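{- Let $K=\mathbb{F}_q$ be a finite field with $q$ elements. Let $\mathcal{G}$ be a bipartite (simple, finite) graph with a perfect matching, with $n=2k$ vertices and $m$ connected components, and let $\mathbb{X}$ be the toric set over $K$ parameterized by the edges of $\mathcal{G}$. Let $S=K[X_1,\ldots,X_s]$, where $s$ is the number of edges of $\mathcal{G}$, let $I_{\mathbb{X}}\subseteq S$ be the vanishing ideal of $\mathbb{X}$, and for an integer $d\ge 0$ let $C_{\mathbb{X}}(d)$ be the code of order $d$ parameterized by the edges of $\mathcal{G}$, with minimum distance $\delta_{\mathbb{X}}(d)$. Then: (1) The length of the code $C_{\mathbb{X}}(d)$ is $$|\mathbb{X}|=(q-1)^{n-m-1}.$$ (2) The regularity index of $S/I_{\mathbb{X}}$ satisfies $$\left\lceil \frac{(q-2)(n-1)}{2(q-1)^{m}}\right\rceil \leq \mathrm{reg}(S/I_{\mathbb{X}}) \leq (q-2)(k-1)+(q-1)^{k-m}-1.$$ (3) The dimension of the code $C_{\mathbb{X}}(d)$ satisfies $$\dim_K C_{\mathbb{X}}(d) \geq \sum_{j=0}^{\lfloor d/(q-1)\rfloor} (-1)^j \binom{k-1}{j}\binom{k-1+d-j(q-1)}{k-1}.$$ (4) The minimum distance of the code $C_{\mathbb{X}}(d)$ satisfies $$\left\lceil \frac{\delta_{\mathbb{T}_{n-1}}(2d)}{(q-1)^m}\right\rceil \leq \delta_{\mathbb{X}}(d) \leq (q-1)^{k-m}\,\delta_{\mathbb{T}_{k-1}}(d).$$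
   Context: Let $K=\mathbb{F}_q$ and $K^*=K\setminus\{0\}$. The projective torus of dimension $r-1$ is $\mathbb{T}_{r-1}=\{[t_1,\ldots,t_r]\in\mathbb{P}^{r-1}: t_i\in K^*\text{ for all } i\}$, where $\mathbb{P}^{r-1}$ is the projective space over $K$. For a simple graph $\mathcal{G}$ with vertices $v_1,\ldots,v_n$ and edges $e_1,\ldots,e_s$, and $(t_1,\ldots,t_n)\in(K^*)^n$, put $(t_1,\ldots,t_n)^{e_i}=t_jt_l$ when $e_i=\{v_j,v_l\}$. The toric set parameterized by the edges of $\mathcal{G}$ is $$\mathbb{X}=\{[(t_1,\ldots,t_n)^{e_1},\ldots,(t_1,\ldots,t_n)^{e_s}]\in\mathbb{P}^{s-1}: t_i\in K^*\}.$$ For a nonempty set of points $\mathbb{Z}=\{P_1,\ldots,P_N\}\subseteq\mathbb{T}_{r-1}$ with $N=|\mathbb{Z}|$, and the polynomial ring $A=K[X_1,\ldots,X_r]=\oplus_{d\ge0}A_d$ with the standard grading, the code of order $d$ associated with $\mathbb{Z}$ is the subspace $$C_{\mathbb{Z}}(d)=\left\{\left(\frac{f(P_1)}{X_1^d(P_1)},\ldots,\frac{f(P_N)}{X_1^d(P_N)}\right): f\in A_d\right\}\subseteq K^{N}.$$ Its length is $N$. Its minimum distance $\delta_{\mathbb{Z}}(d)$ is the minimum Hamming weight (number of nonzero entries) of a nonzero vector of $C_{\mathbb{Z}}(d)$. The vanishing ideal $I_{\mathbb{Z}}\subseteq A$ is the ideal generated by the homogeneous polynomials vanishing at all points of $\mathbb{Z}$;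 $I_{\mathbb{Z}}(d)=I_{\mathbb{Z}}\cap A_d$; the Hilbert function is $H_{\mathbb{Z}}(d)=\dim_K(A_d/I_{\mathbb{Z}}(d))=\dim_K C_{\mathbb{Z}}(d)$. The regularity index $\mathrm{reg}(A/I_{\mathbb{Z}})$ is the least integer $d\ge 0$ such that $H_{\mathbb{Z}}(d)=|\mathbb{Z}|$.
   Formalization: The lower bound for reg(S/I_X) in (2) is stated only for k ≥ 2: for k = 1 and q ≥ 3 the graph is a single edge, X is one point, reg = 0, but the claimed lower bound equals 1; everything else is stated for all k ≥ 1. -}

module Defs where

open import Algebra.Bundles using (CommutativeRing; CommutativeSemiring)
open import Algebra.Module.Bundles.Raw using (RawLeftModule)
open import Data.Bool.Base using (Bool; if_then_else_)
open import Data.Fin.Base using (Fin; zero)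
open import Data.Fin.Properties using () renaming (_≟_ to _≟ᶠ_)
open import Data.Fin.Subset using (Subset; _∈_)
open import Data.List.Base as List using (List; []; _∷_; _++_)
open import Data.Nat.Base as ℕ using (ℕ; zero; suc; _≤_)
open import Data.Nat.DivMod using (_/_)
import Data.Nat.Properties as ℕₚ
open import Data.Product using (Σ; ∃; ∃!; ∃₂; _×_; _,_; proj₁; proj₂)
open import Data.Sum.Base using (_⊎_)
open import Data.Vec.Base as Vec using (Vec)
open import Data.Vec.Properties using () renaming (≡-dec to Vec-≡-dec)
import Data.Vec.Functional as Vector
open import Function.Bundles using (Inverse)
open import Function.Properties.Inverse using (Inverse⇒Injection)
import Function.Construct.Symmetry as Symmetry
open import Level using (Level; _⊔_) renaming (suc to lsuc)
open import Relation.Binary.Bundles using (Setoid)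
open import Relation.Binary.Core using (Rel)
open import Relation.Binary.Definitions using (DecidableEquality; Decidable)
open import Relation.Binary.PropositionalEquality.Core using (_≡_; _≢_)
open import Relation.Binary.PropositionalEquality.Properties using () renaming (setoid to ≡-setoid)
import Relation.Binary.Construct.Closure.Equivalence as EqClosure
import Relation.Binary.Construct.On as On
open import Relation.Nullary.Decidable using (does; ¬?; via-injection)
open import Relation.Nullary.Negation using (¬_)
import Relation.Unary as Unary
open Unary using (Pred; _∩_)

HasCardinality : ∀ {a ℓ} → Setoid a ℓ → ℕ → Set (a ⊔ ℓ)
HasCardinality S N = Inverse (≡-setoid (Fin N)) S

IsLeast : ∀ {p} → Pred ℕ p → Pred ℕ p
IsLeast P n = P n × (∀ m → P m → n ≤ m)

-- Total versions of floor and ceiling of a/b; the value at b = 0 is junk.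
⌊_÷_⌋ : ℕ → ℕ → ℕ
⌊ a ÷ zero  ⌋ = 0
⌊ a ÷ suc b ⌋ = a / suc b

⌈_÷_⌉ : ℕ → ℕ → ℕ
⌈ a ÷ zero  ⌉ = 0
⌈ a ÷ suc b ⌉ = (a ℕ.+ b) / suc b

------------------------------------------------------------------------

SameEnds : ∀ {n} → Rel (Fin n × Fin n) _
SameEnds (u , v) (u′ , v′) = (u ≡ u′ × v ≡ v′) ⊎ (u ≡ v′ × v ≡ u′)

-- Vertices v₁,…,vₙ and edges e₁,…,eₛ.  The order in which `ends` lists the
-- two endpoints of an edge carries no meaning.
record SimpleGraph (n s : ℕ) : Set where
  field
    ends       : Fin s → Fin n × Fin n
    loopless   : ∀ e → proj₁ (ends e) ≢ proj₂ (ends e)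
    noMultiple : ∀ e f → SameEnds (ends e) (ends f) → e ≡ f

module _ {n s : ℕ} (G : SimpleGraph n s) where
  open SimpleGraph G

  Incident : Fin n → Fin s → Set
  Incident v e = v ≡ proj₁ (ends e) ⊎ v ≡ proj₂ (ends e)

  -- `EqClosure` below symmetrises this relation.
  Joined : Rel (Fin n) _
  Joined u v = ∃ λ e → ends e ≡ (u , v)

  IsBipartite : Set
  IsBipartite = ∃ λ (side : Fin n → Bool) →
    ∀ e → side (proj₁ (ends e)) ≢ side (proj₂ (ends e))

  HasPerfectMatching : Set
  HasPerfectMatching = ∃ λ (M : Subset s) →
    ∀ v → ∃! _≡_ (λ e → e ∈ M × Incident v e)

  -- Vertices, identified when a path joins them.
  components : Setoid _ _
  components = EqClosure.setoid Joined

------------------------------------------------------------------------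

-- The value of 0# ⁻¹ is unconstrained.
record FiniteField (c ℓ : Level) (q : ℕ) : Set (lsuc (c ⊔ ℓ)) where
  field
    commutativeRing : CommutativeRing c ℓ
  open CommutativeRing commutativeRing public
  infix 8 _⁻¹
  field
    _⁻¹         : Carrier → Carrier
    1≉0         : ¬ (1# ≈ 0#)
    *-inverseʳ  : ∀ x → ¬ (x ≈ 0#) → x * x ⁻¹ ≈ 1#
    cardinality : HasCardinality setoid q

  _≟_ : Decidable _≈_
  _≟_ = via-injection (Inverse⇒Injection (Symmetry.inverse cardinality)) _≟ᶠ_

  open import Relation.Binary.Reasoning.Setoid setoid

  *-nonzero : ∀ {x y} → ¬ (x ≈ 0#) → ¬ (y ≈ 0#) → ¬ (x * y ≈ 0#)
  *-nonzero {x} {y} x≉0 y≉0 xy≈0 = x≉0 (begin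
    x              ≈⟨ *-identityʳ x ⟨
    x * 1#         ≈⟨ *-congˡ (*-inverseʳ y y≉0) ⟨
    x * (y * y ⁻¹) ≈⟨ *-assoc x y (y ⁻¹) ⟨
    x * y * y ⁻¹   ≈⟨ *-congʳ xy≈0 ⟩
    0# * y ⁻¹      ≈⟨ zeroˡ (y ⁻¹) ⟩
    0#             ∎)

  ⁻¹-nonzero : ∀ {x} → ¬ (x ≈ 0#) → ¬ (x ⁻¹ ≈ 0#)
  ⁻¹-nonzero {x} x≉0 x⁻¹≈0 = 1≉0 (begin
    1#         ≈⟨ *-inverseʳ x x≉0 ⟨
    x * x ⁻¹   ≈⟨ *-congˡ x⁻¹≈0 ⟩
    x * 0#     ≈⟨ zeroʳ x ⟩
    0#         ∎)

------------------------------------------------------------------------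

module ToricCodes {c ℓ : Level} {q : ℕ} (K : FiniteField c ℓ q) where
  open FiniteField K hiding (zero)
  open import Algebra.Definitions.RawSemiring
    (CommutativeSemiring.rawSemiring commutativeSemiring) using (_^_; product)
  open import Relation.Binary.Reasoning.Setoid setoid

  ----------------------------------------------------------------------

  module _ {m ℓm} (M : RawLeftModule Carrier m ℓm) where
    open RawLeftModule M
    open import Algebra.Definitions.RawMonoid
      (RawLeftModule.+ᴹ-rawMonoid M) using (sum)

    linearCombination : ∀ {D} → (Fin D → Carrier) → (Fin D → Carrierᴹ) → Carrierᴹ
    linearCombination a b = sum (λ i → a i *ₗ b i)

    -- For subspaces U ⊆ W of M: the quotient W / U has a basis of D elements,
    -- namely the classes of the b i.
    HasQuotientDimension : ∀ {u w} → Pred Carrierᴹ w → Pred Carrierᴹ u → ℕ → Set _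
    HasQuotientDimension W U D = ∃ λ (b : Fin D → Carrierᴹ) →
      (∀ i → W (b i)) ×
      (∀ a → U (linearCombination a b) → ∀ i → a i ≈ 0#) ×
      (∀ x → W x → ∃ λ a → U (x +ᴹ -ᴹ linearCombination a b))

    HasDimension : ∀ {w} → Pred Carrierᴹ w → ℕ → Set _
    HasDimension W = HasQuotientDimension W (_≈ᴹ 0ᴹ)

  K^ : ℕ → RawLeftModule Carrier c ℓ
  K^ N = record
    { Carrierᴹ = Fin N → Carrier
    ; _≈ᴹ_     = λ v w → ∀ i → v i ≈ w i
    ; _+ᴹ_     = λ v w i → v i + w i
    ; _*ₗ_     = λ a v i → a * v i
    ; 0ᴹ       = λ _ → 0#
    ; -ᴹ_      = λ v i → - v i
    }

  ----------------------------------------------------------------------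

  Exponent : ℕ → Set
  Exponent r = Vec ℕ r

  _≟ᵉ_ : ∀ {r} → DecidableEquality (Exponent r)
  _≟ᵉ_ = Vec-≡-dec ℕₚ._≟_

  -- K[X₁,…,Xᵣ]: formal sums of terms a X^α, where an exponent may be repeated;
  -- polynomials are these lists up to equality of all coefficients (_≈ᴾ_).
  Polynomial : ℕ → Set c
  Polynomial r = List (Carrier × Exponent r)

  coefficient : ∀ {r} → Polynomial r → Exponent r → Carrier
  coefficient []            α = 0#
  coefficient ((a , β) ∷ f) α =
    if does (β ≟ᵉ α) then a + coefficient f α else coefficient f α

  infix 4 _≈ᴾ_
  _≈ᴾ_ : ∀ {r} → Rel (Polynomial r) ℓ
  f ≈ᴾ g = ∀ α → coefficient f α ≈ coefficient g α

  infixl 7 _*ᴾ_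
  _*ᴾ_ : ∀ {r} → Polynomial r → Polynomial r → Polynomial r
  _*ᴾ_ = List.cartesianProductWith
    (λ (a , α) (b , β) → a * b , Vec.zipWith ℕ._+_ α β)

  polynomials : ℕ → RawLeftModule Carrier c ℓ
  polynomials r = record
    { Carrierᴹ = Polynomial r
    ; _≈ᴹ_     = _≈ᴾ_
    ; _+ᴹ_     = _++_
    ; _*ₗ_     = λ a → List.map (λ (b , β) → a * b , β)
    ; 0ᴹ       = []
    ; -ᴹ_      = List.map (λ (b , β) → - b , β)
    }

  evaluate : ∀ {r} → Polynomial r → (Fin r → Carrier) → Carrier
  evaluate []            x = 0#
  evaluate ((a , α) ∷ f) x =
    a * product (λ i → x i ^ Vec.lookup α i) + evaluate f x

  -- f ∈ A_d; in particular the zero polynomial lies in every A_d.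
  Homogeneous : ∀ {r} → ℕ → Pred (Polynomial r) ℓ
  Homogeneous d f = ∀ α → Vec.sum α ≢ d → coefficient f α ≈ 0#

  ⟨_⟩ : ∀ {r p} → Pred (Polynomial r) p → Pred (Polynomial r) (c ⊔ ℓ ⊔ p)
  ⟨_⟩ {r} G f = ∃ λ N → ∃₂ λ (a g : Fin N → Polynomial r) →
    (∀ i → G (g i)) × f ≈ᴾ Vector.foldr _++_ [] (λ i → a i *ᴾ g i)

  ----------------------------------------------------------------------

  -- A representative [x₀,…,xᵣ] of a point of ℙ^r.
  record Point (r : ℕ) : Set (c ⊔ ℓ) where
    field
      coord   : Fin (suc r) → Carrier
      nonzero : ¬ (∀ i → coord i ≈ 0#)
  open Point public

  infix 4 _∼_
  _∼_ : ∀ {r} → Rel (Point r) (c ⊔ ℓ)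
  P ∼ Q = ∃ λ λ′ → ¬ (λ′ ≈ 0#) × (∀ i → coord P i ≈ λ′ * coord Q i)

  ℙ : ℕ → Setoid (c ⊔ ℓ) (c ⊔ ℓ)
  ℙ r = record
    { Carrier = Point r
    ; _≈_ = _∼_
    ; isEquivalence = record
      { refl  = 1# , 1≉0 , λ i → sym (*-identityˡ _)
      ; sym   = λ {P} {Q} (a , a≉0 , P≈aQ) → a ⁻¹ , ⁻¹-nonzero a≉0 , λ i → begin
          coord Q i               ≈⟨ *-identityˡ _ ⟨
          1# * coord Q i          ≈⟨ *-congʳ (trans (*-comm _ _) (*-inverseʳ a a≉0)) ⟨
          a ⁻¹ * a * coord Q i    ≈⟨ *-assoc _ _ _ ⟩
          a ⁻¹ * (a * coord Q i)  ≈⟨ *-congˡ (P≈aQ i) ⟨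
          a ⁻¹ * coord P i        ∎
      ; trans = λ {P} {Q} {R} (a , a≉0 , P≈aQ) (b , b≉0 , Q≈bR) →
          a * b , *-nonzero a≉0 b≉0 , λ i → begin
          coord P i            ≈⟨ P≈aQ i ⟩
          a * coord Q i        ≈⟨ *-congˡ (Q≈bR i) ⟩
          a * (b * coord R i)  ≈⟨ *-assoc _ _ _ ⟨
          a * b * coord R i    ∎
      }
    }

  pointsOf : ∀ {r z} → Pred (Point r) z → Setoid (c ⊔ ℓ ⊔ z) (c ⊔ ℓ)
  pointsOf {r} Z = On.setoid {B = Σ (Point r) Z} (ℙ r) proj₁

  -- A numbering P₁,…,P_N of Z without repetition.
  Enumeration : ∀ {r z} → Pred (Point r) z → ℕ → Set (c ⊔ ℓ ⊔ z)
  Enumeration Z N = HasCardinality (pointsOf Z) N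

  𝕋 : ∀ r → Pred (Point r) ℓ
  𝕋 r P = ∀ i → ¬ (coord P i ≈ 0#)

  -- The number of edges is written suc s-1, so that the toric set lies in ℙ^(s-1).
  module _ {n s-1 : ℕ} (G : SimpleGraph n (suc s-1)) where
    open SimpleGraph G

    edgePoint : (t : Fin n → Carrier) → (∀ j → ¬ (t j ≈ 0#)) → Point s-1
    edgePoint t t≉0 = record
      { coord   = λ e → t (proj₁ (ends e)) * t (proj₂ (ends e))
      ; nonzero = λ all≈0 → *-nonzero (t≉0 _) (t≉0 _) (all≈0 zero)
      }

    toricSet : Pred (Point s-1) (c ⊔ ℓ)
    toricSet P = ∃₂ λ t t≉0 → P ∼ edgePoint t t≉0

  ----------------------------------------------------------------------

  module _ {r z} (Z : Pred (Point r) z) where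

    HomogeneousVanishing : Pred (Polynomial (suc r)) _
    HomogeneousVanishing f =
      (∃ λ d → Homogeneous d f) × (∀ P → Z P → evaluate f (coord P) ≈ 0#)

    vanishingIdeal : Pred (Polynomial (suc r)) _
    vanishingIdeal = ⟨ HomogeneousVanishing ⟩

    -- dim_K A_d / I_Z(d) = h
    HasHilbertValue : ℕ → ℕ → Set _
    HasHilbertValue d h = HasQuotientDimension (polynomials (suc r))
      (Homogeneous d) (vanishingIdeal ∩ Homogeneous d) h

    IsRegularityIndex : ℕ → Set _
    IsRegularityIndex = IsLeast λ d →
      ∃ λ N → HasCardinality (pointsOf Z) N × HasHilbertValue d N

  ----------------------------------------------------------------------

  -- Meaningful for Z ⊆ 𝕋 r, where the denominators X₁^d(Pᵢ) are nonzero; the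
  -- quotient then does not depend on the representatives of the points.
  code : ∀ {r z N} {Z : Pred (Point r) z} → Enumeration Z N → ℕ →
         Pred (Fin N → Carrier) (c ⊔ ℓ)
  code {r} P d v = ∃ λ (f : Polynomial (suc r)) → Homogeneous d f ×
    (∀ i → let x = coord (proj₁ (Inverse.to P i)) in
           v i ≈ evaluate f x * (x zero ^ d) ⁻¹)

  weight : ∀ {N} → (Fin N → Carrier) → ℕ
  weight v = Vec.count (λ x → ¬? (x ≟ 0#)) (Vec.tabulate v)

  IsMinimumDistance : ∀ {N a} → Pred (Fin N → Carrier) a → ℕ → Set _
  IsMinimumDistance C = IsLeast λ w →
    ∃ λ v → C v × ¬ (∀ i → v i ≈ 0#) × weight v ≡ w

-- Fix a root in every component of the graph, and let w be the matching partner
-- of one of them.  Every point of X has exactly one parameter t that is 1 at the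
-- roots and at w: if two such parameters have proportional edge products, the
-- factor is 1 because of the edge at w, and then equality spreads along paths.
-- This counts X, and it bounds the fibres of 𝕋_(n-1) → X by (q-1)^m and those of
-- the projection X → 𝕋_(k-1) to the matching edges by (q-1)^(k-m).  Pulling
-- polynomials back along the two maps gives the bounds on the minimum distance.
--
-- Parameters equal to 1 on one side of the bipartition embed 𝕋_(k-1) linearly in
-- X.  Hence monomials in the matching edges with exponents at most q-2 (in all
-- edges but one) remain independent on X, and the alternating sum counts them.
-- Likewise a polynomial of degree d that isolates a point of X isolates a point
-- of 𝕋_(k-1), and d ≥ (q-2)(k-1) because power sums over K* vanish; for k ≥ 2
-- this is at least the asserted lower bound for the regularity index.  Conversely, a
-- point of X is isolated by (q-2)(k-1) linear forms that cut out its fibre over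
-- 𝕋_(k-1), times one linear form for each further point of that fibre.

module Submission where

open import Algebra.Bundles using (CommutativeSemiring)
open import Data.Bool.Base using (Bool; true; false; not; if_then_else_)
import Data.Bool.Properties as Boolₚ
open import Data.Empty using (⊥-elim)
open import Data.Fin.Base as Fin using (Fin; zero; suc; toℕ; splitAt; join; _↑ˡ_; _↑ʳ_)
import Data.Fin.Permutation as Perm
import Data.Fin.Properties as Finₚ
open import Data.Integer.Base as ℤ using (ℤ; -1ℤ; +_; +≤+)
import Data.Integer.Properties as ℤₚ
import Data.Integer.Tactic.RingSolver as ℤSolver
open import Data.List.Base as List using (List; []; _∷_; _++_)
open import Data.List.Membership.Propositional using (_∈_)
open import Data.List.Membership.Propositional.Properties using (∈-lookup; ∈-map⁻; ∈-++⁻)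
import Data.List.Properties as Listₚ
open import Data.List.Relation.Unary.All as All using (All; []; _∷_)
import Data.List.Relation.Unary.All.Properties as Allₚ
open import Data.List.Relation.Unary.AllPairs using ([]; _∷_)
open import Data.List.Relation.Unary.Any using (Any; here; there)
import Data.List.Relation.Unary.Any.Properties as Anyₚ
open import Data.List.Relation.Unary.Unique.Propositional using (Unique)
import Data.List.Relation.Unary.Unique.Propositional.Properties as Uniqueₚ
open import Data.Nat.Base as ℕ using (ℕ; zero; suc; _≤_; _<_; s≤s; z≤n)
open import Data.Nat.Combinatorics using (_C_; nCn≡1; nCk+nC[k+1]≡[n+1]C[k+1])
open import Data.Nat.DivMod using (_/_; m<n⇒m/n≡0; m/n≡1+[m∸n]/n; m<n*o⇒m/o<n)
import Data.Nat.Properties as ℕₚ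
import Data.Nat.Tactic.RingSolver as ℕSolver
open import Data.Product using (∃; _×_; _,_; proj₁; proj₂)
open import Data.Sum.Base using (_⊎_; inj₁; inj₂; swap; [_,_]′)
open import Data.Vec.Base as Vec using (Vec; []; _∷_)
import Data.Vec.Functional as Vector
import Data.Vec.Properties as Vecₚ
open import Function.Base using (_∘_; id)
open import Function.Bundles using (Inverse)
open import Function.Definitions using (Injective)
open import Relation.Binary.Bundles using (Setoid)
open import Relation.Binary.Construct.Closure.Equivalence using (EqClosure)
open import Relation.Binary.Construct.Closure.ReflexiveTransitive using (ε; _◅_)
open import Relation.Binary.Construct.Closure.Symmetric using (fwd; bwd)
open import Relation.Binary.PropositionalEquality as ≡ using (_≡_; _≢_)
open import Relation.Nullary.Decidable using (Dec; yes; no; does; dec-true; dec-false; decidable-stable; ¬?; _×-dec_)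
open import Relation.Nullary.Negation using (¬_)
open import Relation.Unary using (Pred; Decidable; ∁)
open import Defs

-- Bipartiteness enters the counts as follows. Multiplying a parameter by α_c on one side of
-- component c and by ν/α_c on the other multiplies every edge product by ν, so it does not move the
-- point of X. These m + 1 units are what it takes to make the m roots and w equal to 1. Scaling the
-- whole parameter is one of these moves, so m of them remain on 𝕋_(n-1). Of the k matching edges, m
-- carry a root; there the root has value 1 and the edge value gives the other end. Each of the
-- other k - m edges leaves one unit undetermined. The alternating sum is the coefficient of z^d in
-- (1 - z^(q-1))^(k-1) / (1 - z)^k, the number of exponents in k - 1 variables with entries at most
-- q - 2 and total at most d. Points are known only up to a scalar and polynomials only up to
-- equality of coefficients. Arguments therefore transport nonvanishing, which scaling preserves,
-- rather than values, and terms that cancel are deleted before degrees are counted.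

module Combinatorics where
  open import Data.Nat.Base using (_+_; _*_; _∸_)
  open import Relation.Binary.PropositionalEquality
  open import Algebra.Properties.CommutativeMonoid.Sum ℤₚ.+-0-commutativeMonoid
    using (sum⁺-syntax; sum-cong-≗; ∑-distrib-+; sum-replicate-zero) renaming (sum to ∑ℤ)
  open import Algebra.Properties.Semiring.Sum ℤₚ.+-*-semiring using (*-distribˡ-sum)

  -- Counting subsets of a finite set

  -- `index` takes a proof of `P j`, but `at-index` and `at-injective` make its result independent
  -- of that proof, so `P` need not be a proposition.
  record Enumerates {n p} (P : Pred (Fin n) p) (c : ℕ) : Set p where
    field
      at           : Fin c → Fin n
      holds        : ∀ i → P (at i)
      index        : ∀ {j} → P j → Fin c
      at-index     : ∀ {j} (pj : P j) → at (index pj) ≡ j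
      at-injective : Injective _≡_ _≡_ at

  -- Phrased with `Vec.count` over `Vec.tabulate` so that the size of the support of a vector is its
  -- `weight` by definition.
  enumerates : ∀ {a q} {A : Set a} {Q : Pred A q} (Q? : Decidable Q) {n} (v : Fin n → A) →
               Enumerates (Q ∘ v) (Vec.count Q? (Vec.tabulate v))
  enumerates Q? {zero} v = record
    { at = λ () ; holds = λ () ; index = λ { {()} } ; at-index = λ { {()} } ; at-injective = λ { {()} } }
  enumerates {Q = Q} Q? {suc n} v with Q? (v zero) | enumerates Q? (v ∘ suc)
  ... | yes q | E = record
    { at = at′ ; holds = holds′ ; index = index′ ; at-index = at-index′ ; at-injective = at-injective′ }
    where
    module E = Enumerates E
    at′ : Fin (suc _) → Fin (suc n)
    at′ zero    = zero
    at′ (suc i) = suc (E.at i)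
    holds′ : ∀ i → Q (v (at′ i))
    holds′ zero    = q
    holds′ (suc i) = E.holds i
    index′ : ∀ {j} → Q (v j) → Fin (suc _)
    index′ {zero}  _ = zero
    index′ {suc j} p = suc (E.index p)
    at-index′ : ∀ {j} (p : Q (v j)) → at′ (index′ p) ≡ j
    at-index′ {zero}  _ = refl
    at-index′ {suc j} p = cong suc (E.at-index p)
    at-injective′ : Injective _≡_ _≡_ at′
    at-injective′ {zero}  {zero}  _  = refl
    at-injective′ {suc i} {suc j} eq = cong suc (E.at-injective (Finₚ.suc-injective eq))
  ... | no ¬q | E = record
    { at           = suc ∘ E.at
    ; holds        = E.holds
    ; index        = λ { {zero} q → ⊥-elim (¬q q) ; {suc j} p → E.index p }
    ; at-index     = λ { {zero} q → ⊥-elim (¬q q) ; {suc j} p → cong suc (E.at-index p) }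
    ; at-injective = λ eq → E.at-injective (Finₚ.suc-injective eq)
    }
    where module E = Enumerates E

  enumerate : ∀ {n p} {P : Pred (Fin n) p} → Decidable P → ∃ (Enumerates P)
  enumerate P? = _ , enumerates P? id

  card-≤ : ∀ {n p a b} {P : Pred (Fin n) p} → Enumerates P a → (f : ∀ j → P j → Fin b) →
           (∀ {i j} pi pj → f i pi ≡ f j pj → i ≡ j) → a ≤ b
  card-≤ E f f-inj = Finₚ.injective⇒≤ {f = λ i → f (at i) (holds i)}
    (λ eq → at-injective (f-inj _ _ eq))
    where open Enumerates E

  card-unique : ∀ {n p a b} {P : Pred (Fin n) p} → Enumerates P a → (f : ∀ j → P j → Fin b) →
           (∀ {i j} pi pj → f i pi ≡ f j pj → i ≡ j) →
           (g : Fin b → Fin n) → (∀ i → P (g i)) → Injective _≡_ _≡_ g → a ≡ b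
  card-unique E f f-inj g pg g-inj = ℕₚ.≤-antisym (card-≤ E f f-inj)
    (Finₚ.injective⇒≤ {f = λ i → index (pg i)}
      (λ {i} {j} eq → g-inj (trans (sym (at-index (pg i))) (trans (cong at eq) (at-index (pg j))))))
    where open Enumerates E

  card-complement : ∀ {n p a b} {P : Pred (Fin n) p} → Decidable P →
                    Enumerates P a → Enumerates (∁ P) b → a + b ≡ n
  card-complement {n} {a = a} {b} {P} P? E F = ℕₚ.≤-antisym
    (Finₚ.injective⇒≤ {f = to ∘ splitAt a} (λ {i} {j} eq →
      trans (sym (Finₚ.join-splitAt a b i))
        (trans (cong (join a b) (to-inj (splitAt a i) (splitAt a j) eq)) (Finₚ.join-splitAt a b j))))
    (Finₚ.injective⇒≤ {f = from} (λ {i} {j} eq →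
      trans (sym (to∘from i)) (trans (cong (to ∘ splitAt a) eq) (to∘from j))))
    where
    module E = Enumerates E
    module F = Enumerates F
    to : Fin a ⊎ Fin b → Fin n
    to = [ E.at , F.at ]′
    to-inj : ∀ x y → to x ≡ to y → x ≡ y
    to-inj (inj₁ i) (inj₁ j) eq = cong inj₁ (E.at-injective eq)
    to-inj (inj₁ i) (inj₂ j) eq = ⊥-elim (F.holds j (subst P eq (E.holds i)))
    to-inj (inj₂ i) (inj₁ j) eq = ⊥-elim (F.holds i (subst P (sym eq) (E.holds j)))
    to-inj (inj₂ i) (inj₂ j) eq = cong inj₂ (F.at-injective eq)
    from : Fin n → Fin (a + b)
    from j with P? j
    ... | yes p = E.index p ↑ˡ b
    ... | no ¬p = a ↑ʳ F.index ¬p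
    to∘from : ∀ j → to (splitAt a (from j)) ≡ j
    to∘from j with P? j
    ... | yes p = trans (cong to (Finₚ.splitAt-↑ˡ a (E.index p) b)) (E.at-index p)
    ... | no ¬p = trans (cong to (Finₚ.splitAt-↑ʳ a b (F.index ¬p))) (F.at-index ¬p)

  funToFin-injective : ∀ {m n} {f g : Fin m → Fin n} → Fin.funToFin f ≡ Fin.funToFin g → f ≗ g
  funToFin-injective {f = f} {g} eq i = trans (sym (Finₚ.finToFun-funToFin f i))
    (trans (cong (λ x → Fin.finToFun x i) eq) (Finₚ.finToFun-funToFin g i))

  funToFin-cong : ∀ {m n} {f g : Fin m → Fin n} → f ≗ g → Fin.funToFin f ≡ Fin.funToFin g
  funToFin-cong {zero}  f≗g = refl
  funToFin-cong {suc m} f≗g = cong₂ Fin.combine (f≗g zero) (funToFin-cong (f≗g ∘ suc))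

  -- If y were missed, punching it out of the codomain would inject `Fin (suc n)` into `Fin n`.
  injective⇒surjective : ∀ {n} {f : Fin n → Fin n} → Injective _≡_ _≡_ f → ∀ y → ∃ λ x → f x ≡ y
  injective⇒surjective {suc n} {f} f-inj y with Finₚ.any? (λ x → f x Finₚ.≟ y)
  ... | yes hit = hit
  ... | no miss = ⊥-elim (ℕₚ.1+n≰n (Finₚ.injective⇒≤
    {f = λ x → Fin.punchOut {i = y} {f x} (λ eq → miss (x , sym eq))}
    (λ {i} {j} eq → f-inj (Finₚ.punchOut-injective {i = y} {f i} {f j} _ _ eq))))

  -- Lattice points of a box below a hyperplane

  -- (1 - z^Q)^r / (1 - z)^(u+1) as a sequence of coefficients; shift Q is
  -- multiplication by z^Q.
  shift : ℕ → (ℕ → ℤ) → ℕ → ℤ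
  shift zero    f d       = f d
  shift (suc j) f zero    = + 0
  shift (suc j) f (suc d) = shift j f d

  shift-1-comm : ∀ j f d → shift j (shift 1 f) d ≡ shift 1 (shift j f) d
  shift-1-comm zero    f d             = refl
  shift-1-comm (suc j) f zero          = refl
  shift-1-comm (suc zero) f (suc zero) = refl
  shift-1-comm (suc (suc j)) f (suc zero) = refl
  shift-1-comm (suc j) f (suc (suc d)) = shift-1-comm j f (suc d)

  shift-+ : ∀ j {f g h} → (∀ d → f d ≡ g d ℤ.+ h d) → ∀ d → shift j f d ≡ shift j g d ℤ.+ shift j h d
  shift-+ zero    eq d       = eq d
  shift-+ (suc j) eq zero    = refl
  shift-+ (suc j) eq (suc d) = shift-+ j eq d

  shift-∸ : ∀ j f d → j ≤ d → shift j f d ≡ f (d ∸ j)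
  shift-∸ zero    f d       _         = refl
  shift-∸ (suc j) f (suc d) (s≤s j≤d) = shift-∸ j f d j≤d

  shift-> : ∀ j f d → d < j → shift j f d ≡ + 0
  shift-> (suc j) f zero    _         = refl
  shift-> (suc j) f (suc d) (s≤s d<j) = shift-> j f d d<j

  -- Multiplication by 1 + z + ... + z^(w-1): the sum of the w values f(d), f(d-1), ..., cut off at
  -- index 0.
  window : (ℕ → ℤ) → ℕ → ℕ → ℤ
  window f zero    d       = + 0
  window f (suc w) zero    = f 0
  window f (suc w) (suc d) = f (suc d) ℤ.+ window f w d

  -- The hypothesis says F (1 - z) = f, so f (1 + ... + z^(w-1)) = F (1 - z^w).
  window-telescope : ∀ {F f} → (∀ d → F d ≡ shift 1 F d ℤ.+ f d) →
                     ∀ w d → window f w d ≡ F d ℤ.- shift w F d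
  window-telescope {F} eq zero    d       = sym (ℤₚ.+-inverseʳ (F d))
  window-telescope {F} {f} eq (suc w) zero = begin
    f 0                ≡⟨ ℤₚ.+-identityˡ (f 0) ⟨
    + 0 ℤ.+ f 0        ≡⟨ eq 0 ⟨
    F 0                ≡⟨ ℤₚ.+-identityʳ (F 0) ⟨
    F 0 ℤ.- + 0        ∎
    where open ≡-Reasoning
  window-telescope {F} {f} eq (suc w) (suc d) = begin
    f (suc d) ℤ.+ window f w d                  ≡⟨ cong (ℤ._+_ (f (suc d))) (window-telescope eq w d) ⟩
    f (suc d) ℤ.+ (F d ℤ.- shift w F d)         ≡⟨ lemma (f (suc d)) (F d) (shift w F d) ⟩
    (F d ℤ.+ f (suc d)) ℤ.- shift w F d         ≡⟨ cong (ℤ._- shift w F d) (eq (suc d)) ⟨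
    F (suc d) ℤ.- shift w F d                   ∎
    where
    open ≡-Reasoning
    lemma : ∀ a b c → a ℤ.+ (b ℤ.- c) ≡ (b ℤ.+ a) ℤ.- c
    lemma = ℤSolver.solve-∀

  module _ (Q : ℕ) where

    series : ℕ → ℕ → ℕ → ℤ
    series zero    u d = + ((u + d) C u)
    series (suc r) u d = series r u d ℤ.- shift Q (series r u) d

    -- Dividing by one more factor 1 - z takes partial sums. For r = 0 this is Pascal's rule, and
    -- multiplication by 1 - z^Q commutes with it.
    series-step : ∀ r u d → series r (suc u) d ≡ shift 1 (series r (suc u)) d ℤ.+ series r u d
    series-step zero u zero = cong +_ (begin
      (suc u + 0) C suc u  ≡⟨ cong (_C suc u) (ℕₚ.+-identityʳ (suc u)) ⟩
      suc u C suc u        ≡⟨ nCn≡1 (suc u) ⟩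
      1                    ≡⟨ nCn≡1 u ⟨
      u C u                ≡⟨ cong (_C u) (ℕₚ.+-identityʳ u) ⟨
      (u + 0) C u          ∎)
      where open ≡-Reasoning
    series-step zero u (suc d) = cong +_ (begin
      suc (u + suc d) C suc u                     ≡⟨ nCk+nC[k+1]≡[n+1]C[k+1] (u + suc d) u ⟨
      (u + suc d) C u + (u + suc d) C suc u       ≡⟨ ℕₚ.+-comm ((u + suc d) C u) _ ⟩
      (u + suc d) C suc u + (u + suc d) C u       ≡⟨ cong (λ x → x C suc u + (u + suc d) C u) (ℕₚ.+-suc u d) ⟩
      (suc u + d) C suc u + (u + suc d) C u       ∎)
      where open ≡-Reasoning
    series-step (suc r) u d = begin
      F d ℤ.- shift Q F d
        ≡⟨ cong₂ ℤ._-_ (series-step r u d) (shift-+ Q (series-step r u) d) ⟩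
      (shift 1 F d ℤ.+ f d) ℤ.- (shift Q (shift 1 F) d ℤ.+ shift Q f d)
        ≡⟨ lemma (shift 1 F d) _ _ _ ⟩
      (shift 1 F d ℤ.- shift Q (shift 1 F) d) ℤ.+ (f d ℤ.- shift Q f d)
        ≡⟨ cong (ℤ._+ (f d ℤ.- shift Q f d)) (split d) ⟩
      shift 1 (λ d → F d ℤ.- shift Q F d) d ℤ.+ (f d ℤ.- shift Q f d) ∎
      where
      open ≡-Reasoning
      F = series r (suc u)
      f = series r u
      lemma : ∀ a b c e → (a ℤ.+ b) ℤ.- (c ℤ.+ e) ≡ (a ℤ.- c) ℤ.+ (b ℤ.- e)
      lemma = ℤSolver.solve-∀
      split : ∀ d → shift 1 F d ℤ.- shift Q (shift 1 F) d ≡ shift 1 (λ d → F d ℤ.- shift Q F d) d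
      split d = trans (cong (ℤ._-_ (shift 1 F d)) (shift-1-comm Q F d)) (split′ d)
        where
        split′ : ∀ d → shift 1 F d ℤ.- shift 1 (shift Q F) d ≡ shift 1 (λ d → F d ℤ.- shift Q F d) d
        split′ zero    = refl
        split′ (suc d) = refl

    series-window : ∀ r u d → series (suc r) (suc u) d ≡ window (series r u) Q d
    series-window r u d = sym (window-telescope (series-step r u) Q d)

  module _ (p : ℕ) where
    private Q = suc p

    -- The truncated subtraction is exact for the indices j ≤ ⌊d/Q⌋ over which the terms are summed.
    alternatingTerm : ℕ → ℕ → ℕ → ℕ → ℤ
    alternatingTerm r u d j = -1ℤ ℤ.^ j ℤ.* + (r C j) ℤ.* + ((u + (d ∸ j * Q)) C u)

    ∑-zero : ∀ n (f : Fin n → ℤ) → (∀ i → f i ≡ + 0) → ∑ℤ f ≡ + 0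
    ∑-zero n f eq = trans (sum-cong-≗ eq) (sum-replicate-zero n)

    term-pascal : ∀ r u d d′ → d ∸ Q ≡ d′ → ∀ j → alternatingTerm (suc r) u d (suc j)
                  ≡ alternatingTerm r u d (suc j) ℤ.+ -1ℤ ℤ.* alternatingTerm r u d′ j
    term-pascal r u d d′ eq j = begin
      s ℤ.* + (suc r C suc j) ℤ.* B (d ∸ suc j * Q)
        ≡⟨ cong (λ x → s ℤ.* x ℤ.* B (d ∸ suc j * Q)) (cong +_ (sym (nCk+nC[k+1]≡[n+1]C[k+1] r j))) ⟩
      s ℤ.* (+ (r C j) ℤ.+ + (r C suc j)) ℤ.* B (d ∸ suc j * Q)
        ≡⟨ lemma (-1ℤ ℤ.^ j) (+ (r C j)) (+ (r C suc j)) (B (d ∸ suc j * Q)) ⟩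
      alternatingTerm r u d (suc j) ℤ.+ -1ℤ ℤ.* (-1ℤ ℤ.^ j ℤ.* + (r C j) ℤ.* B (d ∸ suc j * Q))
        ≡⟨ cong (λ x → alternatingTerm r u d (suc j) ℤ.+ -1ℤ ℤ.* (-1ℤ ℤ.^ j ℤ.* + (r C j) ℤ.* B x)) dd ⟩
      alternatingTerm r u d (suc j) ℤ.+ -1ℤ ℤ.* alternatingTerm r u d′ j ∎
      where
      open ≡-Reasoning
      s = -1ℤ ℤ.^ suc j
      B : ℕ → ℤ
      B e = + ((u + e) C u)
      dd : d ∸ suc j * Q ≡ d′ ∸ j * Q
      dd = trans (sym (ℕₚ.∸-+-assoc d Q (j * Q))) (cong (_∸ j * Q) eq)
      lemma : ∀ s a b c → -1ℤ ℤ.* s ℤ.* (a ℤ.+ b) ℤ.* c ≡ -1ℤ ℤ.* s ℤ.* b ℤ.* c ℤ.+ -1ℤ ℤ.* (s ℤ.* a ℤ.* c)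
      lemma = ℤSolver.solve-∀

    -- Induction on r expands (1 - z^Q)^r. The sum shifted by Q has one term less; its j-th term
    -- joins the (j+1)-th of the other by Pascal's rule.
    series-closed : ∀ r u d → series Q r u d ≡ ∑[ j ≤ ⌊ d ÷ Q ⌋ ] alternatingTerm r u d (toℕ j)
    series-closed zero u d = sym (trans
      (cong₂ ℤ._+_ (ℤₚ.*-identityˡ (+ ((u + d) C u)))
         (∑-zero ⌊ d ÷ Q ⌋ _ (λ j → cong (ℤ._* + ((u + (d ∸ suc (toℕ j) * Q)) C u)) (ℤₚ.*-zeroʳ (-1ℤ ℤ.^ suc (toℕ j))))))
      (ℤₚ.+-identityʳ _))
    series-closed (suc r) u d with ℕₚ.<-≤-connex d Q
    -- Only j = 0 is left, and `r C 0` is 1 for every r.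
    ... | inj₁ d<Q = trans (cong₂ ℤ._-_ (series-closed r u d) (shift-> Q (series Q r u) d d<Q))
      (trans (ℤₚ.+-identityʳ _) (small (m<n⇒m/n≡0 d<Q)))
      where
      small : ∀ {w} → w ≡ 0 → (∑[ j ≤ w ] alternatingTerm r u d (toℕ j)) ≡ (∑[ j ≤ w ] alternatingTerm (suc r) u d (toℕ j))
      small refl = refl
    ... | inj₂ Q≤d = begin
      series Q r u d ℤ.- shift Q (series Q r u) d
        ≡⟨ cong₂ ℤ._-_ (series-closed r u d) (trans (shift-∸ Q (series Q r u) d Q≤d) (series-closed r u d′)) ⟩
      (∑[ j ≤ d / Q ] alternatingTerm r u d (toℕ j)) ℤ.- (∑[ j ≤ d′ / Q ] alternatingTerm r u d′ (toℕ j))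
        ≡⟨ large (m/n≡1+[m∸n]/n Q≤d) ⟩
      (∑[ j ≤ d / Q ] alternatingTerm (suc r) u d (toℕ j)) ∎
      where
      open ≡-Reasoning
      d′ = d ∸ Q
      large : ∀ {w w′} → w ≡ suc w′ →
        (∑[ j ≤ w ] alternatingTerm r u d (toℕ j)) ℤ.- (∑[ j ≤ w′ ] alternatingTerm r u d′ (toℕ j))
        ≡ (∑[ j ≤ w ] alternatingTerm (suc r) u d (toℕ j))
      large {w′ = w′} refl = begin
        (t₀ ℤ.+ S) ℤ.- S′               ≡⟨ lemma t₀ S S′ ⟩
        t₀ ℤ.+ (S ℤ.+ -1ℤ ℤ.* S′)       ≡⟨ cong (λ x → t₀ ℤ.+ (S ℤ.+ x)) (*-distribˡ-sum {n = suc w′} -1ℤ (alternatingTerm r u d′ ∘ toℕ)) ⟩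
        t₀ ℤ.+ (S ℤ.+ (∑[ j ≤ w′ ] (-1ℤ ℤ.* alternatingTerm r u d′ (toℕ j))))
          ≡⟨ cong (ℤ._+_ t₀) (∑-distrib-+ {n = suc w′} (alternatingTerm r u d ∘ suc ∘ toℕ) (λ j → -1ℤ ℤ.* alternatingTerm r u d′ (toℕ j))) ⟨
        t₀ ℤ.+ (∑[ j ≤ w′ ] (alternatingTerm r u d (suc (toℕ j)) ℤ.+ -1ℤ ℤ.* alternatingTerm r u d′ (toℕ j)))
          ≡⟨ cong (ℤ._+_ t₀) (sum-cong-≗ {suc w′} (λ j → sym (term-pascal r u d d′ refl (toℕ j)))) ⟩
        t₀ ℤ.+ (∑[ j ≤ w′ ] alternatingTerm (suc r) u d (suc (toℕ j))) ∎
        where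
        t₀ = alternatingTerm r u d 0
        S  = ∑[ j ≤ w′ ] alternatingTerm r u d (suc (toℕ j))
        S′ = ∑[ j ≤ w′ ] alternatingTerm r u d′ (toℕ j)
        lemma : ∀ a b c → (a ℤ.+ b) ℤ.- c ≡ a ℤ.+ (b ℤ.+ -1ℤ ℤ.* c)
        lemma = ℤSolver.solve-∀

    box : ∀ r → ℕ → List (Vec ℕ r)
    slab : ∀ r → ℕ → ℕ → ℕ → List (Vec ℕ (suc r))

    box zero    d = [] ∷ []
    box (suc r) d = slab r Q 0 d

    -- First entry at least a, fewer than a + w, total degree at most a + d.
    slab r zero    a d       = []
    slab r (suc w) a zero    = List.map (a ∷_) (box r 0)
    slab r (suc w) a (suc d) = List.map (a ∷_) (box r (suc d)) List.++ slab r w (suc a) d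

    -- Each coordinate contributes a factor 1 + ... + z^(Q-1). The remaining factor 1 / (1 - z)
    -- comes from bounding the total by d instead of fixing it.
    length-box : ∀ r d → + List.length (box r d) ≡ series Q r r d
    length-slab : ∀ r w a d → + List.length (slab r w a d) ≡ window (series Q r r) w d
    length-box zero    d = refl
    length-box (suc r) d = trans (length-slab r Q 0 d) (sym (series-window Q r r d))
    length-slab r zero    a d       = refl
    length-slab r (suc w) a zero    = trans (cong +_ (Listₚ.length-map (a ∷_) (box r 0))) (length-box r 0)
    length-slab r (suc w) a (suc d) = trans
      (cong +_ (Listₚ.length-++ (List.map (a ∷_) (box r (suc d)))))
      (cong₂ ℤ._+_ (trans (cong +_ (Listₚ.length-map (a ∷_) (box r (suc d)))) (length-box r (suc d)))
        (length-slab r w (suc a) d))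

    slab-head : ∀ r w a d {b α} → (b ∷ α) ∈ slab r w a d → a ≤ b
    slab-head r (suc w) a zero h with ∈-map⁻ (a ∷_) h
    ... | _ , _ , refl = ℕₚ.≤-refl
    slab-head r (suc w) a (suc d) h with ∈-++⁻ (List.map (a ∷_) (box r (suc d))) h
    ... | inj₂ h′ = ℕₚ.≤-trans (ℕₚ.n≤1+n a) (slab-head r w (suc a) d h′)
    ... | inj₁ h′ with ∈-map⁻ (a ∷_) h′
    ... | _ , _ , refl = ℕₚ.≤-refl

    box-unique : ∀ r d → Unique (box r d)
    slab-unique : ∀ r w a d → Unique (slab r w a d)
    box-unique zero    d = [] ∷ []
    box-unique (suc r) d = slab-unique r Q 0 d
    slab-unique r zero    a d       = []
    slab-unique r (suc w) a zero    = Uniqueₚ.map⁺ Vecₚ.∷-injectiveʳ (box-unique r 0)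
    slab-unique r (suc w) a (suc d) = Uniqueₚ.++⁺ (Uniqueₚ.map⁺ Vecₚ.∷-injectiveʳ (box-unique r (suc d)))
      (slab-unique r w (suc a) d) disjoint
      where
      disjoint : ∀ {α} → ¬ (α ∈ List.map (a ∷_) (box r (suc d)) × α ∈ slab r w (suc a) d)
      disjoint (h , h′) with ∈-map⁻ (a ∷_) h
      ... | _ , _ , refl = ℕₚ.1+n≰n (slab-head r w (suc a) d h′)

    box-sum : ∀ r d → All (λ α → Vec.sum α ≤ d) (box r d)
    slab-sum : ∀ r w a d → All (λ α → Vec.sum α ≤ a + d) (slab r w a d)
    box-sum zero    d = z≤n ∷ []
    box-sum (suc r) d = slab-sum r Q 0 d
    slab-sum r zero    a d       = []
    slab-sum r (suc w) a zero    = Allₚ.map⁺ (All.map (ℕₚ.+-monoʳ-≤ a) (box-sum r 0))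
    slab-sum r (suc w) a (suc d) = Allₚ.++⁺ (Allₚ.map⁺ (All.map (ℕₚ.+-monoʳ-≤ a) (box-sum r (suc d))))
      (subst (λ x → All (λ α → Vec.sum α ≤ x) (slab r w (suc a) d)) (sym (ℕₚ.+-suc a d)) (slab-sum r w (suc a) d))

    box-small : ∀ r d → All (λ α → ∀ i → Vec.lookup α i < Q) (box r d)
    slab-small : ∀ r w a d → a + w ≤ Q → All (λ α → ∀ i → Vec.lookup α i < Q) (slab r w a d)
    box-small zero    d = (λ ()) ∷ []
    box-small (suc r) d = slab-small r Q 0 d ℕₚ.≤-refl
    cons-small : ∀ {r a} → a < Q → ∀ d → All (λ α → ∀ i → Vec.lookup α i < Q) (List.map (a ∷_) (box r d))
    cons-small a<Q d = Allₚ.map⁺ (All.map (λ small → λ { zero → a<Q ; (suc i) → small i }) (box-small _ d))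
    slab-small r zero    a d       _ = []
    slab-small r (suc w) a zero    h = cons-small (ℕₚ.≤-trans (ℕₚ.≤-reflexive (ℕₚ.+-comm 1 a)) (ℕₚ.≤-trans (ℕₚ.+-monoʳ-≤ a (s≤s z≤n)) h)) 0
    slab-small r (suc w) a (suc d) h = Allₚ.++⁺
      (cons-small (ℕₚ.≤-trans (ℕₚ.≤-reflexive (ℕₚ.+-comm 1 a)) (ℕₚ.≤-trans (ℕₚ.+-monoʳ-≤ a (s≤s z≤n)) h)) (suc d))
      (slab-small r w (suc a) d (ℕₚ.≤-trans (ℕₚ.≤-reflexive (sym (ℕₚ.+-suc a w))) h))

open Combinatorics

-- Identities in commutative semirings

module SemiringIdentities {c ℓ} (R : CommutativeSemiring c ℓ) where
  open CommutativeSemiring R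
  open import Algebra.Solver.Ring.NaturalCoefficients.Default R

  exchange-remainders : ∀ a r x z → a + x * z + r * z ≈ a + r * z + x * z
  exchange-remainders = solve 4 (λ a r x z → (a :+ x :* z :+ r :* z) := (a :+ r :* z :+ x :* z)) refl

  horner-expand : ∀ a x Bx r Br H → a + x * Bx + r * (Br + x * H) ≈ a + r * Br + x * (Bx + r * H)
  horner-expand = solve 6 (λ a x Bx r Br H → (a :+ x :* Bx :+ r :* (Br :+ x :* H)) := (a :+ r :* Br :+ x :* (Bx :+ r :* H))) refl

  bump-expand : ∀ v x b y h → v + x * (b * y + h) ≈ b * (x * y) + (v + x * h)
  bump-expand = solve 5 (λ v x b y h → (v :+ x :* (b :* y :+ h)) := (b :* (x :* y) :+ (v :+ x :* h))) refl

  rotate : ∀ a b c → a * (b * c) ≈ a * c * b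
  rotate = solve 3 (λ a b c → (a :* (b :* c)) := (a :* c :* b)) refl

  *-interchange : ∀ a b c d → a * b * (c * d) ≈ a * c * (b * d)
  *-interchange = solve 4 (λ a b c d → (a :* b :* (c :* d)) := (a :* c :* (b :* d))) refl

  factor-term : ∀ a b c e → a * (b * c) + b * e ≈ b * (a * c + e)
  factor-term = solve 4 (λ a b c e → (a :* (b :* c) :+ b :* e) := (b :* (a :* c :+ e))) refl

  factor-product : ∀ a b m n e → a * b * (m * n) + a * m * e ≈ a * m * (b * n + e)
  factor-product = solve 5 (λ a b m n e → (a :* b :* (m :* n) :+ a :* m :* e) := (a :* m :* (b :* n :+ e))) refl

  +-interchange : ∀ a b c d → (a + b) + (c + d) ≈ (a + c) + (b + d)
  +-interchange = solve 4 (λ a b c d → ((a :+ b) :+ (c :+ d)) := ((a :+ c) :+ (b :+ d))) refl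

  *-reorder : ∀ a b c d → a * b * (c * d) ≈ a * (c * b * d)
  *-reorder = solve 4 (λ a b c d → (a :* b :* (c :* d)) := (a :* (c :* b :* d))) refl

  *-swap : ∀ a b c → a * (b * c) ≈ b * (a * c)
  *-swap = solve 3 (λ a b c → (a :* (b :* c)) := (b :* (a :* c))) refl

  move-last : ∀ a b c d → a * (b * c) * d ≈ a * b * d * c
  move-last = solve 4 (λ a b c d → (a :* (b :* c) :* d) := (a :* b :* d :* c)) refl

-- Algebra over a field with q = p + 2 elements and Q = p + 1 units

module OverField {c ℓ p} (K : FiniteField c ℓ (suc (suc p))) where
  open FiniteField K hiding (zero)
  open ToricCodes K
  open import Algebra.Definitions.RawSemiring
    (CommutativeSemiring.rawSemiring commutativeSemiring) using (_^_; product)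
  open import Algebra.Properties.Semiring.Exp semiring using (^-congˡ; ^-homo-*; ^-assocʳ)
  open import Algebra.Properties.CommutativeSemiring.Exp commutativeSemiring using (^-distrib-*)
  open import Algebra.Properties.Ring ring using (-0#≈0#; -‿distribˡ-*; -‿+-comm)
  open import Algebra.Properties.Semiring.Sum semiring
    using (sum; sum-cong-≋; sum-remove; sum-permute; ∑-distrib-+; *-distribˡ-sum; *-distribʳ-sum; sum-replicate-zero)
  open import Relation.Binary.Reasoning.Setoid setoid

  open SemiringIdentities commutativeSemiring

  private
    Q = suc p

  -- Units

  ⁻¹-inverseˡ : ∀ {x} → ¬ (x ≈ 0#) → x ⁻¹ * x ≈ 1#
  ⁻¹-inverseˡ x≉0 = trans (*-comm _ _) (*-inverseʳ _ x≉0)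

  *-cancelˡ : ∀ {x y z} → ¬ (x ≈ 0#) → x * y ≈ x * z → y ≈ z
  *-cancelˡ {x} {y} {z} x≉0 eq = begin
    y               ≈⟨ *-identityˡ y ⟨
    1# * y          ≈⟨ *-congʳ (⁻¹-inverseˡ x≉0) ⟨
    x ⁻¹ * x * y    ≈⟨ *-assoc _ _ _ ⟩
    x ⁻¹ * (x * y)  ≈⟨ *-congˡ eq ⟩
    x ⁻¹ * (x * z)  ≈⟨ *-assoc _ _ _ ⟨
    x ⁻¹ * x * z    ≈⟨ *-congʳ (⁻¹-inverseˡ x≉0) ⟩
    1# * z          ≈⟨ *-identityˡ z ⟩
    z               ∎

  *-cancelʳ : ∀ {x y z} → ¬ (x ≈ 0#) → y * x ≈ z * x → y ≈ z
  *-cancelʳ x≉0 eq = *-cancelˡ x≉0 (trans (*-comm _ _) (trans eq (*-comm _ _)))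

  cross-multiply : ∀ {a b c d} → ¬ (b ≈ 0#) → ¬ (d ≈ 0#) → a * b ⁻¹ ≈ c * d ⁻¹ → a * d ≈ c * b
  cross-multiply {a} {b} {c} {d} b≉0 d≉0 eq = begin
    a * d                  ≈⟨ *-congʳ (divide-multiply a b≉0) ⟨
    a * b ⁻¹ * b * d       ≈⟨ *-congʳ (*-congʳ eq) ⟩
    c * d ⁻¹ * b * d       ≈⟨ *-assoc _ _ _ ⟩
    c * d ⁻¹ * (b * d)     ≈⟨ *-congˡ (*-comm b d) ⟩
    c * d ⁻¹ * (d * b)     ≈⟨ *-assoc _ _ _ ⟨
    c * d ⁻¹ * d * b       ≈⟨ *-congʳ (divide-multiply c d≉0) ⟩
    c * b                  ∎
    where
    divide-multiply : ∀ a {b} → ¬ (b ≈ 0#) → a * b ⁻¹ * b ≈ a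
    divide-multiply a b≉0 = trans (*-assoc _ _ _) (trans (*-congˡ (⁻¹-inverseˡ b≉0)) (*-identityʳ a))

  nonzero-factorˡ : ∀ {x y} → ¬ (x * y ≈ 0#) → ¬ (x ≈ 0#)
  nonzero-factorˡ xy≉0 x≈0 = xy≉0 (trans (*-congʳ x≈0) (zeroˡ _))

  nonzero-factorʳ : ∀ {x y} → ¬ (x * y ≈ 0#) → ¬ (y ≈ 0#)
  nonzero-factorʳ xy≉0 y≈0 = xy≉0 (trans (*-congˡ y≈0) (zeroʳ _))

  nonzero-cong : ∀ {x y} → x ≈ y → ¬ (x ≈ 0#) → ¬ (y ≈ 0#)
  nonzero-cong x≈y x≉0 y≈0 = x≉0 (trans x≈y y≈0)

  ^-nonzero : ∀ {x} n → ¬ (x ≈ 0#) → ¬ (x ^ n ≈ 0#)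
  ^-nonzero zero    x≉0 = 1≉0
  ^-nonzero (suc n) x≉0 = *-nonzero x≉0 (^-nonzero n x≉0)

  open Inverse cardinality public using () renaming (to to element; from to number; from-cong to number-cong)

  element-number : ∀ x → element (number x) ≈ x
  element-number x = Inverse.inverseˡ cardinality ≡.refl

  number-element : ∀ i → number (element i) ≡ i
  number-element i = Inverse.inverseʳ cardinality refl

  number-injective : ∀ {x y} → number x ≡ number y → x ≈ y
  number-injective {x} {y} eq = trans (sym (element-number x))
    (trans (reflexive (≡.cong element eq)) (element-number y))

  private
    number≢ : ∀ {x} → ¬ (x ≈ 0#) → number 0# ≢ number x
    number≢ x≉0 eq = x≉0 (sym (number-injective eq))

  abstract
    unit : Fin Q → Carrier
    unit i = element (Fin.punchIn (number 0#) i)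

    unit-nonzero : ∀ i → ¬ (unit i ≈ 0#)
    unit-nonzero i u≈0 = Finₚ.punchInᵢ≢i (number 0#) i
      (≡.trans (≡.sym (number-element _)) (number-cong u≈0))

    unitIndex : ∀ x → ¬ (x ≈ 0#) → Fin Q
    unitIndex x x≉0 = Fin.punchOut (number≢ x≉0)

    unit-unitIndex : ∀ {x} (x≉0 : ¬ (x ≈ 0#)) → unit (unitIndex x x≉0) ≈ x
    unit-unitIndex {x} x≉0 =
      trans (reflexive (≡.cong element (Finₚ.punchIn-punchOut (number≢ x≉0)))) (element-number x)

    -- In particular the index does not depend on the proof that x is nonzero.
    unitIndex-cong : ∀ {x y} (x≉0 : ¬ (x ≈ 0#)) (y≉0 : ¬ (y ≈ 0#)) → x ≈ y → unitIndex x x≉0 ≡ unitIndex y y≉0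
    unitIndex-cong x≉0 y≉0 x≈y = Finₚ.punchOut-cong (number 0#) (number-cong x≈y)

    unitIndex-injective : ∀ {x y} (x≉0 : ¬ (x ≈ 0#)) (y≉0 : ¬ (y ≈ 0#)) → unitIndex x x≉0 ≡ unitIndex y y≉0 → x ≈ y
    unitIndex-injective x≉0 y≉0 eq = trans (sym (unit-unitIndex x≉0))
      (trans (reflexive (≡.cong unit eq)) (unit-unitIndex y≉0))

    unit-injective : ∀ {i j} → unit i ≈ unit j → i ≡ j
    unit-injective {i} {j} eq = Finₚ.punchIn-injective (number 0#) i j
      (≡.trans (≡.sym (number-element _)) (≡.trans (number-cong eq) (number-element _)))

  -- Polynomials in one variable

  horner : ∀ {n} → Vec Carrier n → Carrier → Carrier
  horner []       x = 0#
  horner (a ∷ as) x = a + x * horner as x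

  AllZero : ∀ {n} → Vec Carrier n → Set ℓ
  AllZero as = ∀ j → Vec.lookup as j ≈ 0#

  horner-zero : ∀ {n} (as : Vec Carrier n) x → AllZero as → horner as x ≈ 0#
  horner-zero []       x _ = refl
  horner-zero (a ∷ as) x z = begin
    a + x * horner as x  ≈⟨ +-cong (z zero) (*-congˡ (horner-zero as x (z ∘ suc))) ⟩
    0# + x * 0#          ≈⟨ +-identityˡ _ ⟩
    x * 0#               ≈⟨ zeroʳ x ⟩
    0#                   ∎

  -- The quotient of as(X) - as(r) by X - r.
  quotient : ∀ {n} → Carrier → Vec Carrier (suc n) → Vec Carrier n
  quotient r (a ∷ [])         = []
  quotient r (a ∷ as@(_ ∷ _)) = horner as r ∷ quotient r as

  -- This is as(x) - as(r) = (x - r) q(x), with the negative terms moved across so that identities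
  -- of semirings suffice.
  horner-quotient : ∀ {n} (as : Vec Carrier (suc n)) r x →
    horner as x + r * horner (quotient r as) x ≈ horner as r + x * horner (quotient r as) x
  horner-quotient (a ∷ []) r x = exchange-remainders a r x 0#
  horner-quotient (a ∷ as@(_ ∷ _)) r x = begin
    a + x * Bx + r * (Br + x * H)    ≈⟨ horner-expand a x Bx r Br H ⟩
    a + r * Br + x * (Bx + r * H)    ≈⟨ +-congˡ (*-congˡ (horner-quotient as r x)) ⟩
    a + r * Br + x * (Br + x * H)    ∎
    where
    Bx = horner as x
    Br = horner as r
    H  = horner (quotient r as) x

  -- The entries of the quotient are the values at r of the successive proper tails of the list.
  -- When they are all zero, the coefficients vanish from the top down.
  quotient-zero : ∀ {n} (as : Vec Carrier (suc n)) r →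
                  AllZero (quotient r as) → horner as r ≈ 0# → AllZero as
  quotient-zero (a ∷ as) r z h≈0 = λ { zero → a≈0 as≈0 ; (suc j) → as≈0 j }
    where
    tail-zero : ∀ {n} a (as : Vec Carrier n) → AllZero (quotient r (a ∷ as)) → AllZero as
    tail-zero a []         z = λ ()
    tail-zero a (b ∷ bs) z = quotient-zero (b ∷ bs) r (z ∘ suc) (z zero)
    as≈0 : AllZero as
    as≈0 = tail-zero a as z
    a≈0 : AllZero as → a ≈ 0#
    a≈0 z′ = begin
      a                    ≈⟨ +-identityʳ a ⟨
      a + 0#               ≈⟨ +-congˡ (zeroʳ r) ⟨
      a + r * 0#           ≈⟨ +-congˡ (*-congˡ (horner-zero as r z′)) ⟨
      a + r * horner as r  ≈⟨ h≈0 ⟩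
      0#                   ∎

  -- Divide by X - r, where r is the first point. At any other point x′ the division identity
  -- reduces to r q(x′) = x′ q(x′) with r ≠ x′, so q(x′) = 0 and induction applies to q.
  too-many-roots : ∀ {n} (as : Vec Carrier n) (x : Fin n → Carrier) → Injective _≡_ _≈_ x →
                   (∀ i → horner as (x i) ≈ 0#) → AllZero as
  too-many-roots []            x x-inj roots = λ ()
  too-many-roots as@(_ ∷ _) x x-inj roots = quotient-zero as r
    (too-many-roots (quotient r as) (x ∘ suc) (λ eq → Finₚ.suc-injective (x-inj eq)) roots′) (roots zero)
    where
    r = x zero
    roots′ : ∀ i → horner (quotient r as) (x (suc i)) ≈ 0#
    roots′ i with horner (quotient r as) (x (suc i)) ≟ 0#
    ... | yes H≈0 = H≈0
    ... | no  H≉0 = ⊥-elim (Finₚ.0≢1+n (x-inj (*-cancelʳ H≉0 (begin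
      r * H                      ≈⟨ +-identityˡ _ ⟨
      0# + r * H                 ≈⟨ +-congʳ (roots (suc i)) ⟨
      horner as x′ + r * H       ≈⟨ horner-quotient as r x′ ⟩
      horner as r + x′ * H       ≈⟨ +-congʳ (roots zero) ⟩
      0# + x′ * H                ≈⟨ +-identityˡ _ ⟩
      x′ * H                     ∎))))
      where
      x′ = x (suc i)
      H  = horner (quotient r as) x′

  horner-bump : ∀ {n} i → i < n → ∀ b (v : Fin n → Carrier) x →
    horner (Vec.tabulate {n = n} (λ j → if does (i ℕₚ.≟ toℕ j) then b + v j else v j)) x
    ≈ b * x ^ i + horner (Vec.tabulate v) x
  horner-bump {suc n} zero    _         b v x =
    trans (+-assoc _ _ _) (+-congʳ (sym (*-identityʳ b)))
  horner-bump {suc n} (suc i) (s≤s i<n) b v x = begin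
    v zero + x * horner bumped x             ≈⟨ +-congˡ (*-congˡ (horner-bump i i<n b (v ∘ suc) x)) ⟩
    v zero + x * (b * x ^ i + H)             ≈⟨ bump-expand (v zero) x b (x ^ i) H ⟩
    b * (x * x ^ i) + (v zero + x * H)       ∎
    where
    bumped = Vec.tabulate {n = n} (λ j → if does (i ℕₚ.≟ toℕ j) then b + v (suc j) else v (suc j))
    H = horner (Vec.tabulate (v ∘ suc)) x

  -- Coefficients and values of polynomials

  monomial : ∀ {r} → (Fin r → Carrier) → Exponent r → Carrier
  monomial x α = product (λ i → x i ^ Vec.lookup α i)

  monomial-cong : ∀ {r} {x y : Fin r → Carrier} → (∀ i → x i ≈ y i) → ∀ α → monomial x α ≈ monomial y α
  monomial-cong x≈y []      = refl
  monomial-cong x≈y (a ∷ α) = *-cong (^-congˡ a (x≈y zero)) (monomial-cong (x≈y ∘ suc) α)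

  evaluate-cong : ∀ {r} (f : Polynomial r) {x y} → (∀ i → x i ≈ y i) → evaluate f x ≈ evaluate f y
  evaluate-cong []            x≈y = refl
  evaluate-cong ((a , α) ∷ f) x≈y = +-cong (*-congˡ (monomial-cong x≈y α)) (evaluate-cong f x≈y)

  coefficient-hit : ∀ {r} a {α β : Exponent r} f → α ≡ β → coefficient ((a , α) ∷ f) β ≡ a + coefficient f β
  coefficient-hit a {α} {β} f eq rewrite dec-true (α ≟ᵉ β) eq = ≡.refl

  coefficient-miss : ∀ {r} a (α β : Exponent r) f → α ≢ β → coefficient ((a , α) ∷ f) β ≡ coefficient f β
  coefficient-miss a α β f neq rewrite dec-false (α ≟ᵉ β) neq = ≡.refl

  -- The coefficient of X₁^j when a polynomial is read as one in X₁ over the ring in the other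
  -- variables.
  slice : ∀ {r} → ℕ → Polynomial (suc r) → Polynomial r
  slice j []                = []
  slice j ((a , i ∷ α) ∷ f) = if does (i ℕₚ.≟ j) then (a , α) ∷ slice j f else slice j f

  coefficient-slice : ∀ {r} (f : Polynomial (suc r)) j α → coefficient f (j ∷ α) ≡ coefficient (slice j f) α
  coefficient-slice []                j α = ≡.refl
  coefficient-slice ((a , i ∷ β) ∷ f) j α with does (i ℕₚ.≟ j)
  ... | false = coefficient-slice f j α
  ... | true with does (β ≟ᵉ α)
  ...   | false = coefficient-slice f j α
  ...   | true  = ≡.cong (λ b → a + b) (coefficient-slice f j α)

  Headed : ∀ {r} → ℕ → Polynomial (suc r) → Set c
  Headed n = All (λ (_ , α) → Vec.head α < n)

  evaluate-slices : ∀ {r} n (f : Polynomial (suc r)) → Headed n f → ∀ x →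
    evaluate f x ≈ horner (Vec.tabulate {n = n} (λ j → evaluate (slice (toℕ j) f) (x ∘ suc))) (x zero)
  evaluate-slices n [] [] x = sym (horner-zero (Vec.tabulate {n = n} (λ _ → 0#)) (x zero)
    (λ j → reflexive (Vecₚ.lookup∘tabulate {n = n} (λ _ → 0#) j)))
  evaluate-slices n ((a , i ∷ α) ∷ f) (i<n ∷ h) x = begin
    a * (x zero ^ i * Y) + evaluate f x
      ≈⟨ +-cong (rotate a (x zero ^ i) Y) (evaluate-slices n f h x) ⟩
    a * Y * x zero ^ i + horner (Vec.tabulate v) (x zero)
      ≈⟨ horner-bump i i<n (a * Y) v (x zero) ⟨
    horner (Vec.tabulate {n = n} (λ j → if does (i ℕₚ.≟ toℕ j) then a * Y + v j else v j)) (x zero)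
      ≡⟨ ≡.cong (λ as → horner as (x zero)) (Vecₚ.tabulate-cong {n = n} (λ j → float (does (i ℕₚ.≟ toℕ j)) (slice (toℕ j) f))) ⟩
    horner (Vec.tabulate {n = n} (λ j → evaluate (slice (toℕ j) ((a , i ∷ α) ∷ f)) (x ∘ suc))) (x zero) ∎
    where
    Y = monomial (x ∘ suc) α
    v : Fin n → Carrier
    v j = evaluate (slice (toℕ j) f) (x ∘ suc)
    float : ∀ b g → (if b then a * Y + evaluate g (x ∘ suc) else evaluate g (x ∘ suc))
                    ≡ evaluate (if b then (a , α) ∷ g else g) (x ∘ suc)
    float false g = ≡.refl
    float true  g = ≡.refl

  evaluate-constant : ∀ (f : Polynomial 0) x → evaluate f x ≈ coefficient f []
  evaluate-constant []             x = refl
  evaluate-constant ((a , []) ∷ f) x = +-cong (*-identityʳ a) (evaluate-constant f x)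

  Headed-bound : ∀ {r} (f : Polynomial (suc r)) → ∃ λ n → Headed n f
  Headed-bound []                = 0 , []
  Headed-bound ((a , i ∷ α) ∷ f) with Headed-bound f
  ... | n , h = suc i ℕ.⊔ n , ℕₚ.m≤m⊔n (suc i) n ∷ All.map (λ lt → ℕₚ.≤-trans lt (ℕₚ.m≤n⊔m (suc i) n)) h

  -- Distant terms of the list may cancel, so induction on f fails. The induction is on the number
  -- of variables: every slice of f again has zero coefficients.
  evaluate-zero : ∀ {r} (f : Polynomial r) → f ≈ᴾ [] → ∀ x → evaluate f x ≈ 0#
  evaluate-zero {zero}  f f≈0 x = trans (evaluate-constant f x) (f≈0 [])
  evaluate-zero {suc r} f f≈0 x with Headed-bound f
  ... | n , h = trans (evaluate-slices n f h x) (horner-zero (Vec.tabulate v) (x zero) (λ j →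
    trans (reflexive (Vecₚ.lookup∘tabulate v j))
      (evaluate-zero (slice (toℕ j) f)
        (λ α → trans (reflexive (≡.sym (coefficient-slice f (toℕ j) α))) (f≈0 (toℕ j ∷ α))) (x ∘ suc))))
    where
    v : Fin n → Carrier
    v j = evaluate (slice (toℕ j) f) (x ∘ suc)

  Small : ∀ {r} → Pred (Exponent r) _
  Small α = ∀ i → Vec.lookup α i < Q

  slice-small : ∀ {r} j (f : Polynomial (suc r)) → All (Small ∘ proj₂) f → All (Small ∘ proj₂) (slice j f)
  slice-small j []                _       = []
  slice-small j ((a , i ∷ α) ∷ f) (s ∷ h) with does (i ℕₚ.≟ j)
  ... | false = slice-small j f h
  ... | true  = (s ∘ suc) ∷ slice-small j f h

  -- With the other variables fixed at units, the slices evaluate to the Q coefficients of a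
  -- polynomial in X₁ with Q roots. Hence each slice vanishes on the smaller torus, and induction
  -- applies.
  vanishing⇒zero : ∀ {r} (f : Polynomial r) → All (Small ∘ proj₂) f →
                   (∀ (x : Fin r → Fin Q) → evaluate f (unit ∘ x) ≈ 0#) → ∀ α → Small α → coefficient f α ≈ 0#
  vanishing⇒zero {zero}  f sm van [] _ = trans (sym (evaluate-constant f (unit ∘ λ ()))) (van (λ ()))
  vanishing⇒zero {suc r} f sm van (j ∷ α) s = trans (reflexive (coefficient-slice f j α))
    (vanishing⇒zero (slice j f) (slice-small j f sm) van′ α (s ∘ suc))
    where
    van′ : ∀ y → evaluate (slice j f) (unit ∘ y) ≈ 0#
    van′ y = begin
      evaluate (slice j f) (unit ∘ y)           ≡⟨ ≡.cong (λ j → evaluate (slice j f) (unit ∘ y)) (Finₚ.toℕ-fromℕ< (s zero)) ⟨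
      evaluate (slice (toℕ j′) f) (unit ∘ y)    ≡⟨ Vecₚ.lookup∘tabulate v j′ ⟨
      Vec.lookup (Vec.tabulate v) j′            ≈⟨ too-many-roots (Vec.tabulate v) unit unit-injective roots j′ ⟩
      0#                                        ∎
      where
      j′ = Fin.fromℕ< (s zero)
      v : Fin Q → Carrier
      v j = evaluate (slice (toℕ j) f) (unit ∘ y)
      roots : ∀ i → horner (Vec.tabulate v) (unit i) ≈ 0#
      roots i = trans (sym (evaluate-slices Q f (All.map (λ { {_ , _ ∷ _} s → s zero }) sm) x)) (trans
        (evaluate-cong f (λ { zero → refl ; (suc _) → refl })) (van (i Vector.∷ y)))
        where
        x : Fin (suc r) → Carrier
        x zero    = unit i
        x (suc l) = unit (y l)

  -- Polynomials as a module

  scaleᴾ : ∀ {r} → Carrier → Polynomial r → Polynomial r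
  scaleᴾ a = List.map (λ (b , β) → a * b , β)

  negᴾ : ∀ {r} → Polynomial r → Polynomial r
  negᴾ = List.map (λ (b , β) → - b , β)

  coefficient-++ : ∀ {r} (f g : Polynomial r) α → coefficient (f ++ g) α ≈ coefficient f α + coefficient g α
  coefficient-++ []            g α = sym (+-identityˡ _)
  coefficient-++ ((a , β) ∷ f) g α with does (β ≟ᵉ α)
  ... | false = coefficient-++ f g α
  ... | true  = trans (+-congˡ (coefficient-++ f g α)) (sym (+-assoc _ _ _))

  coefficient-scale : ∀ {r} b (f : Polynomial r) α → coefficient (scaleᴾ b f) α ≈ b * coefficient f α
  coefficient-scale b []            α = sym (zeroʳ b)
  coefficient-scale b ((a , β) ∷ f) α with does (β ≟ᵉ α)
  ... | false = coefficient-scale b f α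
  ... | true  = trans (+-congˡ (coefficient-scale b f α)) (sym (distribˡ _ _ _))

  coefficient-neg : ∀ {r} (f : Polynomial r) α → coefficient (negᴾ f) α ≈ - coefficient f α
  coefficient-neg []            α = sym -0#≈0#
  coefficient-neg ((a , β) ∷ f) α with does (β ≟ᵉ α)
  ... | false = coefficient-neg f α
  ... | true  = trans (+-congˡ (coefficient-neg f α)) (-‿+-comm a (coefficient f α))

  evaluate-++ : ∀ {r} (f g : Polynomial r) x → evaluate (f ++ g) x ≈ evaluate f x + evaluate g x
  evaluate-++ []            g x = sym (+-identityˡ _)
  evaluate-++ ((a , β) ∷ f) g x = trans (+-congˡ (evaluate-++ f g x)) (sym (+-assoc _ _ _))

  evaluate-scale : ∀ {r} b (f : Polynomial r) x → evaluate (scaleᴾ b f) x ≈ b * evaluate f x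
  evaluate-scale b []            x = sym (zeroʳ b)
  evaluate-scale b ((a , β) ∷ f) x = trans (+-cong (*-assoc b a _) (evaluate-scale b f x)) (sym (distribˡ _ _ _))

  evaluate-neg : ∀ {r} (f : Polynomial r) x → evaluate (negᴾ f) x ≈ - evaluate f x
  evaluate-neg []            x = sym -0#≈0#
  evaluate-neg ((a , β) ∷ f) x = trans (+-congˡ (evaluate-neg f x)) (trans (+-congʳ (sym (-‿distribˡ-* a (monomial x β)))) (-‿+-comm _ _))

  difference-zero⇒≈ : ∀ {a b} → a - b ≈ 0# → a ≈ b
  difference-zero⇒≈ {a} {b} eq = begin
    a            ≈⟨ +-identityʳ a ⟨
    a + 0#       ≈⟨ +-congˡ (-‿inverseˡ b) ⟨
    a + (- b + b) ≈⟨ +-assoc _ _ _ ⟨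
    (a - b) + b  ≈⟨ +-congʳ eq ⟩
    0# + b       ≈⟨ +-identityˡ b ⟩
    b            ∎

  ≈⇒difference-zero : ∀ {a b} → a ≈ b → a - b ≈ 0#
  ≈⇒difference-zero a≈b = trans (+-congʳ a≈b) (-‿inverseʳ _)

  evaluate-resp-≈ᴾ : ∀ {r} (f g : Polynomial r) → f ≈ᴾ g → ∀ x → evaluate f x ≈ evaluate g x
  evaluate-resp-≈ᴾ f g f≈g x = difference-zero⇒≈ (begin
    evaluate f x - evaluate g x            ≈⟨ +-congˡ (evaluate-neg g x) ⟨
    evaluate f x + evaluate (negᴾ g) x     ≈⟨ evaluate-++ f (negᴾ g) x ⟨
    evaluate (f ++ negᴾ g) x               ≈⟨ evaluate-zero (f ++ negᴾ g) zeros x ⟩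
    0#                                     ∎)
    where
    zeros : f ++ negᴾ g ≈ᴾ []
    zeros α = begin
      coefficient (f ++ negᴾ g) α                ≈⟨ coefficient-++ f (negᴾ g) α ⟩
      coefficient f α + coefficient (negᴾ g) α   ≈⟨ +-congˡ (coefficient-neg g α) ⟩
      coefficient f α - coefficient g α          ≈⟨ ≈⇒difference-zero (f≈g α) ⟩
      0#                                         ∎

  -- Homogeneous polynomials

  -- Homogeneity of the list of terms, stronger than Homogeneous.
  OfDegree : ∀ {r} → ℕ → Polynomial r → Set c
  OfDegree d = All (λ (_ , α) → Vec.sum α ≡ d)

  OfDegree⇒Homogeneous : ∀ {r d} {f : Polynomial r} → OfDegree d f → Homogeneous d f
  OfDegree⇒Homogeneous [] α _ = refl
  OfDegree⇒Homogeneous {f = (a , β) ∷ f} (eq ∷ h) α neq = trans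
    (reflexive (coefficient-miss a β α f (λ β≡α → neq (≡.trans (≡.cong Vec.sum (≡.sym β≡α)) eq)))) (OfDegree⇒Homogeneous h α neq)

  module _ {r : ℕ} (d : ℕ) where
    degree? : Decidable (λ ((_ , α) : Carrier × Exponent r) → Vec.sum α ≡ d)
    degree? (_ , α) = Vec.sum α ℕₚ.≟ d

    -- A `Homogeneous` list may contain terms of other degrees that cancel. Deleting them changes no
    -- coefficient and gives a list that is `OfDegree`, as dilation and substitution require.
    homogeneousPart : Polynomial r → Polynomial r
    homogeneousPart = List.filter degree?

    homogeneousPart-degree : ∀ f → OfDegree d (homogeneousPart f)
    homogeneousPart-degree f = Allₚ.all-filter degree? f

    coefficient-homogeneousPart : ∀ f α → Vec.sum α ≡ d → coefficient f α ≈ coefficient (homogeneousPart f) α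
    coefficient-homogeneousPart []            α eq = refl
    coefficient-homogeneousPart ((a , β) ∷ f) α eq with degree? (a , β)
    ... | no neq = trans (reflexive (coefficient-miss a β α f (λ β≡α → neq (≡.trans (≡.cong Vec.sum β≡α) eq))))
      (trans (coefficient-homogeneousPart f α eq)
        (reflexive (≡.cong (λ g → coefficient g α) (≡.sym (Listₚ.filter-reject degree? {a , β} {f} neq)))))
    ... | yes acc = trans head
        (reflexive (≡.cong (λ g → coefficient g α) (≡.sym (Listₚ.filter-accept degree? {a , β} {f} acc))))
      where
      head : coefficient ((a , β) ∷ f) α ≈ coefficient ((a , β) ∷ homogeneousPart f) α
      head with does (β ≟ᵉ α)
      ... | false = coefficient-homogeneousPart f α eq
      ... | true  = +-congˡ (coefficient-homogeneousPart f α eq)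

    homogeneousPart-≈ᴾ : ∀ f → Homogeneous d f → f ≈ᴾ homogeneousPart f
    homogeneousPart-≈ᴾ f hom α with Vec.sum α ℕₚ.≟ d
    ... | yes eq = coefficient-homogeneousPart f α eq
    ... | no neq = trans (hom α neq) (sym (OfDegree⇒Homogeneous (homogeneousPart-degree f) α neq))

    evaluate-homogeneousPart : ∀ f → Homogeneous d f → ∀ x → evaluate f x ≈ evaluate (homogeneousPart f) x
    evaluate-homogeneousPart f hom = evaluate-resp-≈ᴾ f (homogeneousPart f) (homogeneousPart-≈ᴾ f hom)

  monomial-scale : ∀ {r} b (x : Fin r → Carrier) α → monomial (λ i → b * x i) α ≈ b ^ Vec.sum α * monomial x α
  monomial-scale b x []      = sym (*-identityʳ 1#)
  monomial-scale b x (a ∷ α) = begin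
    (b * x zero) ^ a * monomial (λ i → b * x (suc i)) α
      ≈⟨ *-cong (^-distrib-* b (x zero) a) (monomial-scale b (x ∘ suc) α) ⟩
    b ^ a * x zero ^ a * (b ^ Vec.sum α * monomial (x ∘ suc) α)
      ≈⟨ *-interchange (b ^ a) _ _ _ ⟩
    b ^ a * b ^ Vec.sum α * (x zero ^ a * monomial (x ∘ suc) α)
      ≈⟨ *-congʳ (^-homo-* b a (Vec.sum α)) ⟨
    b ^ (a ℕ.+ Vec.sum α) * (x zero ^ a * monomial (x ∘ suc) α) ∎

  evaluate-dilate : ∀ {r d} {f : Polynomial r} → OfDegree d f → ∀ b x →
                    evaluate f (λ i → b * x i) ≈ b ^ d * evaluate f x
  evaluate-dilate [] b x = sym (zeroʳ _)
  evaluate-dilate {d = d} {(a , α) ∷ f} (≡.refl ∷ h) b x = begin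
    a * monomial (λ i → b * x i) α + evaluate f (λ i → b * x i)
      ≈⟨ +-cong (*-congˡ (monomial-scale b x α)) (evaluate-dilate h b x) ⟩
    a * (b ^ d * monomial x α) + b ^ d * evaluate f x
      ≈⟨ factor-term a (b ^ d) _ _ ⟩
    b ^ d * (a * monomial x α + evaluate f x) ∎

  -- Scaling a representative by b multiplies the value by b^d. The value is thus not a function of
  -- the point, but its nonvanishing is.
  evaluate-∼ : ∀ {r d} (f : Polynomial (suc r)) → Homogeneous d f → ∀ {P Q : Point r} → P ∼ Q →
               ¬ (evaluate f (coord P) ≈ 0#) → ¬ (evaluate f (coord Q) ≈ 0#)
  evaluate-∼ {d = d} f hom {P} {Q} (b , b≉0 , eq) = nonzero-factorʳ ∘ nonzero-cong (begin
    evaluate f (coord P)                           ≈⟨ evaluate-cong f eq ⟩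
    evaluate f (λ i → b * coord Q i)               ≈⟨ evaluate-homogeneousPart d f hom _ ⟩
    evaluate (homogeneousPart d f) (λ i → b * coord Q i) ≈⟨ evaluate-dilate (homogeneousPart-degree d f) b (coord Q) ⟩
    b ^ d * evaluate (homogeneousPart d f) (coord Q)     ≈⟨ *-congˡ (evaluate-homogeneousPart d f hom _) ⟨
    b ^ d * evaluate f (coord Q) ∎)

  -- Monomial substitutions

  monomial-0 : ∀ {r} (x : Fin r → Carrier) → monomial x (Vec.replicate r 0) ≈ 1#
  monomial-0 {zero}  x = refl
  monomial-0 {suc r} x = trans (*-identityˡ _) (monomial-0 (x ∘ suc))

  monomial-+ : ∀ {r} (x : Fin r → Carrier) α β → monomial x (Vec.zipWith ℕ._+_ α β) ≈ monomial x α * monomial x β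
  monomial-+ x []      []      = sym (*-identityʳ 1#)
  monomial-+ x (a ∷ α) (b ∷ β) = begin
    x zero ^ (a ℕ.+ b) * monomial (x ∘ suc) (Vec.zipWith ℕ._+_ α β)
      ≈⟨ *-cong (^-homo-* (x zero) a b) (monomial-+ (x ∘ suc) α β) ⟩
    x zero ^ a * x zero ^ b * (monomial (x ∘ suc) α * monomial (x ∘ suc) β)
      ≈⟨ *-interchange (x zero ^ a) _ _ _ ⟩
    x zero ^ a * monomial (x ∘ suc) α * (x zero ^ b * monomial (x ∘ suc) β) ∎

  1^ : ∀ a → 1# ^ a ≈ 1#
  1^ zero    = refl
  1^ (suc a) = trans (*-identityˡ _) (1^ a)

  monomial-* : ∀ {r} (x : Fin r → Carrier) a α → monomial x (Vec.map (a ℕ.*_) α) ≈ monomial x α ^ a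
  monomial-* x a []      = sym (1^ a)
  monomial-* x a (b ∷ β) = begin
    x zero ^ (a ℕ.* b) * monomial (x ∘ suc) (Vec.map (a ℕ.*_) β)
      ≈⟨ *-cong (trans (reflexive (≡.cong (x zero ^_) (ℕₚ.*-comm a b))) (sym (^-assocʳ (x zero) b a))) (monomial-* (x ∘ suc) a β) ⟩
    (x zero ^ b) ^ a * monomial (x ∘ suc) β ^ a
      ≈⟨ ^-distrib-* (x zero ^ b) _ a ⟨
    (x zero ^ b * monomial (x ∘ suc) β) ^ a ∎

  substituteExponent : ∀ {s n} → (Fin s → Exponent n) → Exponent s → Exponent n
  substituteExponent φ []      = Vec.replicate _ 0
  substituteExponent φ (a ∷ α) = Vec.zipWith ℕ._+_ (Vec.map (a ℕ.*_) (φ zero)) (substituteExponent (φ ∘ suc) α)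

  -- The polynomial f(X^φ(1), …, X^φ(s)).
  substitute : ∀ {s n} → (Fin s → Exponent n) → Polynomial s → Polynomial n
  substitute φ = List.map (λ (a , α) → a , substituteExponent φ α)

  monomial-substitute : ∀ {s n} (φ : Fin s → Exponent n) x α →
    monomial x (substituteExponent φ α) ≈ monomial (λ e → monomial x (φ e)) α
  monomial-substitute φ x []      = monomial-0 x
  monomial-substitute φ x (a ∷ α) = trans (monomial-+ x (Vec.map (a ℕ.*_) (φ zero)) _)
    (*-cong (monomial-* x a (φ zero)) (monomial-substitute (φ ∘ suc) x α))

  evaluate-substitute : ∀ {s n} (φ : Fin s → Exponent n) f x →
    evaluate (substitute φ f) x ≈ evaluate f (λ e → monomial x (φ e))
  evaluate-substitute φ []            x = refl
  evaluate-substitute φ ((a , α) ∷ f) x = +-cong (*-congˡ (monomial-substitute φ x α)) (evaluate-substitute φ f x)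

  sum-replicate-0 : ∀ n → Vec.sum (Vec.replicate n 0) ≡ 0
  sum-replicate-0 zero    = ≡.refl
  sum-replicate-0 (suc n) = sum-replicate-0 n

  sum-zipWith-+ : ∀ {n} (α β : Vec ℕ n) → Vec.sum (Vec.zipWith ℕ._+_ α β) ≡ Vec.sum α ℕ.+ Vec.sum β
  sum-zipWith-+ []      []      = ≡.refl
  sum-zipWith-+ (a ∷ α) (b ∷ β) = ≡.trans (≡.cong (a ℕ.+ b ℕ.+_) (sum-zipWith-+ α β)) (lemma a b (Vec.sum α) (Vec.sum β))
    where
    lemma : ∀ a b c d → a ℕ.+ b ℕ.+ (c ℕ.+ d) ≡ a ℕ.+ c ℕ.+ (b ℕ.+ d)
    lemma = ℕSolver.solve-∀

  sum-map-* : ∀ {n} a (α : Vec ℕ n) → Vec.sum (Vec.map (a ℕ.*_) α) ≡ a ℕ.* Vec.sum α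
  sum-map-* a []      = ≡.sym (ℕₚ.*-zeroʳ a)
  sum-map-* a (b ∷ β) = ≡.trans (≡.cong (a ℕ.* b ℕ.+_) (sum-map-* a β)) (≡.sym (ℕₚ.*-distribˡ-+ a b (Vec.sum β)))

  sum-substituteExponent : ∀ {s n} (φ : Fin s → Exponent n) w → (∀ e → Vec.sum (φ e) ≡ w) → ∀ α →
    Vec.sum (substituteExponent φ α) ≡ w ℕ.* Vec.sum α
  sum-substituteExponent {n = n} φ w eq [] = ≡.trans (sum-replicate-0 n) (≡.sym (ℕₚ.*-zeroʳ w))
  sum-substituteExponent φ w eq (a ∷ α) = ≡.trans (sum-zipWith-+ (Vec.map (a ℕ.*_) (φ zero)) _)
    (≡.trans (≡.cong₂ ℕ._+_ (≡.trans (sum-map-* a (φ zero)) (≡.cong (a ℕ.*_) (eq zero))) (sum-substituteExponent (φ ∘ suc) w (eq ∘ suc) α))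
      (lemma a w (Vec.sum α)))
    where
    lemma : ∀ a w s → a ℕ.* w ℕ.+ w ℕ.* s ≡ w ℕ.* (a ℕ.+ s)
    lemma = ℕSolver.solve-∀

  -- Applied with w = 1 to pass between edges and torus coordinates, and with w = 2 to replace an
  -- edge by the product of its two ends.
  substitute-degree : ∀ {s n} (φ : Fin s → Exponent n) w d → (∀ e → Vec.sum (φ e) ≡ w) →
    ∀ {f} → OfDegree d f → OfDegree (w ℕ.* d) (substitute φ f)
  substitute-degree φ w d eq []       = []
  substitute-degree φ w d eq (_∷_ {_ , α} h hs) =
    ≡.trans (sum-substituteExponent φ w eq α) (≡.cong (w ℕ.*_) h) ∷ substitute-degree φ w d eq hs

  variableExponent : ∀ {n} → Fin n → Exponent n
  variableExponent zero    = 1 ∷ Vec.replicate _ 0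
  variableExponent (suc i) = 0 ∷ variableExponent i

  sum-variableExponent : ∀ {n} (i : Fin n) → Vec.sum (variableExponent i) ≡ 1
  sum-variableExponent {suc n} zero    = ≡.cong suc (sum-replicate-0 n)
  sum-variableExponent {suc n} (suc i) = sum-variableExponent i

  monomial-variable : ∀ {n} x (i : Fin n) → monomial x (variableExponent i) ≈ x i
  monomial-variable x zero    = trans (*-cong (*-identityʳ _) (monomial-0 (x ∘ suc))) (*-identityʳ _)
  monomial-variable x (suc i) = trans (*-identityˡ _) (monomial-variable (x ∘ suc) i)

  -- Products

  evaluate-*-term : ∀ {r} a α (g : Polynomial r) x →
    evaluate (List.map (λ (b , β) → a * b , Vec.zipWith ℕ._+_ α β) g) x ≈ a * monomial x α * evaluate g x
  evaluate-*-term a α []            x = sym (zeroʳ _)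
  evaluate-*-term a α ((b , β) ∷ g) x = trans
    (+-cong (*-congˡ (monomial-+ x α β)) (evaluate-*-term a α g x)) (factor-product a b (monomial x α) (monomial x β) (evaluate g x))

  evaluate-* : ∀ {r} (f g : Polynomial r) x → evaluate (f *ᴾ g) x ≈ evaluate f x * evaluate g x
  evaluate-* []            g x = sym (zeroˡ _)
  evaluate-* ((a , α) ∷ f) g x = trans
    (evaluate-++ (List.map (λ (b , β) → a * b , Vec.zipWith ℕ._+_ α β) g) (f *ᴾ g) x)
    (trans (+-cong (evaluate-*-term a α g x) (evaluate-* f g x)) (sym (distribʳ _ _ _)))

  *-degree : ∀ {r d e} {f g : Polynomial r} → OfDegree d f → OfDegree e g → OfDegree (d ℕ.+ e) (f *ᴾ g)
  *-degree []                          hg = []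
  *-degree {g = g} (_∷_ {_ , α} h hs) hg = Allₚ.++⁺
    (Allₚ.map⁺ (All.map (λ { {_ , β} h′ → ≡.trans (sum-zipWith-+ α β) (≡.cong₂ ℕ._+_ h h′) }) hg)) (*-degree hs hg)

  1ᴾ : ∀ {r} → Polynomial r
  1ᴾ = (1# , Vec.replicate _ 0) ∷ []

  evaluate-1 : ∀ {r} (x : Fin r → Carrier) → evaluate 1ᴾ x ≈ 1#
  evaluate-1 x = trans (+-identityʳ _) (trans (*-identityˡ _) (monomial-0 x))

  coefficient-1*-term : ∀ {r} (g : Polynomial r) →
    List.map (λ (b , β) → 1# * b , Vec.zipWith ℕ._+_ (Vec.replicate _ 0) β) g ≈ᴾ g
  coefficient-1*-term []            γ = refl
  coefficient-1*-term ((b , β) ∷ g) γ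
    rewrite ≡.trans (Vecₚ.zipWith-replicate₁ ℕ._+_ 0 β) (Vecₚ.map-id β) with does (β ≟ᵉ γ)
  ... | false = coefficient-1*-term g γ
  ... | true  = +-cong (*-identityˡ b) (coefficient-1*-term g γ)

  1*ᴾ : ∀ {r} (g : Polynomial r) → 1ᴾ *ᴾ g ≈ᴾ g
  1*ᴾ g γ = trans (coefficient-++ (List.map (λ (b , β) → 1# * b , Vec.zipWith ℕ._+_ (Vec.replicate _ 0) β) g) [] γ) (trans (+-identityʳ _) (coefficient-1*-term g γ))

  evaluate-ideal : ∀ {r z} (Z : Pred (Point r) z) f → vanishingIdeal Z f → ∀ P → Z P → evaluate f (coord P) ≈ 0#
  evaluate-ideal Z f (N , a , g , g-van , f≈) P ZP = trans
    (evaluate-resp-≈ᴾ f (Vector.foldr _++_ [] (λ i → a i *ᴾ g i)) f≈ (coord P)) (go N a g (λ i → proj₂ (g-van i) P ZP))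
    where
    go : ∀ N (a g : Fin N → Polynomial _) → (∀ i → evaluate (g i) (coord P) ≈ 0#) →
         evaluate (Vector.foldr _++_ [] (λ i → a i *ᴾ g i)) (coord P) ≈ 0#
    go zero    a g van = refl
    go (suc N) a g van = begin
      evaluate (a zero *ᴾ g zero ++ _) (coord P)
        ≈⟨ evaluate-++ (a zero *ᴾ g zero) _ (coord P) ⟩
      evaluate (a zero *ᴾ g zero) (coord P) + _
        ≈⟨ +-cong (trans (evaluate-* (a zero) (g zero) (coord P)) (trans (*-congˡ (van zero)) (zeroʳ _))) (go N (a ∘ suc) (g ∘ suc) (van ∘ suc)) ⟩
      0# + 0#
        ≈⟨ +-identityʳ 0# ⟩
      0# ∎

  -- The ideal is given by generators; f is one of them, exhibited as 1 · f. With `evaluate-ideal`,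
  -- membership of a homogeneous polynomial becomes the same as vanishing on Z.
  homogeneousVanishing⇒ideal : ∀ {r z} (Z : Pred (Point r) z) f d → Homogeneous d f →
    (∀ P → Z P → evaluate f (coord P) ≈ 0#) → vanishingIdeal Z f
  homogeneousVanishing⇒ideal Z f d hom van = 1 , (λ _ → 1ᴾ) , (λ _ → f) , (λ _ → (d , hom) , van) ,
    λ α → sym (trans (coefficient-++ (1ᴾ *ᴾ f) [] α) (trans (+-identityʳ _) (1*ᴾ f α)))

  -- Power sums over the units

  sum-zero : ∀ {n} (f : Fin n → Carrier) → (∀ i → f i ≈ 0#) → sum f ≈ 0#
  sum-zero {n} f f≈0 = trans (sum-cong-≋ f≈0) (sum-replicate-zero n)

  sum-single : ∀ {n} (f : Fin n → Carrier) i → (∀ j → j ≢ i → f j ≈ 0#) → sum f ≈ f i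
  sum-single {suc n} f i f≈0 = trans (sum-remove {i = i} f)
    (trans (+-congˡ (sum-zero _ (λ j → f≈0 _ (Finₚ.punchInᵢ≢i i j)))) (+-identityʳ _))

  -- Otherwise X^(j+1) - 1, of degree below Q, would vanish at all units, and its leading
  -- coefficient 1 would be 0. This stands in for a primitive element of K.
  nontrivial-power : ∀ j → suc j < Q → ∃ λ i → ¬ (unit i ^ suc j ≈ 1#)
  nontrivial-power j j<Q with Finₚ.any? (λ i → ¬? ((unit i ^ suc j) ≟ 1#))
  ... | yes hit = hit
  ... | no  all = ⊥-elim (1≉0 (begin
    1#                              ≈⟨ +-identityʳ 1# ⟨
    1# + 0#                         ≡⟨ coefficient-hit 1# {α = suc j ∷ []} ((- 1# , 0 ∷ []) ∷ []) ≡.refl ⟨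
    coefficient f (suc j ∷ [])      ≈⟨ vanishing⇒zero f ((λ { zero → j<Q }) ∷ (λ { zero → s≤s z≤n }) ∷ []) vanish (suc j ∷ []) (λ { zero → j<Q }) ⟩
    0#                              ∎))
    where
    f : Polynomial 1
    f = (1# , suc j ∷ []) ∷ (- 1# , 0 ∷ []) ∷ []
    vanish : ∀ x → evaluate f (unit ∘ x) ≈ 0#
    vanish x = begin
      1# * (unit (x zero) ^ suc j * 1#) + (- 1# * (1# * 1#) + 0#)
        ≈⟨ +-cong (trans (*-identityˡ _) (*-identityʳ _))
                  (trans (+-identityʳ _) (trans (*-congˡ (*-identityʳ 1#)) (*-identityʳ _))) ⟩
      unit (x zero) ^ suc j - 1#
        ≈⟨ ≈⇒difference-zero (decidable-stable (_ ≟ _) (λ neq → all (x zero , neq))) ⟩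
      0# ∎

  powerSum : ℕ → Carrier
  powerSum j = sum (λ i → unit i ^ j)

  -- Multiplication by a unit permutes the summands.
  powerSum-zero : ∀ j → suc j < Q → powerSum (suc j) ≈ 0#
  powerSum-zero j j<Q with nontrivial-power j j<Q
  ... | l , nontrivial = decidable-stable (_ ≟ _) (λ S≉0 → nontrivial (*-cancelʳ S≉0 (begin
    u ^ suc j * powerSum (suc j)             ≈⟨ *-distribˡ-sum (u ^ suc j) (λ i → unit i ^ suc j) ⟩
    sum (λ i → u ^ suc j * unit i ^ suc j)   ≈⟨ sum-cong-≋ (λ i → ^-distrib-* u (unit i) (suc j)) ⟨
    sum (λ i → (u * unit i) ^ suc j)         ≈⟨ sum-cong-≋ (λ i → ^-congˡ (suc j) (unit-unitIndex (scaled≉0 i))) ⟨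
    sum (λ i → unit (scale i) ^ suc j)       ≈⟨ sum-permute (λ i → unit i ^ suc j) (Perm.permutation scale unscale invˡ invʳ) ⟨
    powerSum (suc j)                         ≈⟨ *-identityˡ _ ⟨
    1# * powerSum (suc j)                    ∎)))
    where
    u = unit l
    u≉0 = unit-nonzero l
    scaled≉0 : ∀ i → ¬ (u * unit i ≈ 0#)
    scaled≉0 i = *-nonzero u≉0 (unit-nonzero i)
    unscaled≉0 : ∀ i → ¬ (u ⁻¹ * unit i ≈ 0#)
    unscaled≉0 i = *-nonzero (⁻¹-nonzero u≉0) (unit-nonzero i)
    scale unscale : Fin Q → Fin Q
    scale i   = unitIndex (u * unit i) (scaled≉0 i)
    unscale i = unitIndex (u ⁻¹ * unit i) (unscaled≉0 i)
    invˡ : ∀ i → scale (unscale i) ≡ i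
    invˡ i = unit-injective (begin
      unit (scale (unscale i))   ≈⟨ unit-unitIndex _ ⟩
      u * unit (unscale i)       ≈⟨ *-congˡ (unit-unitIndex _) ⟩
      u * (u ⁻¹ * unit i)        ≈⟨ *-assoc _ _ _ ⟨
      u * u ⁻¹ * unit i          ≈⟨ *-congʳ (*-inverseʳ u u≉0) ⟩
      1# * unit i                ≈⟨ *-identityˡ _ ⟩
      unit i                     ∎)
    invʳ : ∀ i → unscale (scale i) ≡ i
    invʳ i = unit-injective (begin
      unit (unscale (scale i))   ≈⟨ unit-unitIndex _ ⟩
      u ⁻¹ * unit (scale i)      ≈⟨ *-congˡ (unit-unitIndex _) ⟩
      u ⁻¹ * (u * unit i)        ≈⟨ *-assoc _ _ _ ⟨
      u ⁻¹ * u * unit i          ≈⟨ *-congʳ (⁻¹-inverseˡ u≉0) ⟩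
      1# * unit i                ≈⟨ *-identityˡ _ ⟩
      unit i                     ∎)

  units : ∀ {r} → Vec (Fin Q) r → Fin r → Carrier
  units v i = unit (Vec.lookup v i)

  -- Σ y₁⋯yᵣ g(y) over all y with unit entries: the weight y₁⋯yᵣ makes every
  -- monomial of degree below r(q - 2) sum to zero.
  weightedSum : ∀ r → (Vec (Fin Q) r → Carrier) → Carrier
  weightedSum zero    g = g []
  weightedSum (suc r) g = sum (λ i → unit i * weightedSum r (λ v → g (i ∷ v)))

  weightedSum-+ : ∀ r g h → weightedSum r (λ v → g v + h v) ≈ weightedSum r g + weightedSum r h
  weightedSum-+ zero    g h = refl
  weightedSum-+ (suc r) g h = trans
    (sum-cong-≋ {Q} {λ i → unit i * weightedSum r (λ v → g (i ∷ v) + h (i ∷ v))} {λ i → G i + H i} (λ i →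
      trans (*-congˡ (weightedSum-+ r (λ v → g (i ∷ v)) (λ v → h (i ∷ v)))) (distribˡ (unit i) _ _)))
    (∑-distrib-+ G H)
    where
    G H : Fin Q → Carrier
    G i = unit i * weightedSum r (λ v → g (i ∷ v))
    H i = unit i * weightedSum r (λ v → h (i ∷ v))

  weightedSum-* : ∀ r b g → weightedSum r (λ v → b * g v) ≈ b * weightedSum r g
  weightedSum-* zero    b g = refl
  weightedSum-* (suc r) b g = trans
    (sum-cong-≋ {Q} {λ i → unit i * weightedSum r (λ v → b * g (i ∷ v))} {λ i → b * G i} (λ i →
      trans (*-congˡ (weightedSum-* r b (λ v → g (i ∷ v)))) (*-swap (unit i) b _)))
    (sym (*-distribˡ-sum b G))
    where
    G : Fin Q → Carrier
    G i = unit i * weightedSum r (λ v → g (i ∷ v))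

  weightedSum-0 : ∀ r g → (∀ v → g v ≈ 0#) → weightedSum r g ≈ 0#
  weightedSum-0 zero    g g≈0 = g≈0 []
  weightedSum-0 (suc r) g g≈0 = sum-zero (λ i → unit i * weightedSum r (λ v → g (i ∷ v)))
    (λ i → trans (*-congˡ (weightedSum-0 r (λ v → g (i ∷ v)) (λ v → g≈0 (i ∷ v)))) (zeroʳ (unit i)))

  -- If the first exponent a is below p, the weight raises it to a + 1, strictly between 0 and q -
  -- 1, and its power sum is 0; unweighted, a = 0 would contribute q - 1 = -1. If a ≥ p, the other
  -- exponents satisfy the bound for one variable less.
  weightedSum-monomial : ∀ r (α : Exponent r) → Vec.sum α < r ℕ.* p →
                         weightedSum r (λ v → monomial (units v) α) ≈ 0#
  weightedSum-monomial (suc r) (a ∷ α) lt = begin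
    sum (λ i → unit i * weightedSum r (λ v → unit i ^ a * monomial (units v) α))
      ≈⟨ sum-cong-≋ {Q} {λ i → unit i * weightedSum r (λ v → unit i ^ a * monomial (units v) α)} {λ i → unit i ^ suc a * w} (λ i →
           trans (*-congˡ (weightedSum-* r (unit i ^ a) (λ v → monomial (units v) α))) (sym (*-assoc (unit i) (unit i ^ a) w))) ⟩
    sum (λ i → unit i ^ suc a * w)   ≈⟨ *-distribʳ-sum w (λ i → unit i ^ suc a) ⟨
    powerSum (suc a) * w             ≈⟨ either (a ℕₚ.<? p) ⟩
    0#                               ∎
    where
    w = weightedSum r (λ v → monomial (units v) α)
    either : Dec (a < p) → powerSum (suc a) * w ≈ 0#
    either (yes a<p) = trans (*-congʳ (powerSum-zero a (s≤s a<p))) (zeroˡ w)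
    either (no  a≮p) = trans (*-congˡ (weightedSum-monomial r α
      (ℕₚ.+-cancelˡ-< p _ _ (ℕₚ.≤-<-trans (ℕₚ.+-monoˡ-≤ (Vec.sum α) (ℕₚ.≮⇒≥ a≮p)) lt)))) (zeroʳ _)

  affinePoint : ∀ {r} → Vec (Fin Q) r → Fin (suc r) → Carrier
  affinePoint v zero    = 1#
  affinePoint v (suc i) = units v i

  weightedSum-evaluate : ∀ {r d} {f : Polynomial (suc r)} → OfDegree d f → d < r ℕ.* p →
                         weightedSum r (λ v → evaluate f (affinePoint v)) ≈ 0#
  weightedSum-evaluate {r} [] lt = weightedSum-0 r (λ _ → 0#) (λ v → refl)
  weightedSum-evaluate {r} {f = (b , a ∷ α) ∷ f} (≡.refl ∷ h) lt = begin
    weightedSum r (λ v → b * (1# ^ a * monomial (units v) α) + evaluate f (affinePoint v))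
      ≈⟨ weightedSum-+ r (λ v → b * (1# ^ a * monomial (units v) α)) (λ v → evaluate f (affinePoint v)) ⟩
    weightedSum r (λ v → b * (1# ^ a * monomial (units v) α)) + weightedSum r (λ v → evaluate f (affinePoint v))
      ≈⟨ +-cong (trans (weightedSum-* r b (λ v → 1# ^ a * monomial (units v) α)) (*-congˡ (weightedSum-* r (1# ^ a) (λ v → monomial (units v) α)))) (weightedSum-evaluate h lt) ⟩
    b * (1# ^ a * weightedSum r (λ v → monomial (units v) α)) + 0#
      ≈⟨ +-identityʳ _ ⟩
    b * (1# ^ a * weightedSum r (λ v → monomial (units v) α))
      ≈⟨ *-congˡ (*-congˡ (weightedSum-monomial r α (ℕₚ.≤-<-trans (ℕₚ.m≤n+m (Vec.sum α) a) lt))) ⟩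
    b * (1# ^ a * 0#)
      ≈⟨ trans (*-congˡ (zeroʳ _)) (zeroʳ b) ⟩
    0# ∎

  oneIndex : Fin Q
  oneIndex = unitIndex 1# 1≉0

  ones : ∀ {r} → Vec (Fin Q) r
  ones = Vec.replicate _ oneIndex

  weightedSum-delta : ∀ r g → (∀ v → v ≢ ones → g v ≈ 0#) → weightedSum r g ≈ g ones
  weightedSum-delta zero    g g≈0 = refl
  weightedSum-delta (suc r) g g≈0 = begin
    weightedSum (suc r) g
      ≈⟨ sum-single (λ i → unit i * weightedSum r (λ v → g (i ∷ v))) oneIndex (λ j j≢ → trans
           (*-congˡ (weightedSum-0 r (λ v → g (j ∷ v)) (λ v → g≈0 (j ∷ v) (j≢ ∘ Vecₚ.∷-injectiveˡ)))) (zeroʳ (unit j))) ⟩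
    unit oneIndex * weightedSum r (λ v → g (oneIndex ∷ v))
      ≈⟨ *-cong (unit-unitIndex 1≉0) (weightedSum-delta r (λ v → g (oneIndex ∷ v)) (λ v v≢ → g≈0 (oneIndex ∷ v) (v≢ ∘ Vecₚ.∷-injectiveʳ))) ⟩
    1# * g (oneIndex ∷ ones)
      ≈⟨ *-identityˡ _ ⟩
    g ones ∎

  -- The weighted sum of f over the torus is its value at `ones`, where the weight is 1. In degree
  -- below r p that sum is 0.
  indicator-degree : ∀ {r d} {f : Polynomial (suc r)} → OfDegree d f → ¬ (evaluate f (affinePoint ones) ≈ 0#) →
                     (∀ v → v ≢ ones → evaluate f (affinePoint v) ≈ 0#) → r ℕ.* p ≤ d
  indicator-degree {r} {d} {f} deg f1≉0 f≈0 = ℕₚ.≮⇒≥ (λ lt → f1≉0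
    (trans (sym (weightedSum-delta r (λ v → evaluate f (affinePoint v)) f≈0)) (weightedSum-evaluate deg lt)))

  -- Linear algebra

  private
    q : ℕ
    q = suc (suc p)

  abstract
    encode : ∀ n → (Fin n → Carrier) → Fin (q ℕ.^ n)
    encode n a = Fin.funToFin (number ∘ a)

    decode : ∀ n → Fin (q ℕ.^ n) → Fin n → Carrier
    decode n x i = element (Fin.finToFun {q} {n} x i)

    encode-injective : ∀ n {a b : Fin n → Carrier} → encode n a ≡ encode n b → ∀ i → a i ≈ b i
    encode-injective n eq i = number-injective (funToFin-injective eq i)

    decode-injective : ∀ n {x y : Fin (q ℕ.^ n)} → (∀ i → decode n x i ≈ decode n y i) → x ≡ y
    decode-injective n {x} {y} eq = ≡.trans (≡.sym (Finₚ.funToFin-finToFin {n} {q} x)) (≡.trans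
      (funToFin-cong {n} {q} {Fin.finToFun {q} {n} x} {Fin.finToFun {q} {n} y} (λ i →
        ≡.trans (≡.sym (number-element _)) (≡.trans (number-cong (eq i)) (number-element _))))
      (Finₚ.funToFin-finToFin {n} {q} y))

  -- Finiteness of K replaces elimination: dimensions are compared through the
  -- numbers of vectors, and an injective endomap of K^n is surjective.
  injective⇒dimension-≤ : ∀ {h d} (F : (Fin h → Carrier) → Fin d → Carrier) →
    (∀ a b → (∀ i → F a i ≈ F b i) → ∀ i → a i ≈ b i) → h ≤ d
  injective⇒dimension-≤ {h} {d} F F-inj = ℕₚ.≮⇒≥ (λ d<h → ℕₚ.<⇒≱ (ℕₚ.^-monoʳ-< q (s≤s (s≤s z≤n)) d<h)
    (Finₚ.injective⇒≤ {f = λ x → encode d (F (decode h x))} (λ eq →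
      decode-injective h (F-inj _ _ (encode-injective d eq)))))

  sum-difference : ∀ {n} (a b c : Fin n → Carrier) →
    sum (λ i → (a i - b i) * c i) ≈ sum (λ i → a i * c i) - sum (λ i → b i * c i)
  sum-difference {zero}  a b c = sym (-‿inverseʳ 0#)
  sum-difference {suc n} a b c = begin
    (a₀ - b₀) * c₀ + sum (λ i → (a (suc i) - b (suc i)) * c (suc i))
      ≈⟨ +-cong (distribʳ c₀ a₀ (- b₀)) (sum-difference (a ∘ suc) (b ∘ suc) (c ∘ suc)) ⟩
    (a₀ * c₀ + - b₀ * c₀) + (A - B)
      ≈⟨ +-congʳ (+-congˡ (-‿distribˡ-* b₀ c₀)) ⟨
    (a₀ * c₀ + - (b₀ * c₀)) + (A - B)
      ≈⟨ +-interchange _ _ _ _ ⟩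
    (a₀ * c₀ + A) + (- (b₀ * c₀) - B)
      ≈⟨ +-congˡ (-‿+-comm _ _) ⟩
    (a₀ * c₀ + A) - (b₀ * c₀ + B) ∎
    where
    a₀ = a zero
    b₀ = b zero
    c₀ = c zero
    A = sum (λ i → a (suc i) * c (suc i))
    B = sum (λ i → b (suc i) * c (suc i))

  independent⇒spanning : ∀ {n} (B : Fin n → Fin n → Carrier) →
    (∀ a → (∀ j → sum (λ i → a i * B i j) ≈ 0#) → ∀ i → a i ≈ 0#) →
    ∀ v → ∃ λ a → ∀ j → sum (λ i → a i * B i j) ≈ v j
  independent⇒spanning {n} B independent v =
    let (x , eq) = injective⇒surjective φ-injective (encode n v) in
    decode n x , encode-injective n eq
    where
    image : (Fin n → Carrier) → Fin n → Carrier
    image a j = sum (λ i → a i * B i j)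
    φ : Fin (q ℕ.^ n) → Fin (q ℕ.^ n)
    φ x = encode n (image (decode n x))
    φ-injective : Injective _≡_ _≡_ φ
    φ-injective {x} {y} eq = decode-injective n (λ i → difference-zero⇒≈ (independent
      (λ i → decode n x i - decode n y i)
      (λ j → trans (sum-difference (decode n x) (decode n y) (λ i → B i j))
        (≈⇒difference-zero (encode-injective n eq j))) i))

  linearCombination-K^ : ∀ {N D} (a : Fin D → Carrier) (b : Fin D → Fin N → Carrier) j →
    linearCombination (K^ N) a b j ≈ sum (λ i → a i * b i j)
  linearCombination-K^ {D = zero}  a b j = refl
  linearCombination-K^ {N} {suc D} a b j = +-congˡ (linearCombination-K^ {N} (a ∘ suc) (b ∘ suc) j)

  evaluate-linearCombination : ∀ {r D} (a : Fin D → Carrier) (b : Fin D → Polynomial r) x →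
    evaluate (linearCombination (polynomials r) a b) x ≈ sum (λ i → a i * evaluate (b i) x)
  evaluate-linearCombination {D = zero}  a b x = refl
  evaluate-linearCombination {r} {suc D} a b x = trans
    (evaluate-++ (scaleᴾ (a zero) (b zero)) (linearCombination (polynomials r) (a ∘ suc) (b ∘ suc)) x)
    (+-cong (evaluate-scale (a zero) (b zero) x) (evaluate-linearCombination (a ∘ suc) (b ∘ suc) x))

  Homogeneous-++ : ∀ {r d} (f g : Polynomial r) → Homogeneous d f → Homogeneous d g → Homogeneous d (f ++ g)
  Homogeneous-++ f g hf hg α neq = trans (coefficient-++ f g α) (trans (+-cong (hf α neq) (hg α neq)) (+-identityʳ 0#))

  Homogeneous-scale : ∀ {r d} b (f : Polynomial r) → Homogeneous d f → Homogeneous d (scaleᴾ b f)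
  Homogeneous-scale b f hf α neq = trans (coefficient-scale b f α) (trans (*-congˡ (hf α neq)) (zeroʳ b))

  Homogeneous-neg : ∀ {r d} (f : Polynomial r) → Homogeneous d f → Homogeneous d (negᴾ f)
  Homogeneous-neg f hf α neq = trans (coefficient-neg f α) (trans (-‿cong (hf α neq)) -0#≈0#)

  Homogeneous-linearCombination : ∀ {r d D} (a : Fin D → Carrier) (b : Fin D → Polynomial r) →
    (∀ i → Homogeneous d (b i)) → Homogeneous d (linearCombination (polynomials r) a b)
  Homogeneous-linearCombination {D = zero}  a b hom α neq = refl
  Homogeneous-linearCombination {r} {d} {suc D} a b hom = Homogeneous-++ {d = d} (scaleᴾ (a zero) (b zero)) _
    (Homogeneous-scale {d = d} (a zero) (b zero) (hom zero)) (Homogeneous-linearCombination {d = d} (a ∘ suc) (b ∘ suc) (hom ∘ suc))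

  -- Codes and Hilbert functions

  ∼-refl : ∀ {r} (P : Point r) → P ∼ P
  ∼-refl {r} P = Setoid.refl (ℙ r) {P}

  ∼-sym : ∀ {r} {P P′ : Point r} → P ∼ P′ → P′ ∼ P
  ∼-sym {r} {P} {P′} = Setoid.sym (ℙ r) {P} {P′}

  ∼-trans : ∀ {r} {P P′ P″ : Point r} → P ∼ P′ → P′ ∼ P″ → P ∼ P″
  ∼-trans {r} {P} {P′} {P″} = Setoid.trans (ℙ r) {P} {P′} {P″}

  module _ {r z N} {Z : Pred (Point r) z} (P : Enumeration Z N) where

    representative : Fin N → Point r
    representative i = proj₁ (Inverse.to P i)

    representative∈ : ∀ i → Z (representative i)
    representative∈ i = proj₂ (Inverse.to P i)

    position : ∀ {x} → Z x → Fin N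
    position Zx = Inverse.from P (_ , Zx)

    position-∼ : ∀ {x} (Zx : Z x) → representative (position Zx) ∼ x
    position-∼ Zx = Inverse.inverseˡ P ≡.refl

    representative-injective : ∀ {i j} → representative i ∼ representative j → i ≡ j
    representative-injective {i} {j} eq = ≡.trans (≡.sym (Inverse.inverseʳ P (∼-refl (representative i))))
      (≡.trans (Inverse.from-cong P {Inverse.to P i} {Inverse.to P j} eq) (Inverse.inverseʳ P (∼-refl (representative j))))

    position-injective : ∀ {x y} (Zx : Z x) (Zy : Z y) → position Zx ≡ position Zy → x ∼ y
    position-injective {x} {y} Zx Zy eq = ∼-trans {P = x} {representative (position Zx)} {y}
      (∼-sym {P = representative (position Zx)} {x} (position-∼ Zx))
      (≡.subst (λ i → representative i ∼ y) (≡.sym eq) (position-∼ Zy))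

    vanishing-everywhere : ∀ {d} f → Homogeneous d f → (∀ i → evaluate f (coord (representative i)) ≈ 0#) →
                           ∀ x → Z x → evaluate f (coord x) ≈ 0#
    vanishing-everywhere f hom van x Zx = decidable-stable (_ ≟ _) (λ neq →
      evaluate-∼ f hom {x} {representative (position Zx)} (∼-sym {P = representative (position Zx)} {x} (position-∼ Zx)) neq (van _))

    -- Interpolation: subtracting from f the combination with coefficients f(P_i) / b_i(P_i) leaves
    -- a polynomial that vanishes on Z and so lies in the ideal. Independence is read off at P_i,
    -- where only b_i contributes.
    indicators⇒HilbertValue : ∀ d (b : Fin N → Polynomial (suc r)) → (∀ i → Homogeneous d (b i)) →
      (∀ i → ¬ (evaluate (b i) (coord (representative i)) ≈ 0#)) →
      (∀ i j → j ≢ i → evaluate (b i) (coord (representative j)) ≈ 0#) →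
      HasHilbertValue Z d N
    indicators⇒HilbertValue d b hom nonzero vanish = b , hom , independent , spanning
      where
      comb : (Fin N → Carrier) → Polynomial (suc r)
      comb a = linearCombination (polynomials (suc r)) a b
      comb-value : ∀ a j → evaluate (comb a) (coord (representative j)) ≈ a j * evaluate (b j) (coord (representative j))
      comb-value a j = trans (evaluate-linearCombination a b (coord (representative j)))
        (sum-single _ j (λ i i≢j → trans (*-congˡ (vanish i j (i≢j ∘ ≡.sym))) (zeroʳ _)))
      independent : ∀ a → vanishingIdeal Z (comb a) × Homogeneous d (comb a) → ∀ i → a i ≈ 0#
      independent a (ideal , _) i = *-cancelʳ (nonzero i)
        (trans (sym (comb-value a i)) (trans (evaluate-ideal Z (comb a) ideal (representative i) (representative∈ i)) (sym (zeroˡ _))))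
      spanning : ∀ f → Homogeneous d f → ∃ λ a →
        vanishingIdeal Z (f ++ negᴾ (comb a)) × Homogeneous d (f ++ negᴾ (comb a))
      spanning f hf = a , homogeneousVanishing⇒ideal Z rest d hrest (vanishing-everywhere {d} rest hrest van) , hrest
        where
        a : Fin N → Carrier
        a i = evaluate f (coord (representative i)) * evaluate (b i) (coord (representative i)) ⁻¹
        rest = f ++ negᴾ (comb a)
        hrest : Homogeneous d rest
        hrest = Homogeneous-++ {d = d} f (negᴾ (comb a)) hf
          (Homogeneous-neg {d = d} (comb a) (Homogeneous-linearCombination {d = d} a b hom))
        van : ∀ i → evaluate rest (coord (representative i)) ≈ 0#
        van i = begin
          evaluate rest x                           ≈⟨ evaluate-++ f (negᴾ (comb a)) x ⟩
          evaluate f x + evaluate (negᴾ (comb a)) x ≈⟨ +-congˡ (evaluate-neg (comb a) x) ⟩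
          evaluate f x - evaluate (comb a) x        ≈⟨ ≈⇒difference-zero (sym (begin
            evaluate (comb a) x                       ≈⟨ comb-value a i ⟩
            evaluate f x * bx ⁻¹ * bx                 ≈⟨ *-assoc _ _ _ ⟩
            evaluate f x * (bx ⁻¹ * bx)               ≈⟨ *-congˡ (⁻¹-inverseˡ (nonzero i)) ⟩
            evaluate f x * 1#                         ≈⟨ *-identityʳ _ ⟩
            evaluate f x                              ∎)) ⟩
          0#                                        ∎
          where
          x = coord (representative i)
          bx = evaluate (b i) x

    -- The N × N matrix of the values of the basis at the points has independent rows, because a
    -- combination that vanishes on Z lies in the ideal. The rows therefore span, and one
    -- combination of them is the i-th unit vector.
    HilbertValue⇒indicator : ∀ d → HasHilbertValue Z d N → ∀ i → ∃ λ f → Homogeneous d f ×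
      ¬ (evaluate f (coord (representative i)) ≈ 0#) ×
      (∀ j → j ≢ i → evaluate f (coord (representative j)) ≈ 0#)
    HilbertValue⇒indicator d (b , hom , independent , _) i =
        let (a , eq) = independent⇒spanning (λ l j → evaluate (b l) (coord (representative j))) independent′ δ
            value = λ j → trans (evaluate-linearCombination a b (coord (representative j))) (eq j) in
        linearCombination (polynomials (suc r)) a b , Homogeneous-linearCombination {d = d} a b hom ,
        (λ ≈0 → 1≉0 (trans (sym (reflexive hit)) (trans (sym (value i)) ≈0))) ,
        (λ j j≢i → trans (value j) (reflexive (miss j j≢i)))
      where
      δ : Fin N → Carrier
      δ j = if does (j Finₚ.≟ i) then 1# else 0#
      hit : δ i ≡ 1#
      hit rewrite dec-true (i Finₚ.≟ i) ≡.refl = ≡.refl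
      miss : ∀ j → j ≢ i → δ j ≡ 0#
      miss j j≢i rewrite dec-false (j Finₚ.≟ i) j≢i = ≡.refl
      independent′ : ∀ a → (∀ j → sum (λ l → a l * evaluate (b l) (coord (representative j))) ≈ 0#) → ∀ l → a l ≈ 0#
      independent′ a van = independent a (homogeneousVanishing⇒ideal Z comb d hcomb
          (vanishing-everywhere {d} comb hcomb (λ j → trans (evaluate-linearCombination a b _) (van j))) , hcomb)
        where
        comb : Polynomial (suc r)
        comb = linearCombination (polynomials (suc r)) a b
        hcomb : Homogeneous d comb
        hcomb = Homogeneous-linearCombination {d = d} a b hom

  support : ∀ {N} (v : Fin N → Carrier) → Enumerates (λ i → ¬ (v i ≈ 0#)) (weight v)
  support v = enumerates (λ x → ¬? (x ≟ 0#)) v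

  -- Fibre counting: f maps the support of v to that of v′, and g tells apart the positions with
  -- equal image, so a fibre has at most w elements.
  weight-≤ : ∀ {N N′ w} (v : Fin N → Carrier) (v′ : Fin N′ → Carrier) →
    (f : ∀ i → ¬ (v i ≈ 0#) → Fin N′) → (∀ i v≉0 → ¬ (v′ (f i v≉0) ≈ 0#)) →
    (g : Fin N → Fin w) → (∀ {i j} vi≉0 vj≉0 → f i vi≉0 ≡ f j vj≉0 → g i ≡ g j → i ≡ j) →
    weight v ≤ weight v′ ℕ.* w
  weight-≤ v v′ f f≉0 g inj = card-≤ (support v) (λ i v≉0 → Fin.combine (index (f≉0 i v≉0)) (g i))
    (λ {i} {j} vi≉0 vj≉0 eq → let (eq₁ , eq₂) = Finₚ.combine-injective _ _ _ _ eq in inj vi≉0 vj≉0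
      (≡.trans (≡.sym (at-index (f≉0 i vi≉0))) (≡.trans (≡.cong at eq₁) (at-index (f≉0 j vj≉0)))) eq₂)
    where open Enumerates (support v′)

  -- Polynomials with prescribed exponents

  fromCoefficients : ∀ {r} (αs : List (Exponent r)) → (Fin (List.length αs) → Carrier) → Polynomial r
  fromCoefficients []       a = []
  fromCoefficients (α ∷ αs) a = (a zero , α) ∷ fromCoefficients αs (a ∘ suc)

  fromCoefficients-All : ∀ {r q} {R : Pred (Exponent r) q} (αs : List (Exponent r)) a →
    All R αs → All (R ∘ proj₂) (fromCoefficients αs a)
  fromCoefficients-All []       a []       = []
  fromCoefficients-All (α ∷ αs) a (h ∷ hs) = h ∷ fromCoefficients-All αs (a ∘ suc) hs

  coefficient-absent : ∀ {r} (αs : List (Exponent r)) a β → All (_≢ β) αs → coefficient (fromCoefficients αs a) β ≈ 0#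
  coefficient-absent []       a β []       = refl
  coefficient-absent (α ∷ αs) a β (h ∷ hs) =
    trans (reflexive (coefficient-miss (a zero) α β (fromCoefficients αs (a ∘ suc)) h)) (coefficient-absent αs (a ∘ suc) β hs)

  coefficient-fromCoefficients : ∀ {r} (αs : List (Exponent r)) a → Unique αs → ∀ i →
    coefficient (fromCoefficients αs a) (List.lookup αs i) ≈ a i
  coefficient-fromCoefficients (α ∷ αs) a (h ∷ u) zero = trans
    (reflexive (coefficient-hit (a zero) {α} {α} (fromCoefficients αs (a ∘ suc)) ≡.refl))
    (trans (+-congˡ (coefficient-absent αs (a ∘ suc) α (All.map (λ neq → neq ∘ ≡.sym) h))) (+-identityʳ _))
  coefficient-fromCoefficients (α ∷ αs) a (h ∷ u) (suc i) = trans
    (reflexive (coefficient-miss (a zero) α (List.lookup αs i) (fromCoefficients αs (a ∘ suc)) (All.lookup h (∈-lookup i))))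
    (coefficient-fromCoefficients αs (a ∘ suc) u i)

  fromCoefficients-injective : ∀ {r} (αs : List (Exponent r)) → Unique αs → All Small αs → ∀ a b →
    (∀ v → evaluate (fromCoefficients αs a) (units v) ≈ evaluate (fromCoefficients αs b) (units v)) → ∀ i → a i ≈ b i
  fromCoefficients-injective αs u small a b eq i = difference-zero⇒≈ (begin
    a i - b i                                    ≈⟨ +-cong (coefficient-fromCoefficients αs a u i) (-‿cong (coefficient-fromCoefficients αs b u i)) ⟨
    coefficient f α - coefficient g α            ≈⟨ +-congˡ (coefficient-neg g α) ⟨
    coefficient f α + coefficient (negᴾ g) α     ≈⟨ coefficient-++ f (negᴾ g) α ⟨
    coefficient (f ++ negᴾ g) α                  ≈⟨ vanishing⇒zero (f ++ negᴾ g)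
                                                      (Allₚ.++⁺ (fromCoefficients-All αs a small) (Allₚ.map⁺ (fromCoefficients-All αs b small)))
                                                      vanish α (All.lookup small (∈-lookup i)) ⟩
    0#                                           ∎)
    where
    f = fromCoefficients αs a
    g = fromCoefficients αs b
    α = List.lookup αs i
    vanish : ∀ x → evaluate (f ++ negᴾ g) (unit ∘ x) ≈ 0#
    vanish x = begin
      evaluate (f ++ negᴾ g) (unit ∘ x)          ≈⟨ evaluate-++ f (negᴾ g) _ ⟩
      evaluate f (unit ∘ x) + evaluate (negᴾ g) (unit ∘ x) ≈⟨ +-congˡ (evaluate-neg g _) ⟩
      evaluate f (unit ∘ x) - evaluate g (unit ∘ x)        ≈⟨ ≈⇒difference-zero (trans (tab f) (trans (eq (Vec.tabulate x)) (sym (tab g)))) ⟩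
      0# ∎
      where
      tab : ∀ f → evaluate f (unit ∘ x) ≈ evaluate f (units (Vec.tabulate x))
      tab f = evaluate-cong f (λ i → reflexive (≡.cong unit (≡.sym (Vecₚ.lookup∘tabulate x i))))

  -- Undone by setting the new first variable to 1, as `affinePoint` does. The truncated subtraction
  -- is exact for totals at most d, the hypothesis of `homogenise-degree`.
  homogenise : ∀ {r} → ℕ → Polynomial r → Polynomial (suc r)
  homogenise d = List.map (λ (a , α) → a , (d ℕ.∸ Vec.sum α) ∷ α)

  homogenise-degree : ∀ {r d} {f : Polynomial r} → All (λ (_ , α) → Vec.sum α ≤ d) f → OfDegree d (homogenise d f)
  homogenise-degree h = Allₚ.map⁺ (All.map ℕₚ.m∸n+n≡m h)

  evaluate-homogenise : ∀ {r} d (f : Polynomial r) v → evaluate (homogenise d f) (affinePoint v) ≈ evaluate f (units v)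
  evaluate-homogenise d []            v = refl
  evaluate-homogenise d ((a , α) ∷ f) v = +-cong (*-congˡ (trans (*-congʳ (1^ (d ℕ.∸ Vec.sum α))) (*-identityˡ _))) (evaluate-homogenise d f v)

  module _ {r z N} {Z : Pred (Point r) z} (P : Enumeration Z N) (Z⊆𝕋 : ∀ x → Z x → 𝕋 r x) (d : ℕ) where

    codeWord : Polynomial (suc r) → Fin N → Carrier
    codeWord f i = evaluate f (coord (representative P i)) * (coord (representative P i) zero ^ d) ⁻¹

    codeWord-nonzero : ∀ f i → ¬ (evaluate f (coord (representative P i)) ≈ 0#) → ¬ (codeWord f i ≈ 0#)
    codeWord-nonzero f i f≉0 = *-nonzero f≉0
      (⁻¹-nonzero (^-nonzero d (Z⊆𝕋 (representative P i) (representative∈ P i) zero)))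

    -- Nonvanishing at any point of Z suffices to make the word nonzero: it passes to the
    -- representative that the numbering chose.
    minimumDistance-≤ : ∀ {δ} → IsMinimumDistance (code P d) δ → ∀ f → OfDegree d f → ∀ x → Z x →
                        ¬ (evaluate f (coord x) ≈ 0#) → δ ≤ weight (codeWord f)
    minimumDistance-≤ (_ , least) f deg x Zx f≉0 = least (weight (codeWord f))
      (codeWord f , (f , OfDegree⇒Homogeneous deg , λ i → refl) , (λ all≈0 → codeWord-nonzero f (position P Zx) at-position (all≈0 _)) , ≡.refl)
      where
      at-position : ¬ (evaluate f (coord (representative P (position P Zx))) ≈ 0#)
      at-position = evaluate-∼ f (OfDegree⇒Homogeneous deg) {x} {representative P (position P Zx)}
        (∼-sym {P = representative P (position P Zx)} {x} (position-∼ P {x} Zx)) f≉0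

    -- The code supplies only a `Homogeneous` polynomial. Its homogeneous part has the same values,
    -- and its degree can be followed through substitutions.
    minimumWord : ∀ {δ} → IsMinimumDistance (code P d) δ → ∃ λ f → OfDegree d f ×
      (∃ λ i → ¬ (evaluate f (coord (representative P i)) ≈ 0#)) × weight (codeWord f) ≤ δ
    minimumWord ((v , (f , hom , v≈) , v≉0 , w≡) , _) = homogeneousPart d f , homogeneousPart-degree d f ,
      (let (i , vi≉0) = Finₚ.¬∀⟶∃¬ N (λ i → v i ≈ 0#) (λ i → v i ≟ 0#) v≉0 in
        i , nonzero-factorˡ (nonzero-cong (v≈part i) vi≉0)) ,
      ℕₚ.≤-trans (card-≤ (support (codeWord (homogeneousPart d f)))
        (λ i w≉0 → Enumerates.index (support v) {i} (nonzero-cong (sym (v≈part i)) w≉0))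
        (λ {i} {j} wi≉0 wj≉0 eq → ≡.trans
          (≡.sym (Enumerates.at-index (support v) {i} (nonzero-cong (sym (v≈part i)) wi≉0)))
          (≡.trans (≡.cong (Enumerates.at (support v)) eq)
            (Enumerates.at-index (support v) {j} (nonzero-cong (sym (v≈part j)) wj≉0)))))
        (ℕₚ.≤-reflexive w≡)
      where
      v≈part : ∀ i → v i ≈ codeWord (homogeneousPart d f) i
      v≈part i = trans (v≈ i) (*-congʳ (evaluate-homogeneousPart d f hom (coord (representative P i))))

  -- Products of linear forms

  -- (a , e , b , f) stands for the form a X_e - b X_f.
  Form : ℕ → Set c
  Form r = Carrier × Fin r × Carrier × Fin r

  formValue : ∀ {r} → (Fin r → Carrier) → Form r → Carrier
  formValue x (a , e , b , f) = a * x e - b * x f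

  formPolynomial : ∀ {r} → Form r → Polynomial r
  formPolynomial (a , e , b , f) = (a , variableExponent e) ∷ (- b , variableExponent f) ∷ []

  evaluate-form : ∀ {r} (l : Form r) x → evaluate (formPolynomial l) x ≈ formValue x l
  evaluate-form (a , e , b , f) x = +-cong (*-congˡ (monomial-variable x e))
    (trans (+-identityʳ _) (trans (*-congˡ (monomial-variable x f)) (sym (-‿distribˡ-* b (x f)))))

  formProduct : ∀ {r} → List (Form r) → Polynomial r
  formProduct []       = 1ᴾ
  formProduct (l ∷ ls) = formPolynomial l *ᴾ formProduct ls

  formProduct-degree : ∀ {r} (ls : List (Form r)) → OfDegree (List.length ls) (formProduct ls)
  formProduct-degree {r} [] = sum-replicate-0 r ∷ []
  formProduct-degree ((a , e , b , f) ∷ ls) =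
    *-degree (sum-variableExponent e ∷ sum-variableExponent f ∷ []) (formProduct-degree ls)

  evaluate-formProduct : ∀ {r} l (ls : List (Form r)) x →
    evaluate (formProduct (l ∷ ls)) x ≈ formValue x l * evaluate (formProduct ls) x
  evaluate-formProduct l ls x = trans (evaluate-* (formPolynomial l) (formProduct ls) x) (*-congʳ (evaluate-form l x))

  formProduct-nonzero : ∀ {r} (ls : List (Form r)) x → All (λ l → ¬ (formValue x l ≈ 0#)) ls →
                        ¬ (evaluate (formProduct ls) x ≈ 0#)
  formProduct-nonzero []       x []      = nonzero-cong (sym (evaluate-1 x)) 1≉0
  formProduct-nonzero (l ∷ ls) x (h ∷ hs) =
    nonzero-cong (sym (evaluate-formProduct l ls x)) (*-nonzero h (formProduct-nonzero ls x hs))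

  formProduct-zero : ∀ {r} (ls : List (Form r)) x → Any (λ l → formValue x l ≈ 0#) ls →
                     evaluate (formProduct ls) x ≈ 0#
  formProduct-zero (l ∷ ls) x (here h)  = trans (evaluate-formProduct l ls x) (trans (*-congʳ h) (zeroˡ _))
  formProduct-zero (l ∷ ls) x (there h) = trans (evaluate-formProduct l ls x) (trans (*-congˡ (formProduct-zero ls x h)) (zeroʳ _))

  -- Torus points coincide once all their ratios to coordinate 0 agree. If P′₀ P_e ≠ P′_e P₀ for
  -- some e, the form P′₀ X_e - P′_e X₀ separates them.
  separating-form : ∀ {r} {P P′ : Point r} → 𝕋 r P → 𝕋 r P′ → ¬ (P ∼ P′) →
    ∃ λ l → ¬ (formValue (coord P) l ≈ 0#) × formValue (coord P′) l ≈ 0#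
  separating-form {r} {P} {P′} TP TP′ P≁P′
    with Finₚ.any? (λ e → ¬? ((coord P′ zero * coord P e) ≟ (coord P′ e * coord P zero)))
  ... | yes (e , neq) = (coord P′ zero , e , coord P′ e , zero) , (λ eq → neq (difference-zero⇒≈ eq)) ,
    ≈⇒difference-zero (*-comm _ _)
  ... | no all = ⊥-elim (P≁P′ (coord P zero * coord P′ zero ⁻¹ , *-nonzero (TP zero) (⁻¹-nonzero (TP′ zero)) , λ e → begin
    coord P e
      ≈⟨ *-cancelˡ (TP′ zero) (begin
           coord P′ zero * coord P e
             ≈⟨ decidable-stable (_ ≟ _) (λ neq → all (e , neq)) ⟩
           coord P′ e * coord P zero
             ≈⟨ *-identityˡ _ ⟨
           1# * (coord P′ e * coord P zero)
             ≈⟨ *-cong (*-inverseʳ _ (TP′ zero)) (*-comm _ _) ⟨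
           coord P′ zero * coord P′ zero ⁻¹ * (coord P zero * coord P′ e)
             ≈⟨ *-reorder _ _ _ _ ⟩
           coord P′ zero * (coord P zero * coord P′ zero ⁻¹ * coord P′ e) ∎) ⟩
    coord P zero * coord P′ zero ⁻¹ * coord P′ e ∎))

-- Bipartite graphs with a perfect matching

module MatchedGraph {n s m : ℕ} (G : SimpleGraph n s) (bipartite : IsBipartite G)
  (matching : HasPerfectMatching G) (comps : HasCardinality (components G) m) (base : Fin n) where
  open SimpleGraph G
  open import Data.Nat.Base using (_+_; _*_; _∸_)
  open import Relation.Binary.PropositionalEquality

  side : Fin n → Bool
  side = proj₁ bipartite

  Connects : Fin s → Fin n → Fin n → Set
  Connects e u v = SameEnds (ends e) (u , v)

  connects-ends : ∀ e → Connects e (proj₁ (ends e)) (proj₂ (ends e))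
  connects-ends e = inj₁ (refl , refl)

  connects-side : ∀ {e u v} → Connects e u v → side u ≢ side v
  connects-side {e} (inj₁ (refl , refl)) = proj₂ bipartite e
  connects-side {e} (inj₂ (refl , refl)) = proj₂ bipartite e ∘ sym

  connects-sym : ∀ {e u v} → Connects e u v → Connects e v u
  connects-sym = swap

  connects-unique : ∀ {e u v w} → Connects e u v → Connects e v w → w ≡ u
  connects-unique h@(inj₁ (refl , refl)) (inj₁ (eq , _)) = ⊥-elim (connects-side h (cong side eq))
  connects-unique (inj₁ (refl , refl))   (inj₂ (eq , _)) = sym eq
  connects-unique (inj₂ (refl , refl))   (inj₁ (_ , eq)) = sym eq
  connects-unique h@(inj₂ (refl , refl)) (inj₂ (_ , eq)) = ⊥-elim (connects-side h (cong side eq))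

  matchingEdge : Fin n → Fin s
  matchingEdge v = proj₁ (proj₂ matching v)

  private
    otherEnd : ∀ e v → Incident G v e → ∃ (Connects e v)
    otherEnd e v (inj₁ eq) = proj₂ (ends e) , inj₁ (sym eq , refl)
    otherEnd e v (inj₂ eq) = proj₁ (ends e) , inj₂ (refl , sym eq)

    connects⇒incident : ∀ {e u v} → Connects e u v → Incident G v e
    connects⇒incident (inj₁ (_ , eq)) = inj₂ (sym eq)
    connects⇒incident (inj₂ (eq , _)) = inj₁ (sym eq)

    matchingEnd : ∀ v → ∃ (Connects (matchingEdge v) v)
    matchingEnd v = otherEnd (matchingEdge v) v (proj₂ (proj₁ (proj₂ (proj₂ matching v))))

  abstract
    mate : Fin n → Fin n
    mate v = proj₁ (matchingEnd v)

    connects-mate : ∀ v → Connects (matchingEdge v) v (mate v)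
    connects-mate v = proj₂ (matchingEnd v)

  matchingEdge-mate : ∀ v → matchingEdge (mate v) ≡ matchingEdge v
  matchingEdge-mate v = proj₂ (proj₂ (proj₂ matching (mate v)))
    (proj₁ (proj₁ (proj₂ (proj₂ matching v))) , connects⇒incident (connects-mate v))

  mate-involutive : ∀ v → mate (mate v) ≡ v
  mate-involutive v = connects-unique (connects-mate v)
    (subst (λ e → Connects e (mate v) (mate (mate v))) (matchingEdge-mate v) (connects-mate (mate v)))

  mate-injective : Injective _≡_ _≡_ mate
  mate-injective eq = trans (sym (mate-involutive _)) (trans (cong mate eq) (mate-involutive _))

  side-mate : ∀ v → side v ≢ side (mate v)
  side-mate v = connects-side (connects-mate v)

  -- Components

  abstract
    root : Fin m → Fin n
    root = Inverse.to comps

    component : Fin n → Fin m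
    component = Inverse.from comps

    component-root : ∀ c → component (root c) ≡ c
    component-root c = Inverse.inverseʳ comps ε

    root-path : ∀ v → EqClosure (Joined G) (root (component v)) v
    root-path v = Inverse.inverseˡ comps refl

    component-connects : ∀ {e u v} → Connects e u v → component u ≡ component v
    component-connects {e} (inj₁ (refl , refl)) = Inverse.from-cong comps (fwd (e , refl) ◅ ε)
    component-connects {e} (inj₂ (refl , refl)) = Inverse.from-cong comps (bwd (e , refl) ◅ ε)

  root-injective : Injective _≡_ _≡_ root
  root-injective eq = trans (sym (component-root _)) (trans (cong component eq) (component-root _))

  component-mate : ∀ v → component v ≡ component (mate v)
  component-mate v = component-connects (connects-mate v)

  baseComponent : Fin m
  baseComponent = component base

  baseRoot baseMate : Fin n
  baseRoot = root baseComponent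
  baseMate = mate baseRoot

  IsRoot : Pred (Fin n) _
  IsRoot v = root (component v) ≡ v

  isRoot? : Decidable IsRoot
  isRoot? v = root (component v) Finₚ.≟ v

  root-isRoot : ∀ c → IsRoot (root c)
  root-isRoot c = cong root (component-root c)

  isRoot-injective : ∀ {u v} → IsRoot u → IsRoot v → component u ≡ component v → u ≡ v
  isRoot-injective ru rv eq = trans (sym ru) (trans (cong root eq) rv)

  component-baseMate : component baseMate ≡ baseComponent
  component-baseMate = trans (sym (component-mate baseRoot)) (component-root baseComponent)

  baseMate-notRoot : ¬ IsRoot baseMate
  baseMate-notRoot eq = side-mate baseRoot (cong side (trans (sym (cong root component-baseMate)) eq))

  -- The vertices at which a normalised parameter is unconstrained; at roots and at `baseMate` it is
  -- 1.
  Free : Pred (Fin n) _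
  Free v = ¬ IsRoot v × v ≢ baseMate

  free? : Decidable Free
  free? v = ¬? (isRoot? v) ×-dec ¬? (v Finₚ.≟ baseMate)

  -- The other vertices are the m roots and `baseMate`. The latter is no root: it lies in the base
  -- component, on the side opposite to `baseRoot`.
  card-free : ∀ {c} → Enumerates Free c → c ≡ n ∸ m ∸ 1
  card-free {c} E = let (b , F) = enumerate (¬? ∘ free?) in sym (begin
    n ∸ m ∸ 1            ≡⟨ ℕₚ.∸-+-assoc n m 1 ⟩
    n ∸ (m + 1)          ≡⟨ cong (n ∸_) (ℕₚ.+-comm m 1) ⟩
    n ∸ suc m            ≡⟨ cong₂ _∸_ (card-complement free? E F) (card-bound F) ⟨
    c + b ∸ b            ≡⟨ ℕₚ.m+n∸n≡m c b ⟩
    c                    ∎)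
    where
    open ≡-Reasoning
    label : ∀ v → ¬ Free v → Fin (suc m)
    label v _ with v Finₚ.≟ baseMate
    ... | yes _ = zero
    ... | no  _ = suc (component v)
    root-of : ∀ v → ¬ Free v → v ≢ baseMate → IsRoot v
    root-of v ¬free v≢ with isRoot? v
    ... | yes r = r
    ... | no ¬r = ⊥-elim (¬free (¬r , v≢))
    label-injective : ∀ {u v} fu fv → label u fu ≡ label v fv → u ≡ v
    label-injective {u} {v} fu fv eq with u Finₚ.≟ baseMate | v Finₚ.≟ baseMate
    ... | yes refl | yes refl = refl
    ... | no u≢    | no v≢    = isRoot-injective (root-of u fu u≢) (root-of v fv v≢) (Finₚ.suc-injective eq)
    ... | yes _    | no _     = ⊥-elim (Finₚ.0≢1+n eq)
    ... | no _     | yes _    = ⊥-elim (Finₚ.0≢1+n (sym eq))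
    fixed : Fin (suc m) → Fin n
    fixed zero    = baseMate
    fixed (suc c) = root c
    fixed-notFree : ∀ i → ¬ Free (fixed i)
    fixed-notFree zero    (_ , neq) = neq refl
    fixed-notFree (suc c) (¬r , _)  = ¬r (root-isRoot c)
    fixed-injective : Injective _≡_ _≡_ fixed
    fixed-injective {zero}  {zero}  _  = refl
    fixed-injective {suc c} {suc d} eq = cong suc (root-injective eq)
    fixed-injective {zero}  {suc d} eq = ⊥-elim (baseMate-notRoot (subst IsRoot (sym eq) (root-isRoot d)))
    fixed-injective {suc c} {zero}  eq = ⊥-elim (baseMate-notRoot (subst IsRoot eq (root-isRoot c)))
    card-bound : ∀ {b} → Enumerates (∁ Free) b → b ≡ suc m
    card-bound F = card-unique F label label-injective fixed fixed-notFree fixed-injective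

  -- The two sides

  OnLeft : Pred (Fin n) _
  OnLeft v = side v ≡ true

  onLeft? : Decidable OnLeft
  onLeft? v = side v Boolₚ.≟ true

  mate-left : ∀ v → ¬ OnLeft v → OnLeft (mate v)
  mate-left v ¬l = trans (Boolₚ.¬-not (side-mate v ∘ sym)) (cong not (Boolₚ.¬-not ¬l))

  mate-right : ∀ v → OnLeft v → ¬ OnLeft (mate v)
  mate-right v l l′ = side-mate v (trans l (sym l′))

  -- `mate` is injective and exchanges the two sides, so each holds half of the vertices.
  card-left : ∀ {a k} → n ≡ 2 * k → Enumerates OnLeft a → a ≡ k
  card-left {a} {k} n≡2k E = let (b , F) = enumerate (¬? ∘ onLeft?) in
    ℕₚ.*-cancelˡ-≡ a k 2 (begin
      a + (a + 0)  ≡⟨ cong (λ x → a + x) (ℕₚ.+-identityʳ a) ⟩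
      a + a        ≡⟨ cong (λ x → a + x) (a≡b F) ⟩
      a + b        ≡⟨ card-complement onLeft? E F ⟩
      n            ≡⟨ n≡2k ⟩
      2 * k        ∎)
    where
    open ≡-Reasoning
    a≡b : ∀ {b} → Enumerates (∁ OnLeft) b → a ≡ b
    a≡b F = ℕₚ.≤-antisym
      (card-≤ E (λ v l → F.index (mate-right v l)) (λ {u} {v} lu lv eq → mate-injective
        (trans (sym (F.at-index (mate-right u lu))) (trans (cong F.at eq) (F.at-index (mate-right v lv))))))
      (card-≤ F (λ v l → E.index (mate-left v l)) (λ {u} {v} lu lv eq → mate-injective
        (trans (sym (E.at-index (mate-left u lu))) (trans (cong E.at eq) (E.at-index (mate-left v lv))))))
      where
      module E = Enumerates E
      module F = Enumerates F

  module Left {k} (L : Enumerates OnLeft k) where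
    private module L = Enumerates L

    left : Fin k → Fin n
    left = L.at

    leftIndex : ∀ {v} → OnLeft v → Fin k
    leftIndex = L.index

    left-leftIndex : ∀ {v} (l : OnLeft v) → left (leftIndex l) ≡ v
    left-leftIndex = L.at-index

    left-onLeft : ∀ i → OnLeft (left i)
    left-onLeft = L.holds

    left-injective : Injective _≡_ _≡_ left
    left-injective = L.at-injective

    leftIndex-left : ∀ {i} (l : OnLeft (left i)) → leftIndex l ≡ i
    leftIndex-left l = left-injective (left-leftIndex l)

    leftEnd : ∀ e → ∃ λ i → ∃ λ v → Connects e (left i) v × ¬ OnLeft v
    leftEnd e with onLeft? (proj₁ (ends e))
    ... | yes l = leftIndex l , proj₂ (ends e) , inj₁ (sym (left-leftIndex l) , refl) ,
                  (λ l′ → proj₂ bipartite e (trans l (sym l′)))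
    ... | no ¬l = leftIndex l′ , proj₁ (ends e) , inj₂ (refl , sym (left-leftIndex l′)) , ¬l
      where
      l′ : OnLeft (proj₂ (ends e))
      l′ = trans (Boolₚ.¬-not (proj₂ bipartite e ∘ sym)) (cong not (Boolₚ.¬-not ¬l))

    matched : Fin k → Fin s
    matched i = matchingEdge (left i)

    matched-covers : ∀ v → ∃ λ i → v ≡ left i ⊎ v ≡ mate (left i)
    matched-covers v with onLeft? v
    ... | yes l = leftIndex l , inj₁ (sym (left-leftIndex l))
    ... | no ¬l = leftIndex (mate-left v ¬l) ,
      inj₂ (trans (sym (mate-involutive v)) (cong mate (sym (left-leftIndex (mate-left v ¬l)))))

    matchingEdge-matched : ∀ v → ∃ λ i → matchingEdge v ≡ matched i
    matchingEdge-matched v with matched-covers v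
    ... | i , inj₁ eq = i , cong matchingEdge eq
    ... | i , inj₂ eq = i , trans (cong matchingEdge eq) (matchingEdge-mate (left i))

    -- On a matching edge with a root, a normalised parameter is 1 at that end and the edge value
    -- gives the other. On an unrooted one, the value at one end has to be recorded.
    Unrooted : Pred (Fin k) _
    Unrooted i = ¬ IsRoot (left i) × ¬ IsRoot (mate (left i))

    unrooted? : Decidable Unrooted
    unrooted? i = ¬? (isRoot? (left i)) ×-dec ¬? (isRoot? (mate (left i)))

    rooted : ∀ {i} → ¬ Unrooted i → IsRoot (left i) ⊎ IsRoot (mate (left i))
    rooted {i} ¬u with isRoot? (left i) | isRoot? (mate (left i))
    ... | yes r | _      = inj₁ r
    ... | no _  | yes r  = inj₂ r
    ... | no ¬r | no ¬r′ = ⊥-elim (¬u (¬r , ¬r′))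

    -- Both ends of a matching edge lie in one component, so it carries at most one root, and every
    -- root lies on one matching edge. The edges with a root thus correspond to the m components.
    card-unrooted : ∀ {c} → Enumerates Unrooted c → c ≡ k ∸ m
    card-unrooted {c} E = let (b , F) = enumerate (¬? ∘ unrooted?) in sym (begin
      k ∸ m      ≡⟨ cong₂ _∸_ (card-complement unrooted? E F) (card-rooted F) ⟨
      c + b ∸ b  ≡⟨ ℕₚ.m+n∸n≡m c b ⟩
      c          ∎)
      where
      open ≡-Reasoning
      label-injective : ∀ {i j} → ¬ Unrooted i → ¬ Unrooted j → component (left i) ≡ component (left j) → i ≡ j
      label-injective {i} {j} ui uj eq with rooted ui | rooted uj
      ... | inj₁ ri | inj₁ rj = left-injective (isRoot-injective ri rj eq)
      ... | inj₂ ri | inj₂ rj = left-injective (mate-injective (isRoot-injective ri rj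
        (trans (sym (component-mate (left i))) (trans eq (component-mate (left j))))))
      ... | inj₁ ri | inj₂ rj = ⊥-elim (mate-right (left j) (left-onLeft j) (subst OnLeft
        (isRoot-injective ri rj (trans eq (component-mate (left j)))) (left-onLeft i)))
      ... | inj₂ ri | inj₁ rj = ⊥-elim (mate-right (left i) (left-onLeft i) (subst OnLeft
        (sym (isRoot-injective ri rj (trans (sym (component-mate (left i))) eq))) (left-onLeft j)))
      edgeOf : Fin m → Fin k
      edgeOf c = proj₁ (matched-covers (root c))
      edgeOf-rooted : ∀ c → ¬ Unrooted (edgeOf c)
      edgeOf-rooted c (¬r , ¬r′) with proj₂ (matched-covers (root c))
      ... | inj₁ eq = ¬r (subst IsRoot eq (root-isRoot c))
      ... | inj₂ eq = ¬r′ (subst IsRoot eq (root-isRoot c))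
      component-edgeOf : ∀ c → component (left (edgeOf c)) ≡ c
      component-edgeOf c with proj₂ (matched-covers (root c))
      ... | inj₁ eq = trans (cong component (sym eq)) (component-root c)
      ... | inj₂ eq = trans (component-mate _) (trans (cong component (sym eq)) (component-root c))
      card-rooted : ∀ {b} → Enumerates (∁ Unrooted) b → b ≡ m
      card-rooted F = card-unique F (λ i _ → component (left i)) label-injective edgeOf edgeOf-rooted
        (λ {c} {d} eq → trans (sym (component-edgeOf c)) (trans (cong (component ∘ left) eq) (component-edgeOf d)))

-- The toric set of the graph and its codes

module Toric {c ℓ p} (K : FiniteField c ℓ (suc (suc p))) {n-1 s-1 m r : ℕ} (G : SimpleGraph (suc n-1) (suc s-1))
  (bipartite : IsBipartite G) (matching : HasPerfectMatching G) (comps : HasCardinality (components G) m)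
  (base : Fin (suc n-1)) (L : Enumerates (MatchedGraph.OnLeft G bipartite matching comps base) (suc r)) where
  private
    n = suc n-1
    Q = suc p
  open FiniteField K hiding (zero)
  open ToricCodes K
  open OverField K
  open SemiringIdentities commutativeSemiring
  open import Algebra.Definitions.RawSemiring
    (CommutativeSemiring.rawSemiring commutativeSemiring) using (_^_)
  open import Algebra.Properties.Ring ring using (-0#≈0#)
  open import Algebra.Properties.Semiring.Sum semiring using (sum; sum-cong-≋)
  open import Algebra.Properties.CommutativeMonoid.Sum ℤₚ.+-0-commutativeMonoid using (sum⁺-syntax)
  open import Relation.Binary.Reasoning.Setoid setoid
  open SimpleGraph G
  open MatchedGraph G bipartite matching comps base
  open Left L

  X : Pred (Point s-1) _
  X = toricSet G

  edgeValue : (Fin n → Carrier) → Fin (suc s-1) → Carrier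
  edgeValue t e = t (proj₁ (ends e)) * t (proj₂ (ends e))

  edgeValue-connects : ∀ t {e u v} → Connects e u v → edgeValue t e ≈ t u * t v
  edgeValue-connects t (inj₁ (≡.refl , ≡.refl)) = refl
  edgeValue-connects t (inj₂ (≡.refl , ≡.refl)) = *-comm _ _

  -- At the edge between baseRoot and baseMate the two sides agree, so a = 1;
  -- then equality spreads from the roots along paths.
  rigidity : ∀ (t t′ : Fin n → Carrier) → (∀ v → ¬ (t v ≈ 0#)) → ∀ a →
    (∀ e → edgeValue t e ≈ a * edgeValue t′ e) →
    (∀ c → t (root c) ≈ t′ (root c)) → t baseMate ≈ t′ baseMate → ∀ v → t v ≈ t′ v
  rigidity t t′ t≉0 a scaled roots mates v = spread (root-path v) (roots (component v))
    where
    a≈1 : a ≈ 1#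
    a≈1 = sym (*-cancelʳ (*-nonzero (t≉0 baseRoot) (t≉0 baseMate)) (begin
      1# * (t baseRoot * t baseMate)          ≈⟨ *-identityˡ _ ⟩
      t baseRoot * t baseMate                 ≈⟨ edgeValue-connects t (connects-mate baseRoot) ⟨
      edgeValue t e                           ≈⟨ scaled e ⟩
      a * edgeValue t′ e                      ≈⟨ *-congˡ (edgeValue-connects t′ (connects-mate baseRoot)) ⟩
      a * (t′ baseRoot * t′ baseMate)         ≈⟨ *-congˡ (*-cong (roots baseComponent) mates) ⟨
      a * (t baseRoot * t baseMate)           ∎))
      where e = matchingEdge baseRoot
    step : ∀ {e u v} → Connects e u v → t u ≈ t′ u → t v ≈ t′ v
    step {e} {u} {v} con tu≈ = *-cancelˡ (t≉0 u) (begin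
      t u * t v            ≈⟨ edgeValue-connects t con ⟨
      edgeValue t e        ≈⟨ scaled e ⟩
      a * edgeValue t′ e   ≈⟨ *-cong a≈1 (edgeValue-connects t′ con) ⟩
      1# * (t′ u * t′ v)   ≈⟨ *-identityˡ _ ⟩
      t′ u * t′ v          ≈⟨ *-congʳ tu≈ ⟨
      t u * t′ v           ∎)
    spread : ∀ {u v} → EqClosure (Joined G) u v → t u ≈ t′ u → t v ≈ t′ v
    spread ε              eq = eq
    spread (fwd (e , ≡.refl) ◅ path) eq = spread path (step (connects-ends e) eq)
    spread (bwd (e , ≡.refl) ◅ path) eq = spread path (step (connects-sym (connects-ends e)) eq)

  -- Normal forms of parameters

  module _ (t : Fin n → Carrier) (t≉0 : ∀ v → ¬ (t v ≈ 0#)) where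
    private
      μ : Carrier
      μ = t baseRoot * t baseMate

      μ≉0 : ¬ (μ ≈ 0#)
      μ≉0 = *-nonzero (t≉0 baseRoot) (t≉0 baseMate)

      -- The factor applied to t in the component with root ρ: 1 / t(ρ) on the side of ρ and t(ρ) /
      -- μ on the other. It makes the roots 1 and divides every edge product by μ; the choice of μ
      -- makes `baseMate` 1 as well.
      gauge : Fin n → Bool → Carrier
      gauge r true  = t r ⁻¹
      gauge r false = t r * μ ⁻¹

      gauge-nonzero : ∀ r b → ¬ (gauge r b ≈ 0#)
      gauge-nonzero r true  = ⁻¹-nonzero (t≉0 r)
      gauge-nonzero r false = *-nonzero (t≉0 r) (⁻¹-nonzero μ≉0)

      gauge-opposite : ∀ r → gauge r true * gauge r false ≈ μ ⁻¹
      gauge-opposite r = begin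
        t r ⁻¹ * (t r * μ ⁻¹)  ≈⟨ *-assoc _ _ _ ⟨
        t r ⁻¹ * t r * μ ⁻¹    ≈⟨ *-congʳ (⁻¹-inverseˡ (t≉0 r)) ⟩
        1# * μ ⁻¹              ≈⟨ *-identityˡ _ ⟩
        μ ⁻¹                   ∎

      sameSide : Fin n → Bool
      sameSide v = does (side v Boolₚ.≟ side (root (component v)))

      gauge-pair : ∀ r {a b} x → a ≢ b → gauge r (does (a Boolₚ.≟ x)) * gauge r (does (b Boolₚ.≟ x)) ≈ μ ⁻¹
      gauge-pair r {true}  {true}  _     neq = ⊥-elim (neq ≡.refl)
      gauge-pair r {false} {false} _     neq = ⊥-elim (neq ≡.refl)
      gauge-pair r {true}  {false} true  _   = gauge-opposite r
      gauge-pair r {true}  {false} false _   = trans (*-comm _ _) (gauge-opposite r)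
      gauge-pair r {false} {true}  true  _   = trans (*-comm _ _) (gauge-opposite r)
      gauge-pair r {false} {true}  false _   = gauge-opposite r

      correction : Fin n → Carrier
      correction v = gauge (root (component v)) (sameSide v)

      correction-connects : ∀ {e u v} → Connects e u v → correction u * correction v ≈ μ ⁻¹
      correction-connects {e} {u} {v} con = trans
        (*-congʳ (reflexive (≡.cong (λ c → gauge (root c) (does (side u Boolₚ.≟ side (root c)))) (component-connects con))))
        (gauge-pair (root (component v)) (side (root (component v))) (connects-side con))

    abstract
      normalForm : Fin n → Carrier
      normalForm v = t v * correction v

      normalForm-nonzero : ∀ v → ¬ (normalForm v ≈ 0#)
      normalForm-nonzero v = *-nonzero (t≉0 v) (gauge-nonzero _ (sameSide v))

      normalForm-root : ∀ c → normalForm (root c) ≈ 1#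
      normalForm-root c = trans
        (*-congˡ (reflexive (≡.cong₂ gauge (root-isRoot c) (dec-true (side (root c) Boolₚ.≟ _) (≡.cong side (≡.sym (root-isRoot c)))))))
        (*-inverseʳ _ (t≉0 (root c)))

      normalForm-baseMate : normalForm baseMate ≈ 1#
      normalForm-baseMate = begin
        t baseMate * correction baseMate
          ≈⟨ *-congˡ (reflexive (≡.cong₂ gauge (≡.cong root component-baseMate)
               (dec-false (side baseMate Boolₚ.≟ _) (λ eq → side-mate baseRoot (≡.sym (≡.trans eq (≡.cong (side ∘ root) component-baseMate))))))) ⟩
        t baseMate * (t baseRoot * μ ⁻¹)  ≈⟨ *-assoc _ _ _ ⟨
        t baseMate * t baseRoot * μ ⁻¹    ≈⟨ *-congʳ (*-comm _ _) ⟩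
        μ * μ ⁻¹                          ≈⟨ *-inverseʳ μ μ≉0 ⟩
        1#                                ∎

      normalForm-scaled : ∀ e → edgeValue t e ≈ μ * edgeValue normalForm e
      normalForm-scaled e = sym (begin
        μ * (tu * gu * (tv * gv))  ≈⟨ *-congˡ (*-interchange tu gu tv gv) ⟩
        μ * (tu * tv * (gu * gv))  ≈⟨ *-congˡ (*-congˡ (correction-connects (connects-ends e))) ⟩
        μ * (tu * tv * μ ⁻¹)       ≈⟨ *-swap μ (tu * tv) (μ ⁻¹) ⟩
        tu * tv * (μ * μ ⁻¹)       ≈⟨ *-congˡ (*-inverseʳ μ μ≉0) ⟩
        tu * tv * 1#               ≈⟨ *-identityʳ _ ⟩
        tu * tv                    ∎)
        where
        tu tv gu gv : Carrier
        tu = t (proj₁ (ends e))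
        tv = t (proj₂ (ends e))
        gu = correction (proj₁ (ends e))
        gv = correction (proj₂ (ends e))

    normalForm-∼ : edgePoint G t t≉0 ∼ edgePoint G normalForm normalForm-nonzero
    normalForm-∼ = μ , μ≉0 , normalForm-scaled

  parameter : ∀ {P} → X P → Fin n → Carrier
  parameter (t , t≉0 , _) = normalForm t t≉0

  parameter-nonzero : ∀ {P} (XP : X P) v → ¬ (parameter {P} XP v ≈ 0#)
  parameter-nonzero (t , t≉0 , _) = normalForm-nonzero t t≉0

  parameter-root : ∀ {P} (XP : X P) c → parameter {P} XP (root c) ≈ 1#
  parameter-root (t , t≉0 , _) = normalForm-root t t≉0

  parameter-baseMate : ∀ {P} (XP : X P) → parameter {P} XP baseMate ≈ 1#
  parameter-baseMate (t , t≉0 , _) = normalForm-baseMate t t≉0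

  parameter-∼ : ∀ {P} (XP : X P) → P ∼ edgePoint G (parameter {P} XP) (parameter-nonzero {P} XP)
  parameter-∼ {P} (t , t≉0 , P∼) = ∼-trans {P = P} {edgePoint G t t≉0}
    {edgePoint G (normalForm t t≉0) (normalForm-nonzero t t≉0)} P∼ (normalForm-∼ t t≉0)

  edgePoint∈X : ∀ t t≉0 → X (edgePoint G t t≉0)
  edgePoint∈X t t≉0 = t , t≉0 , ∼-refl (edgePoint G t t≉0)

  edgePoint-cong : ∀ {t t′ t≉0 t′≉0} → (∀ v → t v ≈ t′ v) → edgePoint G t t≉0 ∼ edgePoint G t′ t′≉0
  edgePoint-cong eq = 1# , 1≉0 , λ e → trans (*-cong (eq _) (eq _)) (sym (*-identityˡ _))

  X⊆𝕋 : ∀ {P} → X P → 𝕋 s-1 P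
  X⊆𝕋 (t , t≉0 , (a , a≉0 , eq)) e = nonzero-cong (sym (eq e)) (*-nonzero a≉0 (*-nonzero (t≉0 _) (t≉0 _)))

  Normalised : (Fin n → Carrier) → Set ℓ
  Normalised t = (∀ c → t (root c) ≈ 1#) × t baseMate ≈ 1#

  normalised-unique : ∀ {t t′ t≉0 t′≉0} → Normalised t → Normalised t′ →
    edgePoint G t t≉0 ∼ edgePoint G t′ t′≉0 → ∀ v → t v ≈ t′ v
  normalised-unique {t} {t′} {t≉0} (roots , mates) (roots′ , mates′) (a , _ , eq) =
    rigidity t t′ t≉0 a eq (λ c → trans (roots c) (sym (roots′ c))) (trans mates (sym mates′))

  parameter-normalised : ∀ {P} (XP : X P) → Normalised (parameter {P} XP)
  parameter-normalised {P} XP = parameter-root {P} XP , parameter-baseMate {P} XP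

  parameter-unique : ∀ {P t t≉0} (XP : X P) → Normalised t → P ∼ edgePoint G t t≉0 → ∀ v → parameter {P} XP v ≈ t v
  parameter-unique {P} {t} {t≉0} XP norm P∼ = normalised-unique {t≉0 = parameter-nonzero {P} XP} {t≉0} (parameter-normalised {P} XP) norm
    (∼-trans {P = edgePoint G (parameter {P} XP) (parameter-nonzero {P} XP)} {P} {edgePoint G t t≉0}
      (∼-sym {P = P} {edgePoint G (parameter {P} XP) (parameter-nonzero {P} XP)} (parameter-∼ {P} XP)) P∼)

  -- Membership in X carries an arbitrary parameter and the point an arbitrary representative; the
  -- normal form depends on neither.
  parameter-cong : ∀ {P P′} (XP : X P) (XP′ : X P′) → P ∼ P′ → ∀ v → parameter {P} XP v ≈ parameter {P′} XP′ v
  parameter-cong {P} {P′} XP XP′ P∼P′ = parameter-unique {P} {t≉0 = parameter-nonzero {P′} XP′} XP (parameter-normalised {P′} XP′)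
    (∼-trans {P = P} {P′} {edgePoint G (parameter {P′} XP′) (parameter-nonzero {P′} XP′)} P∼P′ (parameter-∼ {P′} XP′))

  -- The length

  module _ {c} (F : Enumerates Free c) where
    private module F = Enumerates F

    fill : (Fin c → Fin Q) → Fin n → Carrier
    fill x v with free? v
    ... | yes f = unit (x (F.index f))
    ... | no  _ = 1#

    fill-nonzero : ∀ x v → ¬ (fill x v ≈ 0#)
    fill-nonzero x v with free? v
    ... | yes f = unit-nonzero _
    ... | no  _ = 1≉0

    fill-free : ∀ x l → fill x (F.at l) ≈ unit (x l)
    fill-free x l with free? (F.at l)
    ... | yes f = reflexive (≡.cong (unit ∘ x) (F.at-injective (F.at-index f)))
    ... | no ¬f = ⊥-elim (¬f (F.holds l))

    fill-normalised : ∀ x → Normalised (fill x)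
    fill-normalised x = fill-root , fill-baseMate
      where
      fill-root : ∀ c → fill x (root c) ≈ 1#
      fill-root c with free? (root c)
      ... | yes (¬r , _) = ⊥-elim (¬r (root-isRoot c))
      ... | no _ = refl
      fill-baseMate : fill x baseMate ≈ 1#
      fill-baseMate with free? baseMate
      ... | yes (_ , neq) = ⊥-elim (neq ≡.refl)
      ... | no _ = refl

    -- x is described pointwise because encoding a function as a number and decoding it gives back
    -- the function only pointwise.
    fill-parameter : ∀ (t : Fin n → Carrier) (t≉0 : ∀ v → ¬ (t v ≈ 0#)) → Normalised t → ∀ x →
      (∀ l → x l ≡ unitIndex (t (F.at l)) (t≉0 _)) → ∀ v → fill x v ≈ t v
    fill-parameter t t≉0 (roots , mates) x x≡ v with free? v
    ... | yes f = trans (reflexive (≡.cong unit (x≡ (F.index f))))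
      (trans (unit-unitIndex _) (reflexive (≡.cong t (F.at-index f))))
    ... | no ¬f with isRoot? v | v Finₚ.≟ baseMate
    ...   | yes r | _      = trans (sym (roots _)) (reflexive (≡.cong t r))
    ...   | no _  | yes eq = trans (sym mates) (reflexive (≡.cong t (≡.sym eq)))
    ...   | no ¬r | no neq = ⊥-elim (¬f (¬r , neq))

    filledPoint : Fin (Q ℕ.^ c) → Point s-1
    filledPoint i = edgePoint G (fill (Fin.finToFun {Q} {c} i)) (fill-nonzero _)

    freeValues : ∀ {P} → X P → Fin c → Fin Q
    freeValues {P} XP l = unitIndex (parameter {P} XP (F.at l)) (parameter-nonzero {P} XP _)

    -- Filling the free vertices with units, and reading the normalised parameter of a point at the
    -- free vertices, are inverse to each other.
    X-enumeration : HasCardinality (pointsOf X) (Q ℕ.^ c)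
    X-enumeration = record
      { to        = λ i → filledPoint i , edgePoint∈X _ (fill-nonzero _)
      ; from      = λ (P , XP) → Fin.funToFin (freeValues {P} XP)
      ; to-cong   = λ { {i} ≡.refl → ∼-refl (filledPoint i) }
      ; from-cong = λ { {P , XP} {P′ , XP′} P∼P′ → funToFin-cong (λ l →
          unitIndex-cong _ _ (parameter-cong {P} {P′} XP XP′ P∼P′ (F.at l))) }
      ; inverse   = (λ { {P , XP} ≡.refl → surjective P XP }) , λ { {i} {P , XP} P∼ → injective i P XP P∼ }
      }
      where
      surjective : ∀ P (XP : X P) → filledPoint (Fin.funToFin (freeValues {P} XP)) ∼ P
      surjective P XP = ∼-trans {P = filledPoint (Fin.funToFin (freeValues {P} XP))} {E} {P}
        (edgePoint-cong {fill x} {parameter {P} XP} {fill-nonzero x} {parameter-nonzero {P} XP}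
          (fill-parameter (parameter {P} XP) (parameter-nonzero {P} XP) (parameter-normalised {P} XP) x
            (Finₚ.finToFun-funToFin (freeValues {P} XP))))
        (∼-sym {P = P} {E} (parameter-∼ {P} XP))
        where
        E = edgePoint G (parameter {P} XP) (parameter-nonzero {P} XP)
        x = Fin.finToFun {Q} {c} (Fin.funToFin (freeValues {P} XP))
      injective : ∀ i P (XP : X P) → P ∼ filledPoint i → Fin.funToFin (freeValues {P} XP) ≡ i
      injective i P XP P∼ = ≡.trans
        (funToFin-cong {f = freeValues {P} XP} {Fin.finToFun {Q} {c} i} (λ l → unit-injective (begin
          unit (freeValues {P} XP l)             ≈⟨ unit-unitIndex _ ⟩
          parameter {P} XP (F.at l)              ≈⟨ parameter-unique {P} {t≉0 = fill-nonzero _} XP (fill-normalised _) P∼ (F.at l) ⟩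
          fill (Fin.finToFun {Q} {c} i) (F.at l) ≈⟨ fill-free _ l ⟩
          unit (Fin.finToFun {Q} {c} i l)        ∎)))
        (Finₚ.funToFin-finToFin {c} {Q} i)

  -- Points with parameter 1 on the right-hand side

  module _ (y : Fin (suc r) → Carrier) where

    sideParameter : Fin n → Carrier
    sideParameter v with onLeft? v
    ... | yes l = y (leftIndex l)
    ... | no  _ = 1#

    sideParameter-left : ∀ i → sideParameter (left i) ≈ y i
    sideParameter-left i with onLeft? (left i)
    ... | yes l = reflexive (≡.cong y (leftIndex-left l))
    ... | no ¬l = ⊥-elim (¬l (left-onLeft i))

    sideParameter-right : ∀ {v} → ¬ OnLeft v → sideParameter v ≈ 1#
    sideParameter-right {v} ¬l with onLeft? v
    ... | yes l = ⊥-elim (¬l l)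
    ... | no  _ = refl

    sideParameter-edge : ∀ {e v} i → Connects e (left i) v → ¬ OnLeft v → edgeValue sideParameter e ≈ y i
    sideParameter-edge {e} {v} i con ¬l = begin
      edgeValue sideParameter e                 ≈⟨ edgeValue-connects sideParameter con ⟩
      sideParameter (left i) * sideParameter v  ≈⟨ *-cong (sideParameter-left i) (sideParameter-right ¬l) ⟩
      y i * 1#                                  ≈⟨ *-identityʳ _ ⟩
      y i                                       ∎

    sideParameter-matched : ∀ i → edgeValue sideParameter (matched i) ≈ y i
    sideParameter-matched i = sideParameter-edge i (connects-mate (left i)) (mate-right _ (left-onLeft i))

    sideParameter-leftEnd : ∀ e → edgeValue sideParameter e ≈ y (proj₁ (leftEnd e))
    sideParameter-leftEnd e = let (i , _ , con , ¬l) = leftEnd e in sideParameter-edge i con ¬l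

    sideParameter-nonzero : (∀ i → ¬ (y i ≈ 0#)) → ∀ v → ¬ (sideParameter v ≈ 0#)
    sideParameter-nonzero y≉0 v with onLeft? v
    ... | yes l = y≉0 _
    ... | no  _ = 1≉0

    sidePoint : (∀ i → ¬ (y i ≈ 0#)) → Point s-1
    sidePoint y≉0 = edgePoint G sideParameter (sideParameter-nonzero y≉0)

    sidePoint∈X : ∀ y≉0 → X (sidePoint y≉0)
    sidePoint∈X y≉0 = edgePoint∈X sideParameter (sideParameter-nonzero y≉0)

  affinePoint-nonzero : ∀ v i → ¬ (affinePoint {r} v i ≈ 0#)
  affinePoint-nonzero v zero    = 1≉0
  affinePoint-nonzero v (suc i) = unit-nonzero _

  torusPoint : Vec (Fin Q) r → Point s-1
  torusPoint v = sidePoint (affinePoint v) (affinePoint-nonzero v)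

  torusPoint∈X : ∀ v → X (torusPoint v)
  torusPoint∈X v = sidePoint∈X (affinePoint v) (affinePoint-nonzero v)

  -- The coordinate at `matched zero` is 1 for both points, which forces the scalar to be 1; the
  -- other matching edges then give the entries.
  torusPoint-injective : ∀ v w → torusPoint v ∼ torusPoint w → v ≡ w
  torusPoint-injective v w (a , _ , eq) = ≡.trans (≡.sym (Vecₚ.tabulate∘lookup v))
    (≡.trans (Vecₚ.tabulate-cong (λ i → unit-injective (entries i))) (Vecₚ.tabulate∘lookup w))
    where
    matched-eq : ∀ i → affinePoint v i ≈ a * affinePoint w i
    matched-eq i = trans (sym (sideParameter-matched (affinePoint v) i))
      (trans (eq (matched i)) (*-congˡ (sideParameter-matched (affinePoint w) i)))
    a≈1 : a ≈ 1#
    a≈1 = sym (trans (matched-eq zero) (*-identityʳ a))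
    entries : ∀ i → units v i ≈ units w i
    entries i = begin
      units v i      ≈⟨ matched-eq (suc i) ⟩
      a * units w i  ≈⟨ *-congʳ a≈1 ⟩
      1# * units w i ≈⟨ *-identityˡ _ ⟩
      units w i      ∎

  -- On the points torusPoint v the variable X_e is a coordinate of affinePoint v,
  -- so a polynomial in the edges becomes one of the same degree on the torus.
  leftExponent : Fin (suc s-1) → Exponent (suc r)
  leftExponent e = variableExponent (proj₁ (leftEnd e))

  evaluate-torusPoint : ∀ f v → evaluate (substitute leftExponent f) (affinePoint v) ≈ evaluate f (coord (torusPoint v))
  evaluate-torusPoint f v = trans (evaluate-substitute leftExponent f (affinePoint v)) (evaluate-cong f (λ e →
    trans (monomial-variable (affinePoint v) (proj₁ (leftEnd e))) (sym (sideParameter-leftEnd (affinePoint v) e))))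

  -- The indicator of `torusPoint ones` is pulled back along the embedding of the torus. No other
  -- torus point is equivalent to that one, so the pullback is an indicator of `ones` and
  -- `indicator-degree` applies.
  regularity-lower : ∀ {N} (P : Enumeration X N) d → HasHilbertValue X d N → r ℕ.* p ≤ d
  regularity-lower {N} P d HV = ℕₚ.≤-trans (indicator-degree degree at-ones elsewhere) (ℕₚ.≤-reflexive (ℕₚ.*-identityˡ d))
    where
    i₀ : Fin N
    i₀ = position P (torusPoint∈X ones)
    indicator : ∃ λ f → Homogeneous d f × ¬ (evaluate f (coord (representative P i₀)) ≈ 0#) ×
      (∀ j → j ≢ i₀ → evaluate f (coord (representative P j)) ≈ 0#)
    indicator = HilbertValue⇒indicator P d HV i₀
    f : Polynomial (suc s-1)
    f = proj₁ indicator
    hom : Homogeneous d f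
    hom = proj₁ (proj₂ indicator)
    g : Polynomial (suc r)
    g = substitute leftExponent (homogeneousPart d f)
    degree : OfDegree (1 ℕ.* d) g
    degree = substitute-degree leftExponent 1 d (λ e → sum-variableExponent (proj₁ (leftEnd e))) (homogeneousPart-degree d f)
    g-value : ∀ v → evaluate g (affinePoint v) ≈ evaluate f (coord (torusPoint v))
    g-value v = trans (evaluate-torusPoint (homogeneousPart d f) v) (sym (evaluate-homogeneousPart d f hom _))
    at-ones : ¬ (evaluate g (affinePoint ones) ≈ 0#)
    at-ones = nonzero-cong (sym (g-value ones)) (evaluate-∼ f hom {representative P i₀} {torusPoint ones}
      (position-∼ P {torusPoint ones} (torusPoint∈X ones)) (proj₁ (proj₂ (proj₂ indicator))))
    elsewhere : ∀ v → v ≢ ones → evaluate g (affinePoint v) ≈ 0#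
    elsewhere v v≢ = trans (g-value v) (decidable-stable (_ ≟ _) (λ f≉0 →
      evaluate-∼ f hom {torusPoint v} {representative P j} (∼-sym {P = representative P j} {torusPoint v} (position-∼ P {torusPoint v} (torusPoint∈X v))) f≉0
        (proj₂ (proj₂ (proj₂ indicator)) j (λ j≡i₀ → v≢ (torusPoint-injective v ones
          (position-injective P (torusPoint∈X v) (torusPoint∈X ones) j≡i₀))))))
      where
      j : Fin N
      j = position P (torusPoint∈X v)

  -- Monomials in the matching edges

  matchedExponent : Fin (suc r) → Exponent (suc s-1)
  matchedExponent i = variableExponent (matched i)

  evaluate-matched : ∀ f x → evaluate (substitute matchedExponent f) x ≈ evaluate f (x ∘ matched)
  evaluate-matched f x = trans (evaluate-substitute matchedExponent f x) (evaluate-cong f (λ i → monomial-variable x (matched i)))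

  substitute-matched-degree : ∀ {d f} → OfDegree d f → OfDegree d (substitute matchedExponent f)
  substitute-matched-degree {d} deg = ≡.subst (λ d → OfDegree d _) (ℕₚ.*-identityˡ d)
    (substitute-degree matchedExponent 1 d (λ i → sum-variableExponent (matched i)) deg)

  module _ {N} (P : Enumeration X N) (d : ℕ) where
    private
      αs = box p r d
      h  = List.length αs

      -- The r edges `matched (suc i)` carry the exponents from the box, and `matched zero` takes up
      -- what is missing to degree d.
      poly : (Fin h → Carrier) → Polynomial (suc s-1)
      poly a = substitute matchedExponent (homogenise d (fromCoefficients αs a))

      poly-degree : ∀ a → OfDegree d (poly a)
      poly-degree a = substitute-matched-degree (homogenise-degree (fromCoefficients-All αs a (box-sum p r d)))

      poly-value : ∀ a v → evaluate (poly a) (coord (torusPoint v)) ≈ evaluate (fromCoefficients αs a) (units v)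
      poly-value a v = begin
        evaluate (poly a) (coord (torusPoint v))
          ≈⟨ evaluate-matched (homogenise d (fromCoefficients αs a)) (coord (torusPoint v)) ⟩
        evaluate (homogenise d (fromCoefficients αs a)) (coord (torusPoint v) ∘ matched)
          ≈⟨ evaluate-cong (homogenise d (fromCoefficients αs a)) (sideParameter-matched (affinePoint v)) ⟩
        evaluate (homogenise d (fromCoefficients αs a)) (affinePoint v)
          ≈⟨ evaluate-homogenise d (fromCoefficients αs a) v ⟩
        evaluate (fromCoefficients αs a) (units v) ∎

      denominator : Fin N → Carrier
      denominator i = (coord (representative P i) zero ^ d) ⁻¹

      denominator-nonzero : ∀ i → ¬ (denominator i ≈ 0#)
      denominator-nonzero i = ⁻¹-nonzero (^-nonzero d (X⊆𝕋 {representative P i} (representative∈ P i) zero))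

      word : (Fin h → Carrier) → Fin N → Carrier
      word a i = evaluate (poly a) (coord (representative P i)) * denominator i

      word∈code : ∀ a → code P d (word a)
      word∈code a = poly a , OfDegree⇒Homogeneous (poly-degree a) , λ i → refl

      word-injective : ∀ a b → (∀ i → word a i ≈ word b i) → ∀ i → a i ≈ b i
      word-injective a b eq = fromCoefficients-injective αs (box-unique p r d) (box-small p r d) a b same
        where
        same : ∀ v → evaluate (fromCoefficients αs a) (units v) ≈ evaluate (fromCoefficients αs b) (units v)
        -- The numbering chose some multiple u of `torusPoint v`, which contributes the factor u^d
        -- on both sides.
        same v = *-cancelˡ (^-nonzero d u≉0) (begin
          u ^ d * evaluate (fromCoefficients αs a) (units v)   ≈⟨ dilated a ⟨
          evaluate (poly a) (coord (representative P j))  ≈⟨ *-cancelʳ (denominator-nonzero j) (eq j) ⟩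
          evaluate (poly b) (coord (representative P j))  ≈⟨ dilated b ⟩
          u ^ d * evaluate (fromCoefficients αs b) (units v)   ∎)
          where
          j : Fin N
          j = position P (torusPoint∈X v)
          near : representative P j ∼ torusPoint v
          near = position-∼ P {torusPoint v} (torusPoint∈X v)
          u : Carrier
          u = proj₁ near
          u≉0 : ¬ (u ≈ 0#)
          u≉0 = proj₁ (proj₂ near)
          dilated : ∀ a → evaluate (poly a) (coord (representative P j)) ≈ u ^ d * evaluate (fromCoefficients αs a) (units v)
          dilated a = trans (evaluate-cong (poly a) (proj₂ (proj₂ near)))
            (trans (evaluate-dilate (poly-degree a) u (coord (torusPoint v))) (*-congˡ (poly-value a v)))

    -- The coordinates of a word in the spanning family determine the word, which determines its
    -- coefficients a. They need not depend linearly on a, since only an injection between finite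
    -- sets is needed.
    box-≤-dimension : ∀ dim → HasDimension (K^ N) (code P d) dim → h ≤ dim
    box-≤-dimension dim (b , _ , _ , spanning) = injective⇒dimension-≤ coordinates
      (λ a a′ eq → word-injective a a′ (λ j → begin
        word a j                                     ≈⟨ recover a j ⟩
        linearCombination (K^ N) (coordinates a) b j  ≈⟨ linearCombination-K^ {N} (coordinates a) b j ⟩
        sum (λ i → coordinates a i * b i j)           ≈⟨ sum-cong-≋ {_} {λ i → coordinates a i * b i j} {λ i → coordinates a′ i * b i j} (λ i → *-congʳ (eq i)) ⟩
        sum (λ i → coordinates a′ i * b i j)          ≈⟨ linearCombination-K^ {N} (coordinates a′) b j ⟨
        linearCombination (K^ N) (coordinates a′) b j ≈⟨ recover a′ j ⟨
        word a′ j                                    ∎))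
      where
      coordinates : (Fin h → Carrier) → Fin dim → Carrier
      coordinates a = proj₁ (spanning (word a) (word∈code a))
      recover : ∀ a j → word a j ≈ linearCombination (K^ N) (coordinates a) b j
      recover a j = difference-zero⇒≈ (proj₂ (spanning (word a) (word∈code a)) j)

    dimension-lower : ∀ dim → HasDimension (K^ N) (code P d) dim →
      (∑[ j ≤ ⌊ d ÷ Q ⌋ ] alternatingTerm p r r d (toℕ j)) ℤ.≤ + dim
    dimension-lower dim hd = ≡.subst (ℤ._≤ + dim) (≡.trans (length-box p r d) (series-closed p r r d)) (+≤+ (box-≤-dimension dim hd))

  -- Projection to the matching edges

  matchedPoint : ∀ P → 𝕋 s-1 P → Point r
  matchedPoint P TP = record { coord = coord P ∘ matched ; nonzero = λ all≈0 → TP (matched zero) (all≈0 zero) }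

  matchedPoint-∼ : ∀ P P′ TP TP′ → P ∼ P′ → matchedPoint P TP ∼ matchedPoint P′ TP′
  matchedPoint-∼ P P′ TP TP′ (a , a≉0 , eq) = a , a≉0 , eq ∘ matched

  -- The matching edge at `baseRoot` has value 1 for both parameters, so a = 1. On each matching
  -- edge the product of the ends then agrees, and so does one of the ends: it is a root, or `agree`
  -- provides it.
  matched-rigidity : ∀ (t t′ : Fin n → Carrier) → (∀ v → ¬ (t v ≈ 0#)) → Normalised t → Normalised t′ → ∀ a →
    (∀ i → edgeValue t (matched i) ≈ a * edgeValue t′ (matched i)) →
    (∀ i → Unrooted i → t (left i) ≈ t′ (left i)) → ∀ v → t v ≈ t′ v
  matched-rigidity t t′ t≉0 norm norm′ a scaled agree v = [ (λ eq → at eq (proj₁ (both i))) , (λ eq → at eq (proj₂ (both i))) ]′ (proj₂ (matched-covers v))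
    where
    i : Fin (suc r)
    i = proj₁ (matched-covers v)
    at : ∀ {u v} → v ≡ u → t u ≈ t′ u → t v ≈ t′ v
    at ≡.refl eq = eq
    base-edge : ∀ t → Normalised t → edgeValue t (matchingEdge baseRoot) ≈ 1#
    base-edge t (roots , mates) = trans (edgeValue-connects t (connects-mate baseRoot))
      (trans (*-cong (roots baseComponent) mates) (*-identityˡ 1#))
    i₀ : Fin (suc r)
    i₀ = proj₁ (matchingEdge-matched baseRoot)
    base-matched : ∀ t → Normalised t → edgeValue t (matched i₀) ≈ 1#
    base-matched t norm = trans (reflexive (≡.cong (edgeValue t) (≡.sym (proj₂ (matchingEdge-matched baseRoot))))) (base-edge t norm)
    a≈1 : a ≈ 1#
    a≈1 = sym (begin
      1#                              ≈⟨ base-matched t norm ⟨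
      edgeValue t (matched i₀)        ≈⟨ scaled i₀ ⟩
      a * edgeValue t′ (matched i₀)   ≈⟨ *-congˡ (base-matched t′ norm′) ⟩
      a * 1#                          ≈⟨ *-identityʳ a ⟩
      a                               ∎)
    pair : ∀ i → t (left i) * t (mate (left i)) ≈ t′ (left i) * t′ (mate (left i))
    pair i = begin
      t (left i) * t (mate (left i))    ≈⟨ edgeValue-connects t (connects-mate (left i)) ⟨
      edgeValue t (matched i)           ≈⟨ scaled i ⟩
      a * edgeValue t′ (matched i)      ≈⟨ *-cong a≈1 (edgeValue-connects t′ (connects-mate (left i))) ⟩
      1# * (t′ (left i) * t′ (mate (left i))) ≈⟨ *-identityˡ _ ⟩
      t′ (left i) * t′ (mate (left i))  ∎
    at-root : ∀ v → IsRoot v → t v ≈ t′ v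
    at-root v root≡ = at (≡.sym root≡) (trans (proj₁ norm (component v)) (sym (proj₁ norm′ (component v))))
    both-from-left : ∀ i → t (left i) ≈ t′ (left i) → t (left i) ≈ t′ (left i) × t (mate (left i)) ≈ t′ (mate (left i))
    both-from-left i eq = eq , *-cancelˡ (t≉0 (left i)) (trans (pair i) (*-congʳ (sym eq)))
    both-from-mate : ∀ i → t (mate (left i)) ≈ t′ (mate (left i)) → t (left i) ≈ t′ (left i) × t (mate (left i)) ≈ t′ (mate (left i))
    both-from-mate i eq = *-cancelʳ (t≉0 (mate (left i))) (trans (pair i) (*-congˡ (sym eq))) , eq
    both : ∀ i → t (left i) ≈ t′ (left i) × t (mate (left i)) ≈ t′ (mate (left i))
    both i = byCases (unrooted? i)
      where
      byCases : Dec (Unrooted i) → t (left i) ≈ t′ (left i) × t (mate (left i)) ≈ t′ (mate (left i))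
      byCases (yes u) = both-from-left i (agree i u)
      byCases (no ¬u) = [ both-from-left i ∘ at-root (left i) , both-from-mate i ∘ at-root (mate (left i)) ]′ (rooted ¬u)

  module _ {D} (U : Enumerates Unrooted D) where
    private module U = Enumerates U

    fibreLabel : ∀ P → X P → Fin (Q ℕ.^ D)
    fibreLabel P XP = Fin.funToFin (λ l → unitIndex (parameter {P} XP (left (U.at l))) (parameter-nonzero {P} XP _))

    fibreLabel-injective : ∀ P P′ (XP : X P) (XP′ : X P′) →
      matchedPoint P (X⊆𝕋 {P} XP) ∼ matchedPoint P′ (X⊆𝕋 {P′} XP′) → fibreLabel P XP ≡ fibreLabel P′ XP′ → P ∼ P′
    fibreLabel-injective P P′ XP XP′ near labels = ∼-trans {P = P} {E′} {P′}
      (∼-trans {P = P} {E} {E′} (parameter-∼ {P} XP) (edgePoint-cong {t} {t′} {parameter-nonzero {P} XP} {parameter-nonzero {P′} XP′}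
        (matched-rigidity t t′ (parameter-nonzero {P} XP) (parameter-normalised {P} XP) (parameter-normalised {P′} XP′)
          (proj₁ nearE) (proj₂ (proj₂ nearE)) agree)))
      (∼-sym {P = P′} {E′} (parameter-∼ {P′} XP′))
      where
      t t′ : Fin n → Carrier
      t  = parameter {P} XP
      t′ = parameter {P′} XP′
      E E′ : Point s-1
      E  = edgePoint G t (parameter-nonzero {P} XP)
      E′ = edgePoint G t′ (parameter-nonzero {P′} XP′)
      TP : 𝕋 s-1 P
      TP = X⊆𝕋 {P} XP
      TP′ : 𝕋 s-1 P′
      TP′ = X⊆𝕋 {P′} XP′
      TE : 𝕋 s-1 E
      TE = X⊆𝕋 {E} (edgePoint∈X t (parameter-nonzero {P} XP))
      TE′ : 𝕋 s-1 E′
      TE′ = X⊆𝕋 {E′} (edgePoint∈X t′ (parameter-nonzero {P′} XP′))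
      nearE : matchedPoint E TE ∼ matchedPoint E′ TE′
      nearE = ∼-trans {P = matchedPoint E TE} {matchedPoint P TP} {matchedPoint E′ TE′}
        (matchedPoint-∼ E P TE TP (∼-sym {P = P} {E} (parameter-∼ {P} XP)))
        (∼-trans {P = matchedPoint P TP} {matchedPoint P′ TP′} {matchedPoint E′ TE′} near
          (matchedPoint-∼ P′ E′ TP′ TE′ (parameter-∼ {P′} XP′)))
      agree : ∀ i → Unrooted i → t (left i) ≈ t′ (left i)
      agree i u = ≡.subst (λ i → t (left i) ≈ t′ (left i)) (U.at-index u)
        (unitIndex-injective _ _ (funToFin-injective labels (U.index u)))

  -- The minimum distance

  -- A word of minimum weight on the torus is pulled back along the projection; at most Q^D points
  -- of X lie above each point of its support. The pullback is not zero because `sidePoint` lifts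
  -- every torus point.
  distance-upper : ∀ {N N′ D} (U : Enumerates Unrooted D) (P : Enumeration X N) (P′ : Enumeration (𝕋 r) N′) d {δ δ′} →
    IsMinimumDistance (code P d) δ → IsMinimumDistance (code P′ d) δ′ → δ ≤ (Q ℕ.^ D) ℕ.* δ′
  distance-upper {N} {N′} {D} U P P′ d {δ} {δ′} minimum minimum′ = bound (minimumWord P′ (λ x Tx → Tx) d minimum′)
    where
    module _ (f : Polynomial (suc r)) (deg : OfDegree d f) where
      g : Polynomial (suc s-1)
      g = substitute matchedExponent f
      X𝕋 : ∀ x → X x → 𝕋 s-1 x
      X𝕋 x = X⊆𝕋 {x}
      shadow : Fin N → Point r
      shadow i = matchedPoint (representative P i) (X𝕋 (representative P i) (representative∈ P i))
      shadow∈ : ∀ i → 𝕋 r (shadow i)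
      shadow∈ i l = X𝕋 (representative P i) (representative∈ P i) (matched l)
      weights : weight (codeWord P X𝕋 d g) ≤ weight (codeWord P′ (λ x Tx → Tx) d f) ℕ.* (Q ℕ.^ D)
      weights = weight-≤ (codeWord P X𝕋 d g) (codeWord P′ (λ x Tx → Tx) d f)
        (λ i _ → position P′ {shadow i} (shadow∈ i))
        (λ i w≉0 → codeWord-nonzero P′ (λ x Tx → Tx) d f _ (evaluate-∼ f (OfDegree⇒Homogeneous deg) {shadow i} {representative P′ (position P′ {shadow i} (shadow∈ i))}
          (∼-sym {P = representative P′ (position P′ {shadow i} (shadow∈ i))} {shadow i} (position-∼ P′ {shadow i} (shadow∈ i)))
          (nonzero-cong (evaluate-matched f (coord (representative P i))) (nonzero-factorˡ w≉0))))
        (λ i → fibreLabel U (representative P i) (representative∈ P i))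
        (λ {i} {j} _ _ same label → representative-injective P (fibreLabel-injective U (representative P i) (representative P j)
          (representative∈ P i) (representative∈ P j)
          (position-injective P′ {shadow i} {shadow j} (shadow∈ i) (shadow∈ j) same) label))
      lower : ∀ i → ¬ (evaluate f (coord (representative P′ i)) ≈ 0#) → δ ≤ weight (codeWord P X𝕋 d g)
      lower i f≉0 = minimumDistance-≤ P X𝕋 d minimum g (substitute-matched-degree deg) (sidePoint y y≉0) (sidePoint∈X y y≉0)
        (nonzero-cong (sym (trans (evaluate-matched f _) (evaluate-cong f (sideParameter-matched y)))) f≉0)
        where
        y : Fin (suc r) → Carrier
        y = coord (representative P′ i)
        y≉0 : ∀ l → ¬ (y l ≈ 0#)
        y≉0 = representative∈ P′ i
    bound : (∃ λ f → OfDegree d f × (∃ λ i → ¬ (evaluate f (coord (representative P′ i)) ≈ 0#)) × weight (codeWord P′ (λ x Tx → Tx) d f) ≤ δ′) →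
            δ ≤ (Q ℕ.^ D) ℕ.* δ′
    bound (f , deg , (i , f≉0) , w≤) = ℕₚ.≤-trans (lower f deg i f≉0) (ℕₚ.≤-trans (weights f deg)
      (ℕₚ.≤-trans (ℕₚ.*-monoˡ-≤ (Q ℕ.^ D) w≤) (ℕₚ.≤-reflexive (ℕₚ.*-comm δ′ (Q ℕ.^ D)))))

  endsExponent : Fin (suc s-1) → Exponent n
  endsExponent e = Vec.zipWith ℕ._+_ (variableExponent (proj₁ (ends e))) (variableExponent (proj₂ (ends e)))

  sum-endsExponent : ∀ e → Vec.sum (endsExponent e) ≡ 2
  sum-endsExponent e = ≡.trans (sum-zipWith-+ (variableExponent (proj₁ (ends e))) (variableExponent (proj₂ (ends e))))
    (≡.cong₂ ℕ._+_ (sum-variableExponent (proj₁ (ends e))) (sum-variableExponent (proj₂ (ends e))))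

  evaluate-ends : ∀ f x → evaluate (substitute endsExponent f) x ≈ evaluate f (edgeValue x)
  evaluate-ends f x = trans (evaluate-substitute endsExponent f x) (evaluate-cong f (λ e →
    trans (monomial-+ x (variableExponent (proj₁ (ends e))) (variableExponent (proj₂ (ends e))))
      (*-cong (monomial-variable x (proj₁ (ends e))) (monomial-variable x (proj₂ (ends e))))))

  -- The values of a parameter at these vertices, relative to baseRoot,
  -- determine it up to scaling within its fibre over X.
  labelVertex : Fin m → Fin n
  labelVertex c = if does (c Finₚ.≟ baseComponent) then baseMate else root c

  labelVertex-base : labelVertex baseComponent ≡ baseMate
  labelVertex-base = ≡.cong (λ b → if b then baseMate else root baseComponent) (dec-true (baseComponent Finₚ.≟ baseComponent) ≡.refl)

  labelVertex-root : ∀ c → c ≢ baseComponent → labelVertex c ≡ root c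
  labelVertex-root c c≢ = ≡.cong (λ b → if b then baseMate else root c) (dec-false (c Finₚ.≟ baseComponent) c≢)

  module _ (x : Point n-1) (Tx : 𝕋 n-1 x) where

    edgeMap : Point s-1
    edgeMap = edgePoint G (coord x) Tx

    ratio : Fin m → Carrier
    ratio c = coord x (labelVertex c) * coord x baseRoot ⁻¹

    ratio-nonzero : ∀ c → ¬ (ratio c ≈ 0#)
    ratio-nonzero c = *-nonzero (Tx _) (⁻¹-nonzero (Tx baseRoot))

    torusLabel : Fin (Q ℕ.^ m)
    torusLabel = Fin.funToFin (λ c → unitIndex (ratio c) (ratio-nonzero c))

  -- Scale x by κ so that it agrees with x′ at `baseRoot`. The labels then give agreement at the
  -- other roots and at `baseMate`. Edge products are quadratic, so `rigidity` is applied with the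
  -- factor κ² a.
  torusLabel-injective : ∀ x x′ Tx Tx′ → edgeMap x Tx ∼ edgeMap x′ Tx′ → torusLabel x Tx ≡ torusLabel x′ Tx′ → x ∼ x′
  torusLabel-injective x x′ Tx Tx′ (a , a≉0 , eq) labels = ∼-sym {P = x′} {x} (κ , κ≉0 , λ v →
    trans (sym (rigidity τ (coord x′) (λ v → *-nonzero (Tx v) κ≉0) (κ * κ * a) scaled roots mates v)) (*-comm _ _))
    where
    b b′ κ : Carrier
    b  = coord x baseRoot
    b′ = coord x′ baseRoot
    κ  = b ⁻¹ * b′
    κ≉0 : ¬ (κ ≈ 0#)
    κ≉0 = *-nonzero (⁻¹-nonzero (Tx baseRoot)) (Tx′ baseRoot)
    τ : Fin n → Carrier
    τ v = coord x v * κ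
    scaled : ∀ e → edgeValue τ e ≈ κ * κ * a * edgeValue (coord x′) e
    scaled e = begin
      (xu * κ) * (xv * κ)                      ≈⟨ *-interchange xu κ xv κ ⟩
      xu * xv * (κ * κ)                        ≈⟨ *-comm _ _ ⟩
      κ * κ * (xu * xv)                        ≈⟨ *-congˡ (eq e) ⟩
      κ * κ * (a * edgeValue (coord x′) e)     ≈⟨ *-assoc _ _ _ ⟨
      κ * κ * a * edgeValue (coord x′) e       ∎
      where
      xu xv : Carrier
      xu = coord x (proj₁ (ends e))
      xv = coord x (proj₂ (ends e))
    at-label : ∀ c → τ (labelVertex c) ≈ coord x′ (labelVertex c)
    at-label c = begin
      coord x l * (b ⁻¹ * b′)            ≈⟨ *-assoc _ _ _ ⟨
      coord x l * b ⁻¹ * b′              ≈⟨ *-congʳ (unitIndex-injective _ _ (funToFin-injective labels c)) ⟩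
      coord x′ l * b′ ⁻¹ * b′            ≈⟨ *-assoc _ _ _ ⟩
      coord x′ l * (b′ ⁻¹ * b′)          ≈⟨ *-congˡ (⁻¹-inverseˡ (Tx′ baseRoot)) ⟩
      coord x′ l * 1#                    ≈⟨ *-identityʳ _ ⟩
      coord x′ l                         ∎
      where
      l : Fin n
      l = labelVertex c
    mates : τ baseMate ≈ coord x′ baseMate
    mates = ≡.subst (λ v → τ v ≈ coord x′ v) labelVertex-base (at-label baseComponent)
    base-root : τ baseRoot ≈ coord x′ baseRoot
    base-root = begin
      b * (b ⁻¹ * b′)  ≈⟨ *-assoc _ _ _ ⟨
      b * b ⁻¹ * b′    ≈⟨ *-congʳ (*-inverseʳ b (Tx baseRoot)) ⟩
      1# * b′          ≈⟨ *-identityˡ b′ ⟩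
      b′               ∎
    roots : ∀ c → τ (root c) ≈ coord x′ (root c)
    roots c = byCases (c Finₚ.≟ baseComponent)
      where
      byCases : Dec (c ≡ baseComponent) → τ (root c) ≈ coord x′ (root c)
      byCases (yes c≡) = ≡.subst (λ c → τ (root c) ≈ coord x′ (root c)) (≡.sym c≡) base-root
      byCases (no  c≢) = ≡.subst (λ v → τ v ≈ coord x′ v) (labelVertex-root c c≢) (at-label c)

  -- Pulling a minimum word back along the edge map doubles its degree, and `torusLabel` bounds the
  -- fibres. The pullback is nonzero at any parameter, normalised or not, of a point where f is
  -- nonzero.
  distance-lower : ∀ {N N′} (P : Enumeration X N) (P′ : Enumeration (𝕋 n-1) N′) d {δ δ′} →
    IsMinimumDistance (code P d) δ → IsMinimumDistance (code P′ (2 ℕ.* d)) δ′ → δ′ ≤ δ ℕ.* (Q ℕ.^ m)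
  distance-lower {N} {N′} P P′ d {δ} {δ′} minimum minimum′ = bound (minimumWord P X𝕋 d minimum)
    where
    X𝕋 : ∀ x → X x → 𝕋 s-1 x
    X𝕋 x = X⊆𝕋 {x}
    module _ (f : Polynomial (suc s-1)) (deg : OfDegree d f) where
      g : Polynomial n
      g = substitute endsExponent f
      image : Fin N′ → Point s-1
      image i = edgeMap (representative P′ i) (representative∈ P′ i)
      image∈ : ∀ i → X (image i)
      image∈ i = edgePoint∈X (coord (representative P′ i)) (representative∈ P′ i)
      weights : weight (codeWord P′ (λ x Tx → Tx) (2 ℕ.* d) g) ≤ weight (codeWord P X𝕋 d f) ℕ.* (Q ℕ.^ m)
      weights = weight-≤ (codeWord P′ (λ x Tx → Tx) (2 ℕ.* d) g) (codeWord P X𝕋 d f)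
        (λ i _ → position P {image i} (image∈ i))
        (λ i w≉0 → codeWord-nonzero P X𝕋 d f _ (evaluate-∼ f (OfDegree⇒Homogeneous deg) {image i} {representative P (position P {image i} (image∈ i))}
          (∼-sym {P = representative P (position P {image i} (image∈ i))} {image i} (position-∼ P {image i} (image∈ i)))
          (nonzero-cong (evaluate-ends f (coord (representative P′ i))) (nonzero-factorˡ w≉0))))
        (λ i → torusLabel (representative P′ i) (representative∈ P′ i))
        (λ {i} {j} _ _ same label → representative-injective P′ (torusLabel-injective (representative P′ i) (representative P′ j)
          (representative∈ P′ i) (representative∈ P′ j)
          (position-injective P {image i} {image j} (image∈ i) (image∈ j) same) label))
      lower : ∀ i → ¬ (evaluate f (coord (representative P i)) ≈ 0#) → δ′ ≤ weight (codeWord P′ (λ x Tx → Tx) (2 ℕ.* d) g)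
      lower i f≉0 = minimumDistance-≤ P′ (λ x Tx → Tx) (2 ℕ.* d) minimum′ g (substitute-degree endsExponent 2 d sum-endsExponent deg)
        x t≉0 (nonzero-cong (sym (evaluate-ends f (coord x))) (evaluate-∼ f (OfDegree⇒Homogeneous deg) {R} {edgePoint G t t≉0} R∼ f≉0))
        where
        R : Point s-1
        R = representative P i
        t : Fin n → Carrier
        t = proj₁ (representative∈ P i)
        t≉0 : ∀ v → ¬ (t v ≈ 0#)
        t≉0 = proj₁ (proj₂ (representative∈ P i))
        R∼ : R ∼ edgePoint G t t≉0
        R∼ = proj₂ (proj₂ (representative∈ P i))
        x : Point n-1
        x = record { coord = t ; nonzero = λ all≈0 → t≉0 base (all≈0 base) }
    bound : (∃ λ f → OfDegree d f × (∃ λ i → ¬ (evaluate f (coord (representative P i)) ≈ 0#)) × weight (codeWord P X𝕋 d f) ≤ δ) →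
            δ′ ≤ δ ℕ.* (Q ℕ.^ m)
    bound (f , deg , (i , f≉0) , w≤) = ℕₚ.≤-trans (lower f deg i f≉0) (ℕₚ.≤-trans (weights f deg)
      (ℕₚ.*-monoˡ-≤ (Q ℕ.^ m) w≤))

  -- Indicator polynomials on X

  module _ {N D} (P : Enumeration X N) (U : Enumerates Unrooted D) where
    private
      x : Fin N → Fin (suc s-1) → Carrier
      x i = coord (representative P i)

      x∈ : ∀ i → X (representative P i)
      x∈ = representative∈ P

      x≉0 : ∀ i e → ¬ (x i e ≈ 0#)
      x≉0 i = X⊆𝕋 {representative P i} (x∈ i)

      shadow : Fin N → Point r
      shadow i = matchedPoint (representative P i) (x≉0 i)

    -- shadow j ∼ shadow i, cross-multiplied so that it is decidable.
    SameFibre : Fin N → Pred (Fin N) _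
    SameFibre i j = ∀ l → x j (matched l) * x i (matched zero) ≈ x i (matched l) * x j (matched zero)

    sameFibre? : ∀ i → Decidable (SameFibre i)
    sameFibre? i j = Finₚ.all? (λ l → (x j (matched l) * x i (matched zero)) ≟ (x i (matched l) * x j (matched zero)))

    sameFibre-∼ : ∀ i j → SameFibre i j → shadow j ∼ shadow i
    sameFibre-∼ i j same = x j (matched zero) * x i (matched zero) ⁻¹ ,
      *-nonzero (x≉0 j _) (⁻¹-nonzero (x≉0 i _)) , λ l → *-cancelʳ (x≉0 i (matched zero)) (begin
        x j (matched l) * x i (matched zero)      ≈⟨ same l ⟩
        x i (matched l) * x j (matched zero)      ≈⟨ *-comm _ _ ⟩
        xj₀ * x i (matched l)                    ≈⟨ *-congʳ (*-identityʳ (xj₀)) ⟨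
        xj₀ * 1# * x i (matched l)               ≈⟨ *-congʳ (*-congˡ (⁻¹-inverseˡ (x≉0 i (matched zero)))) ⟨
        xj₀ * (xi₀ ⁻¹ * xi₀) * x i (matched l) ≈⟨ move-last (xj₀) (xi₀ ⁻¹) (xi₀) (x i (matched l)) ⟩
        xj₀ * xi₀ ⁻¹ * x i (matched l) * xi₀   ∎)
      where
      xj₀ xi₀ : Carrier
      xj₀ = x j (matched zero)
      xi₀ = x i (matched zero)

    sameFibre-card : ∀ i {c} → Enumerates (SameFibre i) c → c ≤ Q ℕ.^ D
    sameFibre-card i F = card-≤ F (λ j _ → fibreLabel U (representative P j) (x∈ j)) (λ {j} {j′} fj fj′ labels →
      representative-injective P (fibreLabel-injective U (representative P j) (representative P j′) (x∈ j) (x∈ j′)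
        (∼-trans {P = shadow j} {shadow i} {shadow j′} (sameFibre-∼ i j fj) (∼-sym {P = shadow j′} {shadow i} (sameFibre-∼ i j′ fj′))) labels))

    module _ (i : Fin N) {c} (F : Enumerates (SameFibre i) (suc c)) where
      private module F = Enumerates F

      slope : Fin r → Carrier
      slope l = x i (matched (suc l)) * x i (matched zero) ⁻¹

      slope-nonzero : ∀ l → ¬ (slope l ≈ 0#)
      slope-nonzero l = *-nonzero (x≉0 i _) (⁻¹-nonzero (x≉0 i _))

      slopeIndex : Fin r → Fin Q
      slopeIndex l = unitIndex (slope l) (slope-nonzero l)

      lineForm : Fin r → Carrier → Form (suc s-1)
      lineForm l u = 1# , matched (suc l) , u , matched zero

      -- For each l, one form for each of the p units other than the slope at the i-th point. A
      -- point off its fibre has another slope at some l and is a zero of one of these r p forms.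
      wrongSlope : Fin (r ℕ.* p) → Form (suc s-1)
      wrongSlope w = lineForm (Fin.quotient p w) (unit (Fin.punchIn (slopeIndex (Fin.quotient p w)) (Fin.remainder {r} p w)))

      lineForm-zero : ∀ j l u → formValue (x j) (lineForm l u) ≈ 0# → x j (matched (suc l)) * x j (matched zero) ⁻¹ ≈ u
      lineForm-zero j l u eq = *-cancelʳ (x≉0 j (matched zero)) (begin
        x j (matched (suc l)) * x j (matched zero) ⁻¹ * x j (matched zero)    ≈⟨ *-assoc _ _ _ ⟩
        x j (matched (suc l)) * (x j (matched zero) ⁻¹ * x j (matched zero))  ≈⟨ *-congˡ (⁻¹-inverseˡ (x≉0 j (matched zero))) ⟩
        x j (matched (suc l)) * 1#                                            ≈⟨ *-comm _ _ ⟩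
        1# * x j (matched (suc l))                                            ≈⟨ difference-zero⇒≈ eq ⟩
        u * x j (matched zero)                                                ∎)

      zero-lineForm : ∀ j l u → x j (matched (suc l)) * x j (matched zero) ⁻¹ ≈ u → formValue (x j) (lineForm l u) ≈ 0#
      zero-lineForm j l u eq = ≈⇒difference-zero (begin
        1# * x j (matched (suc l))                                            ≈⟨ *-comm _ _ ⟩
        x j (matched (suc l)) * 1#                                            ≈⟨ *-congˡ (⁻¹-inverseˡ (x≉0 j (matched zero))) ⟨
        x j (matched (suc l)) * (x j (matched zero) ⁻¹ * x j (matched zero))  ≈⟨ *-assoc _ _ _ ⟨
        x j (matched (suc l)) * x j (matched zero) ⁻¹ * x j (matched zero)    ≈⟨ *-congʳ eq ⟩
        u * x j (matched zero)                                                ∎)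

      wrongSlope-nonzero : ∀ w → ¬ (formValue (x i) (wrongSlope w) ≈ 0#)
      wrongSlope-nonzero w eq = Finₚ.punchInᵢ≢i (slopeIndex l) z (unit-injective
        (trans (sym (lineForm-zero i l (unit (Fin.punchIn (slopeIndex l) z)) eq)) (sym (unit-unitIndex (slope-nonzero l)))))
        where
        l : Fin r
        l = Fin.quotient p w
        z : Fin p
        z = Fin.remainder {r} p w

      wrongSlope-zero : ∀ j → ¬ SameFibre i j → ∃ λ w → formValue (x j) (wrongSlope w) ≈ 0#
      wrongSlope-zero j ¬same = find (Finₚ.¬∀⟶∃¬ (suc r) _ (λ l → (x j (matched l) * x i (matched zero)) ≟ (x i (matched l) * x j (matched zero))) ¬same)
        where
        find : (∃ λ l → ¬ (x j (matched l) * x i (matched zero) ≈ x i (matched l) * x j (matched zero))) →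
               ∃ λ w → formValue (x j) (wrongSlope w) ≈ 0#
        -- At the edge `matched zero` the cross-multiplied equation is commutativity, so a
        -- difference shows up at a later edge.
        find (zero  , neq) = ⊥-elim (neq (*-comm _ _))
        find (suc l , neq) = Fin.combine l z , ≡.subst (λ (l , z) → formValue (x j) (lineForm l (unit (Fin.punchIn (slopeIndex l) z))) ≈ 0#)
          (≡.sym (Finₚ.remQuot-combine l z)) (zero-lineForm j l _ (sym (trans
            (reflexive (≡.cong unit (Finₚ.punchIn-punchOut differ))) (unit-unitIndex slope′≉0))))
          where
          slope′ : Carrier
          slope′ = x j (matched (suc l)) * x j (matched zero) ⁻¹
          slope′≉0 : ¬ (slope′ ≈ 0#)
          slope′≉0 = *-nonzero (x≉0 j _) (⁻¹-nonzero (x≉0 j _))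
          differ : slopeIndex l ≢ unitIndex slope′ slope′≉0
          differ eq = neq (cross-multiply (x≉0 j _) (x≉0 i _) (sym (unitIndex-injective (slope-nonzero l) slope′≉0 eq)))
          z : Fin p
          z = Fin.punchOut differ

      i∈ : SameFibre i i
      i∈ l = refl

      neighbour : Fin c → Fin N
      neighbour z = F.at (Fin.punchIn (F.index i∈) z)

      neighbour≢ : ∀ z → neighbour z ≢ i
      neighbour≢ z eq = Finₚ.punchInᵢ≢i (F.index i∈) z (F.at-injective (≡.trans eq (≡.sym (F.at-index i∈))))

      separator : ∀ z → ∃ λ l → ¬ (formValue (x i) l ≈ 0#) × formValue (x (neighbour z)) l ≈ 0#
      separator z = separating-form {P = representative P i} {representative P (neighbour z)} (x≉0 i) (x≉0 (neighbour z))
        (λ near → neighbour≢ z (≡.sym (representative-injective P near)))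

      neighbour-covers : ∀ j → j ≢ i → SameFibre i j → ∃ λ z → neighbour z ≡ j
      neighbour-covers j j≢i same = Fin.punchOut differ ,
        ≡.trans (≡.cong F.at (Finₚ.punchIn-punchOut differ)) (F.at-index same)
        where
        differ : F.index i∈ ≢ F.index same
        differ eq = j≢i (≡.trans (≡.sym (F.at-index same)) (≡.trans (≡.cong F.at (≡.sym eq)) (F.at-index i∈)))

      -- X₁ vanishes nowhere on X, so its powers only raise the degree.
      padding : Form (suc s-1)
      padding = 1# , zero , 0# , zero

      padding-nonzero : ¬ (formValue (x i) padding ≈ 0#)
      padding-nonzero = nonzero-cong (sym (begin
        1# * x i zero - 0# * x i zero  ≈⟨ +-cong (*-identityˡ _) (trans (-‿cong (zeroˡ _)) -0#≈0#) ⟩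
        x i zero + 0#                  ≈⟨ +-identityʳ _ ⟩
        x i zero                       ∎)) (x≉0 i zero)

      forms : ℕ → List (Form (suc s-1))
      forms w = List.tabulate wrongSlope ++ List.tabulate (proj₁ ∘ separator) ++ List.replicate w padding

      length-forms : ∀ w → List.length (forms w) ≡ r ℕ.* p ℕ.+ (c ℕ.+ w)
      length-forms w = ≡.trans (Listₚ.length-++ (List.tabulate wrongSlope))
        (≡.cong₂ ℕ._+_ (Listₚ.length-tabulate wrongSlope) (≡.trans (Listₚ.length-++ (List.tabulate (proj₁ ∘ separator)))
          (≡.cong₂ ℕ._+_ (Listₚ.length-tabulate (proj₁ ∘ separator)) (Listₚ.length-replicate w))))

      forms-nonzero : ∀ w → All (λ l → ¬ (formValue (x i) l ≈ 0#)) (forms w)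
      forms-nonzero w = Allₚ.++⁺ (Allₚ.tabulate⁺ wrongSlope-nonzero)
        (Allₚ.++⁺ (Allₚ.tabulate⁺ (λ z → proj₁ (proj₂ (separator z)))) (Allₚ.replicate⁺ w padding-nonzero))

      forms-zero : ∀ w j → j ≢ i → Any (λ l → formValue (x j) l ≈ 0#) (forms w)
      forms-zero w j j≢i = byCases (sameFibre? i j)
        where
        byCases : Dec (SameFibre i j) → Any (λ l → formValue (x j) l ≈ 0#) (forms w)
        byCases (no ¬same) = let (z , eq) = wrongSlope-zero j ¬same in Anyₚ.++⁺ˡ (Anyₚ.tabulate⁺ z eq)
        byCases (yes same) = let (z , eq) = neighbour-covers j j≢i same in
          Anyₚ.++⁺ʳ (List.tabulate wrongSlope) (Anyₚ.++⁺ˡ (Anyₚ.tabulate⁺ z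
            (≡.subst (λ j → formValue (x j) (proj₁ (separator z)) ≈ 0#) eq (proj₂ (proj₂ (separator z))))))

    private
      -- There are r p forms for the slopes and at most Q^D - 1 for the other points of the fibre.
      -- Padding brings the indicators of all points to this common degree.
      d₀ : ℕ
      d₀ = p ℕ.* r ℕ.+ Q ℕ.^ D ℕ.∸ 1

    indicator : ∀ i → ∃ λ f → OfDegree d₀ f × ¬ (evaluate f (x i) ≈ 0#) × (∀ j → j ≢ i → evaluate f (x j) ≈ 0#)
    indicator i = build (proj₂ (enumerate (sameFibre? i)))
      where
      build : ∀ {c} → Enumerates (SameFibre i) c →
        ∃ λ f → OfDegree d₀ f × ¬ (evaluate f (x i) ≈ 0#) × (∀ j → j ≢ i → evaluate f (x j) ≈ 0#)
      build {zero}  F = ⊥-elim (Finₚ.¬Fin0 (Enumerates.index F {i} (λ l → refl)))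
      build {suc c} F = formProduct (forms i F w) ,
        ≡.subst (λ d → OfDegree d (formProduct (forms i F w))) length≡ (formProduct-degree (forms i F w)) ,
        formProduct-nonzero (forms i F w) (x i) (forms-nonzero i F w) ,
        (λ j j≢i → formProduct-zero (forms i F w) (x j) (forms-zero i F w j j≢i))
        where
        w : ℕ
        w = d₀ ℕ.∸ (r ℕ.* p ℕ.+ c)
        fits : r ℕ.* p ℕ.+ c ≤ d₀
        fits = ℕₚ.≤-trans (ℕₚ.≤-reflexive (≡.trans (≡.cong (ℕ._+ c) (ℕₚ.*-comm r p)) (≡.sym (≡.cong (ℕ._∸ 1) (ℕₚ.+-suc (p ℕ.* r) c)))))
          (ℕₚ.∸-monoˡ-≤ 1 (ℕₚ.+-monoʳ-≤ (p ℕ.* r) (sameFibre-card i F)))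
        length≡ : List.length (forms i F w) ≡ d₀
        length≡ = ≡.trans (length-forms i F w) (≡.trans (≡.sym (ℕₚ.+-assoc (r ℕ.* p) c w)) (ℕₚ.m+[n∸m]≡n fits))

    HilbertValue-upper : HasHilbertValue X d₀ N
    HilbertValue-upper = indicators⇒HilbertValue P d₀ (λ i → proj₁ (indicator i))
      (λ i → OfDegree⇒Homogeneous (proj₁ (proj₂ (indicator i))))
      (λ i → proj₁ (proj₂ (proj₂ (indicator i))))
      (λ i j j≢i → proj₂ (proj₂ (proj₂ (indicator i))) j j≢i)

-- Ceilings and the assembly of the four claims

-- For the divisor b + 1, a + b < (c + 1)(b + 1) keeps the quotient below c + 1. For the divisor 0
-- the ceiling is 0 by convention.
⌈÷⌉-≤ : ∀ a b c → a ≤ c ℕ.* b → ⌈ a ÷ b ⌉ ≤ c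
⌈÷⌉-≤ a zero    c h = z≤n
⌈÷⌉-≤ a (suc b) c h = ℕₚ.≤-pred (m<n*o⇒m/o<n {a ℕ.+ b} {suc c} {suc b}
  (s≤s (ℕₚ.≤-trans (ℕₚ.+-monoˡ-≤ b h) (ℕₚ.≤-reflexive (ℕₚ.+-comm (c ℕ.* suc b) b)))))

-- The second factor on the left is n - 1 = 2 r + 1. For p = 0 the left side is 0. Otherwise (q -
-- 1)^m ≥ 2, where m ≥ 1 because `Fin m` is inhabited, so the right side is at least 4 r p; and 2 r
-- + 1 ≤ 4 r for r ≥ 1.
ceiling-numerator-bound : ∀ p r m reg → Fin m → 1 ≤ r → r ℕ.* p ≤ reg →
  p ℕ.* (r ℕ.+ suc (r ℕ.+ 0)) ≤ reg ℕ.* (2 ℕ.* suc p ℕ.^ m)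
ceiling-numerator-bound zero        r       m       reg c _ _ = z≤n
ceiling-numerator-bound p@(suc p′) r@(suc r′) (suc m) reg c _ h = begin
  -- The slack r′ + r is 2 r - 1 = 4 r - (2 r + 1).
  p ℕ.* (r ℕ.+ suc (r ℕ.+ 0))                         ≤⟨ ℕₚ.*-monoʳ-≤ p (ℕₚ.m≤m+n (r ℕ.+ suc (r ℕ.+ 0)) (r′ ℕ.+ r)) ⟩
  p ℕ.* (r ℕ.+ suc (r ℕ.+ 0) ℕ.+ (r′ ℕ.+ r))          ≡⟨ identity p r′ ⟩
  r ℕ.* p ℕ.* (2 ℕ.* 2)                               ≤⟨ ℕₚ.*-mono-≤ h (ℕₚ.*-monoʳ-≤ 2 two≤) ⟩
  reg ℕ.* (2 ℕ.* suc p ℕ.^ suc m)                     ∎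
  where
  open ℕₚ.≤-Reasoning
  two≤ : 2 ≤ suc p ℕ.^ suc m
  two≤ = ℕₚ.*-mono-≤ {2} {suc p} {1} (s≤s (s≤s z≤n)) (ℕₚ.m^n>0 (suc p) m)
  identity : ∀ p r′ → p ℕ.* (suc r′ ℕ.+ suc (suc r′ ℕ.+ 0) ℕ.+ (r′ ℕ.+ suc r′)) ≡ suc r′ ℕ.* p ℕ.* (2 ℕ.* 2)
  identity = ℕSolver.solve-∀

open import Data.Integer.Properties using (+-0-commutativeMonoid)
open import Algebra.Properties.CommutativeMonoid.Sum +-0-commutativeMonoid using (sum⁺-syntax)
open import Data.Nat.Base using (_+_; _*_; _∸_; _^_; NonZero)

theorem3p1 :
    ∀ {c ℓ} (q : ℕ) (K : FiniteField c ℓ q) →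
    let open ToricCodes K in
    ∀ (k s-1 m : ℕ) .{{_ : NonZero k}} →
    let n = 2 * k in
    ∀ (G : SimpleGraph n (suc s-1)) →
    IsBipartite G → HasPerfectMatching G → HasCardinality (components G) m →
    let X = toricSet G in
    -- length
    HasCardinality (pointsOf X) ((q ∸ 1) ^ (n ∸ m ∸ 1))
    -- regularity index; for k = 1 (a single edge, reg = 0) the lower bound
    -- fails as soon as q ≥ 3
    × (∀ reg → IsRegularityIndex X reg →
         (2 ≤ k → ⌈ (q ∸ 2) * (n ∸ 1) ÷ 2 * (q ∸ 1) ^ m ⌉ ≤ reg)
         × reg ≤ (q ∸ 2) * (k ∸ 1) + (q ∸ 1) ^ (k ∸ m) ∸ 1)
    -- dimension
    × (∀ {N} (P : Enumeration X N) d dim → HasDimension (K^ N) (code P d) dim →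
         (∑[ j ≤ ⌊ d ÷ (q ∸ 1) ⌋ ]
           (-1ℤ ℤ.^ toℕ j
             ℤ.* + ((k ∸ 1) C toℕ j)
             ℤ.* + ((k ∸ 1 + (d ∸ toℕ j * (q ∸ 1))) C (k ∸ 1))))
         ℤ.≤ + dim)
    -- minimum distance
    × (∀ {N Nₙ Nₖ} (P : Enumeration X N)
         (Pₙ : Enumeration (𝕋 (n ∸ 1)) Nₙ) (Pₖ : Enumeration (𝕋 (k ∸ 1)) Nₖ)
         d δX δTₙ δTₖ →
         IsMinimumDistance (code P d) δX →
         IsMinimumDistance (code Pₙ (2 * d)) δTₙ →
         IsMinimumDistance (code Pₖ d) δTₖ →
         ⌈ δTₙ ÷ (q ∸ 1) ^ m ⌉ ≤ δX × δX ≤ (q ∸ 1) ^ (k ∸ m) * δTₖ)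
-- A field has at least the two elements 0 and 1, so q is p + 2 in the remaining clauses.
theorem3p1 zero K = ⊥-elim (Finₚ.¬Fin0 (Inverse.from cardinality 0#))
  where open FiniteField K hiding (zero)
theorem3p1 (suc zero) K = ⊥-elim (1≉0 (trans (sym (Inverse.inverseˡ cardinality {1#} only)) (Inverse.inverseˡ cardinality {0#} only)))
  where
  open FiniteField K hiding (zero)
  only : ∀ {x} → zero ≡ Inverse.from cardinality x
  only {x} with zero ← Inverse.from cardinality x = ≡.refl
theorem3p1 (suc (suc p)) K zero s-1 m = ⊥-elim (ℕ.≢-nonZero⁻¹ 0 ≡.refl)
theorem3p1 (suc (suc p)) K k@(suc r) s-1 m G bipartite matching comps =
    ≡.subst (λ c → HasCardinality (pointsOf X) (suc p ^ c)) (card-free F) (X-enumeration F)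
  , (λ reg isReg@((_ , P , HV) , least) →
        (λ { (s≤s 1≤r) → ⌈÷⌉-≤ (p * (n ∸ 1)) (2 * suc p ^ m) reg
          (ceiling-numerator-bound p r m reg baseComponent 1≤r (regularity-lower P reg HV)) })
      , ≡.subst (λ D → reg ≤ p * r + suc p ^ D ∸ 1) (card-unrooted U)
          (least _ (_ , X-enumeration F , HilbertValue-upper (X-enumeration F) U)))
  , dimension-lower
  , (λ P Pₙ Pₖ d δX δTₙ δTₖ minX minₙ minₖ →
        ⌈÷⌉-≤ δTₙ (suc p ^ m) δX (distance-lower P Pₙ d minX minₙ)
      , ≡.subst (λ D → δX ≤ suc p ^ D * δTₖ) (card-unrooted U) (distance-upper U P Pₖ d minX minₖ))
  where
  open ToricCodes K
  n : ℕ
  n = 2 * k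
  -- Vertex 0 exists because n = 2 (r + 1); it selects the base component.
  open MatchedGraph G bipartite matching comps zero
  L : Enumerates OnLeft (suc r)
  L = let (_ , E) = enumerate onLeft? in ≡.subst (Enumerates OnLeft) (card-left ≡.refl E) E
  open Left L
  open Toric K G bipartite matching comps zero L
  F = proj₂ (enumerate free?)
  U = proj₂ (enumerate unrooted?)
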